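{- Fix an integer $r\ge 2$. If $H$ is an $r$-star-flip graph, then $\mathrm{ex}(n,H)=O_H(n^{2-1/r})$; that is, there is a constant $C>0$ depending only on $H$ (and the fixed $r$) such that $\mathrm{ex}(n,H)\le C\,n^{2-1/r}$ for all positive integers $n$.
   Context: All graphs are finite and simple. For a graph $F$ and a positive integer $n$, the Turán number $\mathrm{ex}(n,F)$ is the maximum number of edges in an $n$-vertex graph containing no subgraph isomorphic to $F$ (with the maximum of the empty set taken to be $0$). Notation: $N_T(c)$ and $d_T(c)$ denote the neighbourhood and the degree of a vertex $c$ in $T$, and $[m]=\{1,\dots,m\}$. A subtree of a tree is a (nonempty) connected subgraph. Definition ($r$-star-flip graph). Fix an integer $r\ge 2$. An $r$-star-flip presentation of a graph $H$ consists of a sequence of graphs $H_0\subset H_1\subset\cdots\subset H_m=H$ (with $m\ge 0$) together with families $\mathcal T_0,\mathcal T_1,\dots,\mathcal T_m$ of trees, whose members are called live trees, constructed recursively as follows. - The initial graph $H_0=R$ is a tree, called the seed tree, and $\mathcal T_0$ is the family of all subtrees of $R$. - Suppose $H_{i-1}$ and $\mathcal T_{i-1}$ have been defined, for some $i\in[m]$. Choose a live tree $T_i\in\mathcal T_{i-1}$ and a vertex $c_i\in V(T_i)$ such that $1\le k_i:=d_{T_i}(c_i)\le r$. Introduce a new vertex $x_i\notin V(H_{i-1})$ and join it precisely to the vertices of $N_{T_i}(c_i)$, i.e. $V(H_i)=V(H_{i-1})\cup\{x_i\}$ and $E(H_i)=E(H_{i-1})\cup\{x_ia: a\in N_{T_i}(c_i)\}$.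 - Let $\mathcal S_i=\{T\in\mathcal T_{i-1}: c_i\in V(T)\text{ and }N_T(c_i)=N_{T_i}(c_i)\}$. For $T\in\mathcal S_i$, let $T^{x_i}$ be the tree obtained from $T$ by replacing $c_i$ with $x_i$. Then $\mathcal T_i=\mathcal T_{i-1}\cup\bigcup_{T\in\mathcal S_i}\{Q: Q\text{ is a subtree of }T^{x_i}\}$. The passage from $(H_{i-1},\mathcal T_{i-1})$ to $(H_i,\mathcal T_i)$ is called a star flip of size $k_i$, performed at $c_i$ with neighbour set $N_{T_i}(c_i)$. A graph $H$ is called an $r$-star-flip graph if it admits an $r$-star-flip presentation. -}

module Defs where

open import Data.Bool using (Bool; true; false)
open import Data.Fin using (Fin; zero; suc; inject₁; fromℕ; finToFun; funToFin) renaming (_<_ to _<ᶠ_)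
open import Data.Fin.Properties using (any?; all?; finToFun-funToFin; <-cmp; <-irrefl) renaming (_≟_ to _≟ᶠ_; _<?_ to _<ᶠ?_)
open import Data.Fin.Permutation.Components using (transpose)
open import Data.Fin.Subset using (Subset; _∈_; _∉_; _⊆_; _∪_; ⁅_⁆; ⊤; ∣_∣; Nonempty)
open import Data.Fin.Subset.Properties using (_∈?_; ∈⊤)
open import Data.List using (List; []; _∷_; [_]; map; concatMap; length; filter; cartesianProduct; allFin)
open import Data.List.Extrema.Nat using (max; xs≤max; argmax-sel)
open import Data.List.Membership.Propositional using () renaming (_∈_ to _∈ˡ_)
open import Data.List.Membership.Propositional.Properties using (∈-map⁺; ∈-map⁻; ∈-concatMap⁺; ∈-filter⁺; ∈-filter⁻)
open import Data.List.Properties using (filter-≐)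
open import Data.List.Relation.Unary.All using () renaming (lookup to lookupᴬ)
open import Data.List.Relation.Unary.Any using (here; there) renaming (map to mapᴬⁿʸ)
open import Data.Nat using (ℕ; zero; suc; _^_; _≤_)
open import Data.Product using (Σ-syntax; ∃-syntax; _×_; _,_; proj₁; proj₂)
open import Data.Sum using (_⊎_; inj₁; inj₂) renaming (map to map⊎)
open import Data.Vec using (Vec; []; _∷_; lookup; tabulate)
open import Data.Vec.Properties using (lookup⇒[]=; []=⇒lookup; lookup∘tabulate)
open import Function using (id; _∘_)
open import Function.Bundles using (_⇔_)
open import Function.Definitions using (Injective)
open import Level using (0ℓ)
open import Relation.Binary using (tri<; tri≈; tri>)
open import Relation.Binary.Construct.Closure.ReflexiveTransitive using (Star)
open import Relation.Binary.PropositionalEquality using (_≡_; refl; sym; trans; cong; subst; subst₂)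
open import Relation.Nullary using (¬_; Dec; yes; no; does; contradiction)
open import Relation.Nullary.Decidable using (_×-dec_; _⊎-dec_; _→-dec_; ¬?; dec-true; map′)
open import Relation.Unary using (Pred)

-- Finite simple graphs with vertex set Fin n.
record Graph (n : ℕ) : Set where
  field
    N      : Fin n → Subset n
    N-sym  : ∀ {a b} → b ∈ N a → a ∈ N b
    irrefl : ∀ {a} → a ∉ N a

open Graph public

-- Each edge is listed once, as the pair of its ends in increasing order.
edges : ∀ {n} → Graph n → List (Fin n × Fin n)
edges {n} G =
  filter (λ (a , b) → (a <ᶠ? b) ×-dec (b ∈? N G a))
         (cartesianProduct (allFin n) (allFin n))

e : ∀ {n} → Graph n → ℕ
e G = length (edges G)

-- A subgraph of G isomorphic to F is the image of an injective homomorphism;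
-- the subgraph need not be induced.
IsCopy : ∀ {h n} → Graph h → Graph n → (Fin h → Fin n) → Set
IsCopy F G f = Injective _≡_ _≡_ f × (∀ a b → b ∈ N F a → f b ∈ N G (f a))

Contains : ∀ {h n} → Graph n → Graph h → Set
Contains G F = ∃[ f ] IsCopy F G f

Free : ∀ {h n} → Graph h → Graph n → Set
Free F G = ¬ Contains G F

tuples : ∀ {A : Set} → List A → (m : ℕ) → List (Vec A m)
tuples xs zero    = [ [] ]
tuples xs (suc m) = concatMap (λ x → map (x ∷_) (tuples xs m)) xs

∈-tuples : ∀ {A : Set} {xs : List A} → (∀ x → x ∈ˡ xs) →
           ∀ {m} (v : Vec A m) → v ∈ˡ tuples xs m
∈-tuples all []      = here refl
∈-tuples {xs = xs} all {suc m} (x ∷ v) =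
  ∈-concatMap⁺ (λ y → map (y ∷_) (tuples xs m))
    (mapᴬⁿʸ (λ { refl → ∈-map⁺ (x ∷_) (∈-tuples all v) }) (all x))

∈-tabulate⁺ : ∀ {n} {P : Fin n → Set} (P? : ∀ i → Dec (P i)) {i} →
              P i → i ∈ tabulate (does ∘ P?)
∈-tabulate⁺ P? {i} p =
  lookup⇒[]= i _ (trans (lookup∘tabulate (does ∘ P?) i) (dec-true (P? i) p))

∈-tabulate⁻ : ∀ {n} {P : Fin n → Set} (P? : ∀ i → Dec (P i)) {i} →
              i ∈ tabulate (does ∘ P?) → P i
∈-tabulate⁻ P? {i} i∈
  with P? i | trans (sym (lookup∘tabulate (does ∘ P?) i)) ([]=⇒lookup i∈)
... | yes p | _  = p
... | no _  | ()

-- The graph whose adjacencies are read off the entries of a square 0-1 matrix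
-- above the diagonal; every graph arises in this way.
module _ {n : ℕ} (M : Vec (Subset n) n) where

  UpperEntry : Fin n → Fin n → Set
  UpperEntry a b = (a <ᶠ b × b ∈ lookup M a) ⊎ (b <ᶠ a × a ∈ lookup M b)

  upperEntry? : ∀ a b → Dec (UpperEntry a b)
  upperEntry? a b = ((a <ᶠ? b) ×-dec (b ∈? lookup M a))
                ⊎-dec ((b <ᶠ? a) ×-dec (a ∈? lookup M b))

  fromMatrix : Graph n
  fromMatrix .N a = tabulate (λ b → does (upperEntry? a b))
  fromMatrix .N-sym {a} {b} b∈ with ∈-tabulate⁻ (upperEntry? a) b∈
  ... | inj₁ p = ∈-tabulate⁺ (upperEntry? b) (inj₂ p)
  ... | inj₂ p = ∈-tabulate⁺ (upperEntry? b) (inj₁ p)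
  fromMatrix .irrefl {a} a∈ with ∈-tabulate⁻ (upperEntry? a) a∈
  ... | inj₁ (a<a , _) = <-irrefl refl a<a
  ... | inj₂ (a<a , _) = <-irrefl refl a<a

graphs : ∀ n → List (Graph n)
graphs n = map fromMatrix (tuples (tuples (true ∷ false ∷ []) n) n)

isCopy? : ∀ {h n} (F : Graph h) (G : Graph n) f → Dec (IsCopy F G f)
isCopy? F G f =
  map′ (λ p {x} {y} → p x y) (λ p x y → p)
    (all? λ x → all? λ y → (f x ≟ᶠ f y) →-dec (x ≟ᶠ y))
  ×-dec
  (all? λ a → all? λ b → (b ∈? N F a) →-dec (f b ∈? N G (f a)))

contains? : ∀ {h n} (G : Graph n) (F : Graph h) → Dec (Contains G F)
contains? {h} {n} G F =
  map′ (λ (k , p) → finToFun k , p) (λ (f , p) → funToFin f , respects f p)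
    (any? {n ^ h} (λ k → isCopy? F G (finToFun k)))
  where
  respects : ∀ f → IsCopy F G f → IsCopy F G (finToFun (funToFin f))
  respects f (inj , hom) =
      (λ {x} {y} eq → inj (trans (sym (eqf x)) (trans eq (eqf y))))
    , (λ a b ab → subst₂ (λ u v → u ∈ N G v) (sym (eqf b)) (sym (eqf a)) (hom a b ab))
    where
    eqf : ∀ i → finToFun (funToFin f) i ≡ f i
    eqf = finToFun-funToFin f

-- The base value 0 makes ex n F = 0 when no graph on Fin n is F-free.
ex : ∀ {h} → ℕ → Graph h → ℕ
ex n F = max 0 (map e (filter (λ G → ¬? (contains? G F)) (graphs n)))

module _ {h : ℕ} (F : Graph h) {n : ℕ} where

  private
    matrix : Graph n → Vec (Subset n) n
    matrix G = tabulate (N G)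

    norm : Graph n → Graph n
    norm G = fromMatrix (matrix G)

    norm⁺ : ∀ G {a b} → b ∈ N G a → b ∈ N (norm G) a
    norm⁺ G {a} {b} ab = ∈-tabulate⁺ (upperEntry? (matrix G) a) (go (<-cmp a b))
      where
      row : ∀ x → lookup (matrix G) x ≡ N G x
      row = lookup∘tabulate (N G)
      go : _ → UpperEntry (matrix G) a b
      go (tri< a<b _ _)  = inj₁ (a<b , subst (b ∈_) (sym (row a)) ab)
      go (tri≈ _ refl _) = contradiction ab (irrefl G)
      go (tri> _ _ b<a)  = inj₂ (b<a , subst (a ∈_) (sym (row b)) (N-sym G ab))

    norm⁻ : ∀ G {a b} → b ∈ N (norm G) a → b ∈ N G a
    norm⁻ G {a} {b} ab with ∈-tabulate⁻ (upperEntry? (matrix G) a) ab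
    ... | inj₁ (_ , p) = subst (b ∈_) (lookup∘tabulate (N G) a) p
    ... | inj₂ (_ , p) = N-sym G (subst (a ∈_) (lookup∘tabulate (N G) b) p)

    norm∈ : ∀ G → norm G ∈ˡ graphs n
    norm∈ G = ∈-map⁺ fromMatrix
      (∈-tuples (∈-tuples (λ { true → here refl ; false → there (here refl) })) (matrix G))

    e-norm : ∀ G → e (norm G) ≡ e G
    e-norm G = cong length (filter-≐
      (λ (a , b) → (a <ᶠ? b) ×-dec (b ∈? N (norm G) a))
      (λ (a , b) → (a <ᶠ? b) ×-dec (b ∈? N G a))
      ((λ (p , q) → p , norm⁻ G q) , (λ (p , q) → p , norm⁺ G q))
      (cartesianProduct (allFin n) (allFin n)))

    free? : ∀ (G : Graph n) → Dec (Free F G)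
    free? G = ¬? (contains? G F)

  ex-upper : ∀ (G : Graph n) → Free F G → e G ≤ ex n F
  ex-upper G free = subst (_≤ ex n F) (e-norm G)
    (lookupᴬ (xs≤max 0 _) (∈-map⁺ e (∈-filter⁺ free? (norm∈ G)
      (λ (f , inj , hom) → free (f , inj , λ a b ab → norm⁻ G (hom a b ab))))))

  ex-attained : (Σ[ G ∈ Graph n ] Free F G × e G ≡ ex n F) ⊎ ((∀ (G : Graph n) → ¬ Free F G) × ex n F ≡ 0)
  ex-attained with filter free? (graphs n) in eq
  ... | [] = inj₂
    ( (λ G free → none (subst (norm G ∈ˡ_) eq (∈-filter⁺ free? (norm∈ G)
        (λ (f , inj , hom) → free (f , inj , λ a b ab → norm⁻ G (hom a b ab))))))
    , refl )
    where
    none : ∀ {G : Graph n} → ¬ (G ∈ˡ [])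
    none ()
  ... | G₀ ∷ Gs with argmax-sel id 0 (map e (G₀ ∷ Gs))
  ...   | inj₂ m∈ with ∈-map⁻ e m∈
  ...     | G , G∈ , eG = inj₁ (G , proj₂ (∈-filter⁻ free? {xs = graphs n} (subst (G ∈ˡ_) (sym eq) G∈)) , sym eG)
  ex-attained | G₀ ∷ Gs | inj₁ m≡0 =
    inj₁ (G₀ , proj₂ (∈-filter⁻ free? {xs = graphs n} (subst (G₀ ∈ˡ_) (sym eq) (here refl))) ,
          trans (n≤0 (subst (e G₀ ≤_) m≡0 (lookupᴬ (xs≤max 0 (map e (G₀ ∷ Gs))) (here refl)))) (sym m≡0))
    where
    n≤0 : ∀ {k} → k ≤ 0 → k ≡ 0
    n≤0 {zero} _ = refl

-- All vertices are labelled in Fin n, so that subgraphs and unions are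
-- literal. The labels outside V are isolated in the underlying Graph n.
record SubGraph (n : ℕ) : Set where
  field
    V       : Subset n
    graph   : Graph n
    support : ∀ {a b} → b ∈ N graph a → b ∈ V

open SubGraph public

Nbh : ∀ {n} → SubGraph n → Fin n → Subset n
Nbh T = N (graph T)

deg : ∀ {n} → SubGraph n → Fin n → ℕ
deg T c = ∣ Nbh T c ∣

whole : ∀ {n} → Graph n → SubGraph n
whole G .V       = ⊤
whole G .graph   = G
whole G .support = λ _ → ∈⊤

infix 4 _⊑_

_⊑_ : ∀ {n} → SubGraph n → SubGraph n → Set
Q ⊑ T = V Q ⊆ V T × (∀ a → Nbh Q a ⊆ Nbh T a)

Connected : ∀ {n} → SubGraph n → Set
Connected T = Nonempty (V T) ×
  (∀ u v → u ∈ V T → v ∈ V T → Star (λ a b → b ∈ Nbh T a) u v)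

-- The cycle f 0, f 1, …, f (k + 2), of length k + 3.
HasCycle : ∀ {n} → SubGraph n → Set
HasCycle {n} T = ∃[ k ] Σ[ f ∈ (Fin (suc (suc (suc k))) → Fin n) ]
  Injective _≡_ _≡_ f ×
  (∀ i → f (suc i) ∈ Nbh T (f (inject₁ i))) ×
  f zero ∈ Nbh T (f (fromℕ (suc (suc k))))

IsTree : ∀ {n} → SubGraph n → Set
IsTree T = Connected T × ¬ HasCycle T

_IsSubtreeOf_ : ∀ {n} → SubGraph n → SubGraph n → Set
Q IsSubtreeOf T = Connected Q × Q ⊑ T

pull : ∀ {n} → (Fin n → Fin n) → Subset n → Subset n
pull τ S = tabulate (lookup S ∘ τ)

pull⁺ : ∀ {n} τ {S : Subset n} {i} → τ i ∈ S → i ∈ pull τ S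
pull⁺ τ {S} {i} p = lookup⇒[]= i _ (trans (lookup∘tabulate (lookup S ∘ τ) i) ([]=⇒lookup p))

pull⁻ : ∀ {n} τ {S : Subset n} {i} → i ∈ pull τ S → τ i ∈ S
pull⁻ τ {S} {i} p = lookup⇒[]= (τ i) S (trans (sym (lookup∘tabulate (lookup S ∘ τ) i)) ([]=⇒lookup p))

-- The graph obtained from T by exchanging the labels c and x. It is used for
-- c ∈ V T and x ∉ V T, where this amounts to replacing the vertex c by x.
replace : ∀ {n} → SubGraph n → (c x : Fin n) → SubGraph n
replace {n} T c x = record
  { V       = pull τ (V T)
  ; graph   = record
    { N      = λ a → pull τ (Nbh T (τ a))
    ; N-sym  = λ b∈ → pull⁺ τ (N-sym (graph T) (pull⁻ τ b∈))
    ; irrefl = λ a∈ → irrefl (graph T) (pull⁻ τ a∈)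
    }
  ; support = λ b∈ → pull⁺ τ (support T (pull⁻ τ b∈))
  }
  where
  τ : Fin n → Fin n
  τ = transpose c x

record Adjoins {n} (H : SubGraph n) (x : Fin n) (S : Subset n) (H′ : SubGraph n) : Set where
  field
    fresh    : x ∉ V H
    vertices : V H′ ≡ V H ∪ ⁅ x ⁆
    adjacent : ∀ a b → b ∈ Nbh H′ a ⇔ (b ∈ Nbh H a ⊎ (a ≡ x × b ∈ S) ⊎ (b ≡ x × a ∈ S))

Family : ℕ → Set₁
Family n = Pred (SubGraph n) 0ℓ

Flippable : ∀ {n} → Family n → SubGraph n → Fin n → Family n
Flippable 𝒯 Tᵢ c T = 𝒯 T × c ∈ V T × Nbh T c ≡ Nbh Tᵢ c

flipFamily : ∀ {n} → Family n → SubGraph n → (c x : Fin n) → Family n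
flipFamily 𝒯 Tᵢ c x Q =
  𝒯 Q ⊎ (∃[ T ] Flippable 𝒯 Tᵢ c T × Q IsSubtreeOf replace T c x)

-- Presentation r H 𝒯: some sequence of star flips of sizes between 1 and r
-- ends in the graph H with the family 𝒯 of live trees.
data Presentation {n : ℕ} (r : ℕ) : SubGraph n → Family n → Set₁ where
  seed : ∀ {R} → IsTree R → Presentation r R (_IsSubtreeOf R)
  flip : ∀ {H 𝒯} → Presentation r H 𝒯 →
         ∀ {T} → 𝒯 T →
         ∀ {c} → c ∈ V T → 1 ≤ deg T c → deg T c ≤ r →
         ∀ {x H′} → Adjoins H x (Nbh T c) H′ →
         Presentation r H′ (flipFamily 𝒯 T c x)

IsStarFlipGraph : ∀ {n} → ℕ → Graph n → Set₁
IsStarFlipGraph {n} r H = Σ[ 𝒯 ∈ Family n ] Presentation r (whole H) 𝒯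

-- Let G be a graph on n vertices with more than C · n^(2 - 1/r) edges. Map the
-- seed tree to G by a stationary random walk branching along the tree, and at
-- every star flip give the new vertex x an image drawn, independently, from
-- the conditional law of the image of c given the images of N(c). Trees are
-- Markov random fields, and that conditional law depends only on N(c), so x can
-- take the place of c in every live tree in which c has this neighbourhood:
-- each live tree T keeps the law of the random walk on T. In particular the
-- star around c follows the random-walk law, under which a k-tuple of leaves
-- has probability proportional to the weight W of its common neighbours. As
-- there are only n^k tuples, the mean of 1/W is at most n^k divided by the sum
-- of the degrees, so x hits the image of an older vertex with small
-- probability. Altogether the map is injective with positive probability.
module Submission where

open import Defs
open import Algebra.Bundles using (CommutativeRing; CommutativeSemiring)
open import Data.Bool using (true; false; if_then_else_)
open import Data.Fin using (Fin; zero; suc; inject₁; fromℕ)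
open import Data.Fin.Permutation using () renaming (transpose to transposition)
open import Data.Fin.Permutation.Components using (transpose)
open import Data.Fin.Properties using (any?; all?) renaming (_≟_ to _≟ᶠ_; _<?_ to _<ᶠ?_)
open import Data.Fin.Subset using (Subset; _∈_; _∉_; _⊆_; _∪_; _∩_; ∁; ⁅_⁆; ⊥; ⊤; ∣_∣; inside; outside)
open import Data.Fin.Subset.Properties
open import Data.List as List using (List; []; _∷_; _++_; length; map; filter; allFin; cartesianProduct)
open import Data.List.Membership.Propositional.Properties using (∈-lookup)
open import Data.List.Properties using (length-++; length-map; length-tabulate; length-filter)
open import Data.List.Relation.Unary.All as All using (All; []; _∷_)
open import Data.List.Relation.Unary.All.Properties using () renaming (++⁺ to All-++⁺)
open import Data.List.Relation.Unary.AllPairs using ([]; _∷_)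
open import Data.List.Relation.Unary.Unique.Propositional using (Unique)
open import Data.Nat as ℕ using (ℕ; zero; suc; z≤n; s≤s)
open import Data.Nat.Properties as ℕ using ()
open import Data.Nat.Solver as ℕSolver using ()
open import Data.Product using (_×_; _,_; proj₁; proj₂; ∃-syntax)
open import Data.Rational using (ℚ; 0ℚ; 1ℚ)
open import Data.Rational.Properties as ℚ using ()
open import Data.Rational.Solver using (module +-*-Solver)
open import Data.Sum using (_⊎_; inj₁; inj₂)
open import Data.Vec using ([]; _∷_; lookup; tabulate; here; there)
open import Data.Vec.Properties using (lookup⇒[]=; lookup∘tabulate)
open import Function using (_∘_; id)
open import Function.Bundles using (module Equivalence; mk⇔)
open import Function.Definitions using (Injective)
open import Relation.Binary.Construct.Closure.ReflexiveTransitive using (Star; ε; _◅_; _◅◅_; gmap)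
open import Relation.Binary.PropositionalEquality
open import Relation.Nullary using (¬_; Dec; yes; no; does; contradiction)
open import Relation.Nullary.Decidable using (dec-true; dec-false; _×-dec_; _⊎-dec_; _→-dec_; ¬?)
open import Relation.Unary using (Decidable)

-- No density for the law of a map of a live tree is ever written down. That law is handled through
-- local identities (`Gibbs`): for a subtree Q of a live tree and a vertex c of Q, redrawing c given
-- its neighbours in Q leaves the law on `V Q` unchanged. These identities survive attaching a leaf,
-- exchanging labels and adding vertices outside Q, and they suffice to evaluate expectations over a
-- star. The obstacle is that the joint law of an older vertex and the star around x is out of
-- control, and that a label of small degree may carry most of the weight W. So labels are split by
-- degree. A label of degree at least 1/β has weight at most β ^ k, and the mean of 1/W pays for it.
-- The labels of smaller degree are charged together to the event that x itself receives such a
-- label, and the probability of that event is known because each single label is stationary. This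
-- takes the place of a minimum degree condition on G. The threshold 1/β is the fraction 1/(l + 1)
-- of e/n, where l is 2h times the number of vertices charged; each charge is 1/(l + 1), so
-- collisions have probability at most l/(l + 1).

module Embedding where

  open import Data.Rational using (_+_; _*_; _≤_; _<_; 1/_; ≢-nonZero; nonNegative)

  ℚ-semiring : CommutativeSemiring _ _
  ℚ-semiring = CommutativeRing.commutativeSemiring ℚ.+-*-commutativeRing

  open import Algebra.Properties.CommutativeMonoid.Sum ℚ.+-0-commutativeMonoid
    using (sum; sum-cong-≗; ∑-distrib-+; ∑-comm; sum-replicate)
  open import Algebra.Properties.CommutativeMonoid.Sum ℚ.*-1-commutativeMonoid
    using () renaming (sum to product; sum-cong-≗ to product-cong; ∑-permute to product-permute)
  open import Algebra.Properties.CommutativeSemiring.Exp ℚ-semiring using (_^_; ^-distrib-*)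
  open import Algebra.Properties.Semiring.Mult (CommutativeSemiring.semiring ℚ-semiring)
    using (×-homo-+; ×1-homo-*; ×-assoc-*) renaming (_×_ to _×ℚ_)
  open import Algebra.Properties.Semiring.Sum (CommutativeSemiring.semiring ℚ-semiring)
    using (*-distribˡ-sum; *-distribʳ-sum)

  -- Rational numbers and finite sums

  ι : ℕ → ℚ
  ι k = k ×ℚ 1ℚ

  *-nonNeg : ∀ {p q} → 0ℚ ≤ p → 0ℚ ≤ q → 0ℚ ≤ p * q
  *-nonNeg {p} {q} 0≤p 0≤q =
    subst (_≤ p * q) (ℚ.*-zeroʳ p) (ℚ.*-monoˡ-≤-nonNeg p {{nonNegative 0≤p}} 0≤q)

  *-monoʳ : ∀ {p q r} → 0ℚ ≤ r → p ≤ q → r * p ≤ r * q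
  *-monoʳ {r = r} 0≤r = ℚ.*-monoˡ-≤-nonNeg r {{nonNegative 0≤r}}

  *-monoˡ : ∀ {p q r} → 0ℚ ≤ r → p ≤ q → p * r ≤ q * r
  *-monoˡ {r = r} 0≤r = ℚ.*-monoʳ-≤-nonNeg r {{nonNegative 0≤r}}

  *-mono : ∀ {p q r s} → 0ℚ ≤ p → 0ℚ ≤ s → p ≤ q → r ≤ s → p * r ≤ q * s
  *-mono 0≤p 0≤s p≤q r≤s = ℚ.≤-trans (*-monoʳ 0≤p r≤s) (*-monoˡ 0≤s p≤q)

  +-nonNeg : ∀ {p q} → 0ℚ ≤ p → 0ℚ ≤ q → 0ℚ ≤ p + q
  +-nonNeg = ℚ.+-mono-≤

  p≤p+q : ∀ {p q} → 0ℚ ≤ q → p ≤ p + q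
  p≤p+q {p} 0≤q = subst (_≤ p + _) (ℚ.+-identityʳ p) (ℚ.+-monoʳ-≤ p 0≤q)

  p≤q+p : ∀ {p q} → 0ℚ ≤ q → p ≤ q + p
  p≤q+p {p} {q} 0≤q = subst (p ≤_) (ℚ.+-comm p q) (p≤p+q 0≤q)

  0≤1 : 0ℚ ≤ 1ℚ
  0≤1 = ℚ.nonNegative⁻¹ 1ℚ

  0≤∧≢0⇒0< : ∀ {p} → 0ℚ ≤ p → p ≢ 0ℚ → 0ℚ < p
  0≤∧≢0⇒0< {p} 0≤p p≢0 with 0ℚ ℚ.<? p
  ... | yes 0<p = 0<p
  ... | no  0≮p = contradiction (ℚ.≤-antisym (ℚ.≮⇒≥ 0≮p) 0≤p) p≢0

  *-≢0 : ∀ {p q} → p ≢ 0ℚ → q ≢ 0ℚ → p * q ≢ 0ℚ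
  *-≢0 {p} {q} p≢0 q≢0 pq≡0 = q≢0 (begin
    q                  ≡⟨ sym (ℚ.*-identityˡ q) ⟩
    1ℚ * q             ≡⟨ cong (_* q) (sym (ℚ.*-inverseˡ p)) ⟩
    1/ p * p * q       ≡⟨ ℚ.*-assoc (1/ p) p q ⟩
    1/ p * (p * q)     ≡⟨ cong (1/ p *_) pq≡0 ⟩
    1/ p * 0ℚ          ≡⟨ ℚ.*-zeroʳ (1/ p) ⟩
    0ℚ                 ∎)
    where
    open ≡-Reasoning
    instance _ = ≢-nonZero p≢0

  ι-nonNeg : ∀ k → 0ℚ ≤ ι k
  ι-nonNeg zero    = ℚ.≤-refl
  ι-nonNeg (suc k) = +-nonNeg 0≤1 (ι-nonNeg k)

  ι-mono : ∀ {j k} → j ℕ.≤ k → ι j ≤ ι k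
  ι-mono {k = k} z≤n = ι-nonNeg k
  ι-mono (s≤s j≤k)   = ℚ.+-monoʳ-≤ 1ℚ (ι-mono j≤k)

  ι-pos : ∀ k → 0ℚ < ι (suc k)
  ι-pos k = ℚ.<-≤-trans (ℚ.positive⁻¹ 1ℚ) (p≤p+q (ι-nonNeg k))

  ι-homo-+ : ∀ j k → ι (j ℕ.+ k) ≡ ι j + ι k
  ι-homo-+ = ×-homo-+ 1ℚ

  ι-homo-* : ∀ j k → ι (j ℕ.* k) ≡ ι j * ι k
  ι-homo-* = ×1-homo-*

  ι-homo-^ : ∀ j k → ι (j ℕ.^ k) ≡ ι j ^ k
  ι-homo-^ j zero    = ℚ.+-identityʳ 1ℚ
  ι-homo-^ j (suc k) = trans (ι-homo-* j (j ℕ.^ k)) (cong (ι j *_) (ι-homo-^ j k))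

  ^-nonNeg : ∀ {p} → 0ℚ ≤ p → ∀ k → 0ℚ ≤ p ^ k
  ^-nonNeg 0≤p zero    = 0≤1
  ^-nonNeg 0≤p (suc k) = *-nonNeg 0≤p (^-nonNeg 0≤p k)

  -- Junk value: inv 0ℚ ≡ 0ℚ.
  inv : ℚ → ℚ
  inv p with p ℚ.≟ 0ℚ
  ... | yes _  = 0ℚ
  ... | no p≢0 = (1/ p) {{≢-nonZero p≢0}}

  *-inv : ∀ {p} → p ≢ 0ℚ → p * inv p ≡ 1ℚ
  *-inv {p} p≢0 with p ℚ.≟ 0ℚ
  ... | yes p≡0 = contradiction p≡0 p≢0
  ... | no p≢0′ = ℚ.*-inverseʳ p {{≢-nonZero p≢0′}}

  inv-* : ∀ {p} → p ≢ 0ℚ → inv p * p ≡ 1ℚ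
  inv-* {p} p≢0 = trans (ℚ.*-comm (inv p) p) (*-inv p≢0)

  inv-≢0 : ∀ {p} → p ≢ 0ℚ → inv p ≢ 0ℚ
  inv-≢0 {p} p≢0 eq = contradiction (trans (sym (*-inv p≢0)) (trans (cong (p *_) eq) (ℚ.*-zeroʳ p))) λ ()

  inv-nonNeg : ∀ {p} → 0ℚ ≤ p → 0ℚ ≤ inv p
  inv-nonNeg {p} 0≤p = by-cases (p ℚ.≟ 0ℚ)
    where
    by-cases : Dec (p ≡ 0ℚ) → 0ℚ ≤ inv p
    by-cases (yes refl) = ℚ.≤-refl
    by-cases (no p≢0) with ℚ.≤-total 0ℚ (inv p)
    ... | inj₁ 0≤i = 0≤i
    ... | inj₂ i≤0 = contradiction
      (ℚ.<-≤-trans (ℚ.positive⁻¹ 1ℚ) (subst₂ _≤_ (*-inv p≢0) (ℚ.*-zeroʳ p) (*-monoʳ 0≤p i≤0)))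
      (ℚ.<-irrefl refl)

  p*inv-p≤1 : ∀ p → p * inv p ≤ 1ℚ
  p*inv-p≤1 p with p ℚ.≟ 0ℚ
  ... | yes refl = subst (_≤ 1ℚ) (sym (ℚ.*-zeroˡ 0ℚ)) 0≤1
  ... | no p≢0   = ℚ.≤-reflexive (ℚ.*-inverseʳ p {{≢-nonZero p≢0}})

  sum-mono : ∀ {k} {f g : Fin k → ℚ} → (∀ i → f i ≤ g i) → sum f ≤ sum g
  sum-mono {zero}  f≤g = ℚ.≤-refl
  sum-mono {suc k} f≤g = ℚ.+-mono-≤ (f≤g zero) (sum-mono (f≤g ∘ suc))

  sum-const : ∀ {k} c → sum {k} (λ _ → c) ≡ ι k * c
  sum-const {k} c = trans (sum-replicate k) (trans (cong (k ×ℚ_) (sym (ℚ.*-identityˡ c))) (sym (×-assoc-* k 1ℚ c)))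

  sum-0 : ∀ {k} {f : Fin k → ℚ} → (∀ i → f i ≡ 0ℚ) → sum f ≡ 0ℚ
  sum-0 {k} f≡0 = trans (sum-cong-≗ f≡0) (trans (sum-const {k} 0ℚ) (ℚ.*-zeroʳ (ι k)))

  sum-nonNeg : ∀ {k} {f : Fin k → ℚ} → (∀ i → 0ℚ ≤ f i) → 0ℚ ≤ sum f
  sum-nonNeg {k} {f} 0≤f = subst (_≤ sum f) (sum-0 {k} λ _ → refl) (sum-mono 0≤f)

  term≤sum : ∀ {k} {f : Fin k → ℚ} → (∀ i → 0ℚ ≤ f i) → ∀ i → f i ≤ sum f
  term≤sum 0≤f zero    = p≤p+q (sum-nonNeg (0≤f ∘ suc))
  term≤sum 0≤f (suc i) = ℚ.≤-trans (term≤sum (0≤f ∘ suc) i) (p≤q+p (0≤f zero))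

  δ : ∀ {k} → Fin k → Fin k → ℚ
  δ i j = if does (i ≟ᶠ j) then 1ℚ else 0ℚ

  δ-refl : ∀ {k} (i : Fin k) → δ i i ≡ 1ℚ
  δ-refl i = cong (if_then 1ℚ else 0ℚ) (dec-true (i ≟ᶠ i) refl)

  δ-nonNeg : ∀ {k} (i j : Fin k) → 0ℚ ≤ δ i j
  δ-nonNeg i j with does (i ≟ᶠ j)
  ... | true  = 0≤1
  ... | false = ℚ.≤-refl

  sum-δ : ∀ {k} (f : Fin k → ℚ) j → sum (λ i → f i * δ i j) ≡ f j
  sum-δ {suc k} f zero = begin
    f zero * 1ℚ + sum (λ i → f (suc i) * δ (suc i) zero)
      ≡⟨ cong₂ _+_ (ℚ.*-identityʳ (f zero)) (sum-0 λ i → ℚ.*-zeroʳ (f (suc i))) ⟩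
    f zero + 0ℚ ≡⟨ ℚ.+-identityʳ (f zero) ⟩
    f zero ∎
    where open ≡-Reasoning
  sum-δ {suc k} f (suc j) = begin
    f zero * 0ℚ + sum (λ i → f (suc i) * δ (suc i) (suc j))
      ≡⟨ cong₂ _+_ (ℚ.*-zeroʳ (f zero)) (sum-δ (f ∘ suc) j) ⟩
    0ℚ + f (suc j) ≡⟨ ℚ.+-identityˡ (f (suc j)) ⟩
    f (suc j) ∎
    where open ≡-Reasoning

  ∏ : ∀ {h} → Subset h → (Fin h → ℚ) → ℚ
  ∏ S g = product λ a → if lookup S a then g a else 1ℚ

  ∏-cong : ∀ {h} (S : Subset h) {f g : Fin h → ℚ} → (∀ a → a ∈ S → f a ≡ g a) → ∏ S f ≡ ∏ S g
  ∏-cong S {f} {g} f≡g = product-cong factor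
    where
    factor : ∀ a → (if lookup S a then f a else 1ℚ) ≡ (if lookup S a then g a else 1ℚ)
    factor a with lookup S a in a∈
    ... | true  = f≡g a (lookup⇒[]= a S a∈)
    ... | false = refl

  ∏-⊥ : ∀ {h} (g : Fin h → ℚ) → ∏ ⊥ g ≡ 1ℚ
  ∏-⊥ {zero}  g = refl
  ∏-⊥ {suc h} g = trans (ℚ.*-identityˡ _) (∏-⊥ (g ∘ suc))

  ∏-insert : ∀ {h} {S : Subset h} {a} (g : Fin h → ℚ) → a ∉ S → ∏ (S ∪ ⁅ a ⁆) g ≡ g a * ∏ S g
  ∏-insert {S = inside ∷ S} {zero} g a∉S = contradiction here a∉S
  ∏-insert {S = outside ∷ S} {zero} g a∉S
    rewrite ∪-identityʳ S = cong (g zero *_) (sym (ℚ.*-identityˡ (∏ S (g ∘ suc))))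
  ∏-insert {S = inside ∷ S} {suc a} g a∉S = trans
    (cong (g zero *_) (∏-insert (g ∘ suc) (a∉S ∘ there)))
    (solve 3 (λ x y z → x :* (y :* z) := y :* (x :* z)) refl (g zero) (g (suc a)) (∏ S (g ∘ suc)))
    where open +-*-Solver
  ∏-insert {S = outside ∷ S} {suc a} g a∉S = trans
    (cong (1ℚ *_) (∏-insert (g ∘ suc) (a∉S ∘ there)))
    (solve 3 (λ x y z → x :* (y :* z) := y :* (x :* z)) refl 1ℚ (g (suc a)) (∏ S (g ∘ suc)))
    where open +-*-Solver

  ∏-nonNeg : ∀ {h} (S : Subset h) {g : Fin h → ℚ} → (∀ a → 0ℚ ≤ g a) → 0ℚ ≤ ∏ S g
  ∏-nonNeg []            0≤g = 0≤1
  ∏-nonNeg (inside ∷ S)  0≤g = *-nonNeg (0≤g zero) (∏-nonNeg S (0≤g ∘ suc))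
  ∏-nonNeg (outside ∷ S) 0≤g = *-nonNeg 0≤1 (∏-nonNeg S (0≤g ∘ suc))

  ∏-≤-^ : ∀ {h} (S : Subset h) {g : Fin h → ℚ} {b} → (∀ a → 0ℚ ≤ g a) → (∀ a → g a ≤ b) → ∏ S g ≤ b ^ ∣ S ∣
  ∏-≤-^ []            0≤g g≤b = ℚ.≤-refl
  ∏-≤-^ (inside ∷ S) {b = b} 0≤g g≤b = *-mono (0≤g zero) (^-nonNeg (ℚ.≤-trans (0≤g zero) (g≤b zero)) ∣ S ∣) (g≤b zero) (∏-≤-^ S (0≤g ∘ suc) (g≤b ∘ suc))
  ∏-≤-^ (outside ∷ S) {g} 0≤g g≤b = subst (_≤ _) (sym (ℚ.*-identityˡ (∏ S (g ∘ suc)))) (∏-≤-^ S (0≤g ∘ suc) (g≤b ∘ suc))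

  ∏-≢0 : ∀ {h} (S : Subset h) {g : Fin h → ℚ} → (∀ a → a ∈ S → g a ≢ 0ℚ) → ∏ S g ≢ 0ℚ
  ∏-≢0 []            g≢0 = λ ()
  ∏-≢0 (inside ∷ S)  g≢0 = *-≢0 (g≢0 zero here) (∏-≢0 S λ a → g≢0 (suc a) ∘ there)
  ∏-≢0 (outside ∷ S) g≢0 = *-≢0 {1ℚ} (λ ()) (∏-≢0 S λ a → g≢0 (suc a) ∘ there)

  ∏-factor-≢0 : ∀ {h} {S : Subset h} {g : Fin h → ℚ} {a} → a ∈ S → ∏ S g ≢ 0ℚ → g a ≢ 0ℚ
  ∏-factor-≢0 {S = inside ∷ S} {g} here ∏≢0 g≡0 =
    ∏≢0 (trans (cong (_* ∏ S (g ∘ suc)) g≡0) (ℚ.*-zeroˡ (∏ S (g ∘ suc))))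
  ∏-factor-≢0 {S = s ∷ S} {g} (there a∈S) ∏≢0 =
    ∏-factor-≢0 a∈S λ ≡0 → ∏≢0 (trans (cong ((if s then g zero else 1ℚ) *_) ≡0) (ℚ.*-zeroʳ (if s then g zero else 1ℚ)))

  -- Resampling kernels

  upd : ∀ {h} {X : Set} → (Fin h → X) → Fin h → X → Fin h → X
  upd φ y v a = if does (a ≟ᶠ y) then v else φ a

  upd-≡ : ∀ {h} {X : Set} (φ : Fin h → X) y v → upd φ y v y ≡ v
  upd-≡ φ y v = cong (if_then v else φ y) (dec-true (y ≟ᶠ y) refl)

  upd-≢ : ∀ {h} {X : Set} (φ : Fin h → X) {y a} v → a ≢ y → upd φ y v a ≡ φ a
  upd-≢ φ {y} {a} v a≢y = cong (if_then v else φ a) (dec-false (a ≟ᶠ y) a≢y)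

  upd-upd : ∀ {h} {X : Set} (φ : Fin h → X) y v w a → upd (upd φ y v) y w a ≡ upd φ y w a
  upd-upd φ y v w a with does (a ≟ᶠ y)
  ... | true  = refl
  ... | false = refl

  upd-comm : ∀ {h} {X : Set} (φ : Fin h → X) {y z} v w → y ≢ z →
             ∀ a → upd (upd φ y v) z w a ≡ upd (upd φ z w) y v a
  upd-comm φ {y} {z} v w y≢z a with a ≟ᶠ z | a ≟ᶠ y
  ... | yes refl | yes refl = contradiction refl y≢z
  ... | yes _    | no _     = refl
  ... | no _     | yes _    = refl
  ... | no _     | no _     = refl

  ∉⇒≢ : ∀ {h} {S : Subset h} {a b} → a ∈ S → b ∉ S → a ≢ b
  ∉⇒≢ a∈S b∉S refl = b∉S a∈S

  DependsOn : ∀ {h} {X : Set} → (Fin h → Set) → ((Fin h → X) → ℚ) → Set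
  DependsOn Y f = ∀ φ ψ → (∀ a → Y a → φ a ≡ ψ a) → f φ ≡ f ψ

  -- Updates of a map commute and collapse only pointwise, so a functional has to respect pointwise
  -- equality before these rules can be applied under it.
  Extensional : ∀ {h} {X : Set} → ((Fin h → X) → ℚ) → Set
  Extensional f = ∀ φ ψ → (∀ a → φ a ≡ ψ a) → f φ ≡ f ψ

  DependsOn⇒Extensional : ∀ {h X Y} {f : (Fin h → X) → ℚ} → DependsOn Y f → Extensional f
  DependsOn⇒Extensional dep φ ψ φ≡ψ = dep φ ψ λ a _ → φ≡ψ a

  module Kernel {n : ℕ} (G : Graph n) where

    A : Fin n → Fin n → ℚ
    A v u = if does (u ∈? N G v) then 1ℚ else 0ℚ

    A-nonNeg : ∀ v u → 0ℚ ≤ A v u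
    A-nonNeg v u with does (u ∈? N G v)
    ... | true  = 0≤1
    ... | false = ℚ.≤-refl

    A≤1 : ∀ v u → A v u ≤ 1ℚ
    A≤1 v u with does (u ∈? N G v)
    ... | true  = ℚ.≤-refl
    ... | false = 0≤1

    A-adjacent : ∀ {v u} → u ∈ N G v → A v u ≡ 1ℚ
    A-adjacent {v} {u} vu = cong (if_then 1ℚ else 0ℚ) (dec-true (u ∈? N G v) vu)

    A≢0⇒adjacent : ∀ {v u} → A v u ≢ 0ℚ → u ∈ N G v
    A≢0⇒adjacent {v} {u} A≢0 with u ∈? N G v
    ... | yes vu = vu
    ... | no ¬vu = contradiction refl A≢0

    A-sym : ∀ v u → A v u ≡ A u v
    A-sym v u with u ∈? N G v
    ... | yes vu = sym (A-adjacent (N-sym G vu))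
    ... | no ¬vu = sym (cong (if_then 1ℚ else 0ℚ) (dec-false (v ∈? N G u) (¬vu ∘ N-sym G)))

    D : Fin n → ℚ
    D v = sum (A v)

    D-nonNeg : ∀ v → 0ℚ ≤ D v
    D-nonNeg v = sum-nonNeg (A-nonNeg v)

    adjacent⇒D≢0 : ∀ {v u} → u ∈ N G v → D v ≢ 0ℚ
    adjacent⇒D≢0 {v} {u} vu D≡0 = ℚ.<-irrefl refl
      (ℚ.<-≤-trans (ℚ.positive⁻¹ 1ℚ) (subst₂ _≤_ (A-adjacent vu) D≡0 (term≤sum (A-nonNeg v) u)))

    I : Fin n → ℚ
    I v = inv (D v)

    I-nonNeg : ∀ v → 0ℚ ≤ I v
    I-nonNeg v = inv-nonNeg (D-nonNeg v)

    P : Fin n → Fin n → ℚ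
    P v u = A v u * I v

    P-nonNeg : ∀ v u → 0ℚ ≤ P v u
    P-nonNeg v u = *-nonNeg (A-nonNeg v u) (I-nonNeg v)

    P≤I : ∀ v u → P v u ≤ I v
    P≤I v u = subst (P v u ≤_) (ℚ.*-identityˡ (I v)) (*-monoˡ (I-nonNeg v) (A≤1 v u))

    P-≢0 : ∀ {v u} → u ∈ N G v → P v u ≢ 0ℚ
    P-≢0 vu = *-≢0 (λ A≡0 → contradiction (trans (sym (A-adjacent vu)) A≡0) λ ()) (inv-≢0 (adjacent⇒D≢0 vu))

    P≢0⇒adjacent : ∀ {v u} → P v u ≢ 0ℚ → u ∈ N G v
    P≢0⇒adjacent {v} {u} P≢0 = A≢0⇒adjacent λ A≡0 → P≢0 (trans (cong (_* I v) A≡0) (ℚ.*-zeroˡ (I v)))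

    -- Detailed balance: together with `A-sym` it makes the walk reversible with respect to the
    -- degrees. For an isolated v both sides vanish, in accordance with the junk value of `inv`.
    D*P : ∀ v u → D v * P v u ≡ A v u
    D*P v u with u ∈? N G v
    ... | yes vu = trans (cong (D v *_) (ℚ.*-identityˡ (I v))) (*-inv (adjacent⇒D≢0 vu))
    ... | no ¬vu = trans (cong (D v *_) (ℚ.*-zeroˡ (I v))) (ℚ.*-zeroʳ (D v))

    -- Twice the number of edges, the normalising constant of the stationary law `D v / M`.
    M : ℚ
    M = sum D

    -- Labels of degree below 1/β are rare, since D v ≤ γ for them, and the
    -- probability of choosing any other label for the centre of a star with
    -- k + 1 leaves is at most β ^ k times the inverse of the total weight.
    record Scale (r : ℕ) : Set where
      field
        β γ η       : ℚ
        0≤β         : 0ℚ ≤ β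
        0≤γ         : 0ℚ ≤ γ
        0≤η         : 0ℚ ≤ η
        1≤γβ        : 1ℚ ≤ γ * β
        low-bound   : ι n * γ * inv M ≤ η
        star-bounds : ∀ k → suc k ℕ.≤ r → β ^ k * (ι n ^ suc k * inv M) ≤ η

    -- The law of the label of c in a random map of a tree, given the labels on
    -- the neighbourhood S of c, has density ω S φ / W S φ, whatever the tree;
    -- K S y f is the mean of f after the label of y is drawn from this law.
    module _ {h : ℕ} where

      ω : Subset h → (Fin h → Fin n) → Fin n → ℚ
      ω S φ v = D v * ∏ S (λ a → P v (φ a))

      W : Subset h → (Fin h → Fin n) → ℚ
      W S φ = sum (ω S φ)

      K : Subset h → Fin h → ((Fin h → Fin n) → ℚ) → (Fin h → Fin n) → ℚ
      K S y f φ = inv (W S φ) * sum (λ v → ω S φ v * f (upd φ y v))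

      ω-nonNeg : ∀ S φ v → 0ℚ ≤ ω S φ v
      ω-nonNeg S φ v = *-nonNeg (D-nonNeg v) (∏-nonNeg S λ a → P-nonNeg v (φ a))

      W-nonNeg : ∀ S φ → 0ℚ ≤ W S φ
      W-nonNeg S φ = sum-nonNeg (ω-nonNeg S φ)

      ω-cong : ∀ {S φ ψ} → (∀ a → a ∈ S → φ a ≡ ψ a) → ∀ v → ω S φ v ≡ ω S ψ v
      ω-cong {S} φ≡ψ v = cong (D v *_) (∏-cong S λ a a∈S → cong (P v) (φ≡ψ a a∈S))

      W-cong : ∀ {S φ ψ} → (∀ a → a ∈ S → φ a ≡ ψ a) → W S φ ≡ W S ψ
      W-cong φ≡ψ = sum-cong-≗ (ω-cong φ≡ψ)

      upd-∉ : ∀ {S : Subset h} {y} (φ : Fin h → Fin n) v → y ∉ S → ∀ a → a ∈ S → upd φ y v a ≡ φ a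
      upd-∉ φ v y∉S a a∈S = upd-≢ φ v (∉⇒≢ a∈S y∉S)

      ω-⊥ : ∀ φ v → ω ⊥ φ v ≡ D v
      ω-⊥ φ v = trans (cong (D v *_) (∏-⊥ λ a → P v (φ a))) (ℚ.*-identityʳ (D v))

      W-⊥ : ∀ φ → W ⊥ φ ≡ M
      W-⊥ φ = sum-cong-≗ (ω-⊥ φ)

      ω-insert : ∀ {S a} → a ∉ S → ∀ φ v → ω (S ∪ ⁅ a ⁆) φ v ≡ ω S φ v * P v (φ a)
      ω-insert {S} {a} a∉S φ v = trans
        (cong (D v *_) (∏-insert (λ b → P v (φ b)) a∉S))
        (solve 3 (λ x y z → x :* (y :* z) := x :* z :* y) refl (D v) (P v (φ a)) (∏ S λ b → P v (φ b)))
        where open +-*-Solver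

      -- By detailed balance the kernel with a single neighbour is a step of the random walk from
      -- the label of p; with no neighbour (`ω-⊥`) it is a stationary start.
      ω-singleton : ∀ p φ v → ω ⁅ p ⁆ φ v ≡ A (φ p) v
      ω-singleton p φ v = begin
        ω ⁅ p ⁆ φ v           ≡⟨ cong (λ S → ω S φ v) (sym (∪-identityˡ ⁅ p ⁆)) ⟩
        ω (⊥ ∪ ⁅ p ⁆) φ v     ≡⟨ ω-insert (∉⊥ {x = p}) φ v ⟩
        ω ⊥ φ v * P v (φ p)   ≡⟨ cong (_* P v (φ p)) (ω-⊥ φ v) ⟩
        D v * P v (φ p)       ≡⟨ D*P v (φ p) ⟩
        A v (φ p)             ≡⟨ A-sym v (φ p) ⟩
        A (φ p) v             ∎
        where open ≡-Reasoning

      W-singleton : ∀ p φ → W ⁅ p ⁆ φ ≡ D (φ p)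
      W-singleton p φ = sum-cong-≗ (ω-singleton p φ)

      W≡0⇒ω≡0 : ∀ {S φ} → W S φ ≡ 0ℚ → ∀ v → ω S φ v ≡ 0ℚ
      W≡0⇒ω≡0 {S} {φ} W≡0 v = ℚ.≤-antisym
        (subst (ω S φ v ≤_) W≡0 (term≤sum (ω-nonNeg S φ) v)) (ω-nonNeg S φ v)

      ω≢0⇒adjacent : ∀ {S φ v a} → ω S φ v ≢ 0ℚ → a ∈ S → φ a ∈ N G v
      ω≢0⇒adjacent {S} {φ} {v} ω≢0 a∈S = P≢0⇒adjacent (∏-factor-≢0 a∈S λ ∏≡0 →
        ω≢0 (trans (cong (D v *_) ∏≡0) (ℚ.*-zeroʳ (D v))))

      ω≢0⇒D≢0 : ∀ {S φ v} → ω S φ v ≢ 0ℚ → D v ≢ 0ℚ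
      ω≢0⇒D≢0 {S} {φ} {v} ω≢0 D≡0 =
        ω≢0 (trans (cong (_* ∏ S λ a → P v (φ a)) D≡0) (ℚ.*-zeroˡ (∏ S λ a → P v (φ a))))

      W-≢0 : ∀ {S φ v} → D v ≢ 0ℚ → (∀ a → a ∈ S → φ a ∈ N G v) → W S φ ≢ 0ℚ
      W-≢0 {S} {φ} {v} D≢0 adj W≡0 =
        *-≢0 D≢0 (∏-≢0 S λ a a∈S → P-≢0 (adj a a∈S)) (W≡0⇒ω≡0 {S} {φ} W≡0 v)

      K-depends : ∀ {S y f} {X Y : Fin h → Set} → DependsOn X f →
                  (∀ a → a ∈ S → Y a) → (∀ a → X a → a ≢ y → Y a) → DependsOn Y (K S y f)
      K-depends {S} {y} {f} {X} f-dep S⊆Y X⊆Y φ ψ φ≡ψ = cong₂ _*_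
        (cong inv (W-cong {S} λ a a∈S → φ≡ψ a (S⊆Y a a∈S)))
        (sum-cong-≗ λ v → cong₂ _*_ (ω-cong {S} (λ a a∈S → φ≡ψ a (S⊆Y a a∈S)) v) (f-dep _ _ (agree v)))
        where
        agree : ∀ v a → X a → upd φ y v a ≡ upd ψ y v a
        agree v a Xa with a ≟ᶠ y
        ... | yes _  = refl
        ... | no a≢y = φ≡ψ a (X⊆Y a Xa a≢y)

      K-ext : ∀ {S y f} → Extensional f → Extensional (K S y f)
      K-ext {S} {y} {f} f-ext φ ψ φ≡ψ = cong₂ _*_
        (cong inv (W-cong {S} λ a _ → φ≡ψ a))
        (sum-cong-≗ λ v → cong₂ _*_ (ω-cong {S} (λ a _ → φ≡ψ a) v) (f-ext _ _ (agree v)))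
        where
        agree : ∀ v a → upd φ y v a ≡ upd ψ y v a
        agree v a with does (a ≟ᶠ y)
        ... | true  = refl
        ... | false = φ≡ψ a

      K-+ : ∀ S y f g φ → K S y (λ ψ → f ψ + g ψ) φ ≡ K S y f φ + K S y g φ
      K-+ S y f g φ = begin
        i * sum (λ v → w v * (f (upd φ y v) + g (upd φ y v)))
          ≡⟨ cong (i *_) (sum-cong-≗ λ v → ℚ.*-distribˡ-+ (w v) (f (upd φ y v)) (g (upd φ y v))) ⟩
        i * sum (λ v → w v * f (upd φ y v) + w v * g (upd φ y v))
          ≡⟨ cong (i *_) (∑-distrib-+ (λ v → w v * f (upd φ y v)) (λ v → w v * g (upd φ y v))) ⟩
        i * (sum (λ v → w v * f (upd φ y v)) + sum (λ v → w v * g (upd φ y v)))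
          ≡⟨ ℚ.*-distribˡ-+ i (sum λ v → w v * f (upd φ y v)) (sum λ v → w v * g (upd φ y v)) ⟩
        K S y f φ + K S y g φ ∎
        where
        open ≡-Reasoning
        i = inv (W S φ)
        w = ω S φ

      K-* : ∀ S y c f φ → K S y (λ ψ → c * f ψ) φ ≡ c * K S y f φ
      K-* S y c f φ = begin
        i * sum (λ v → w v * (c * f (upd φ y v)))
          ≡⟨ cong (i *_) (sum-cong-≗ λ v → solve 3 (λ x y z → x :* (y :* z) := y :* (x :* z)) refl (w v) c (f (upd φ y v))) ⟩
        i * sum (λ v → c * (w v * f (upd φ y v)))
          ≡⟨ cong (i *_) (sym (*-distribˡ-sum c λ v → w v * f (upd φ y v))) ⟩
        i * (c * s)
          ≡⟨ solve 3 (λ x y z → x :* (y :* z) := y :* (x :* z)) refl i c s ⟩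
        c * (i * s) ∎
        where
        open ≡-Reasoning
        open +-*-Solver
        i = inv (W S φ)
        w = ω S φ
        s = sum (λ v → w v * f (upd φ y v))

      -- The comparison is asked only at labels of positive weight. This is how almost sure
      -- properties pass through `resample`.
      K-mono : ∀ {S y f g φ} → (∀ v → ω S φ v ≢ 0ℚ → f (upd φ y v) ≤ g (upd φ y v)) → K S y f φ ≤ K S y g φ
      K-mono {S} {y} {f} {g} {φ} f≤g = *-monoʳ (inv-nonNeg (W-nonNeg S φ)) (sum-mono term)
        where
        term : ∀ v → ω S φ v * f (upd φ y v) ≤ ω S φ v * g (upd φ y v)
        term v with ω S φ v ℚ.≟ 0ℚ
        ... | yes ω≡0 rewrite ω≡0 = ℚ.≤-reflexive (trans (ℚ.*-zeroˡ (f (upd φ y v))) (sym (ℚ.*-zeroˡ (g (upd φ y v)))))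
        ... | no  ω≢0 = *-monoʳ (ω-nonNeg S φ v) (f≤g v ω≢0)

      K-const : ∀ {S y f φ c} → W S φ ≢ 0ℚ → (∀ v → f (upd φ y v) ≡ c) → K S y f φ ≡ c
      K-const {S} {y} {f} {φ} {c} W≢0 f≡c = begin
        inv (W S φ) * sum (λ v → ω S φ v * f (upd φ y v))
          ≡⟨ cong (inv (W S φ) *_) (sum-cong-≗ λ v → cong (ω S φ v *_) (f≡c v)) ⟩
        inv (W S φ) * sum (λ v → ω S φ v * c)
          ≡⟨ cong (inv (W S φ) *_) (sym (*-distribʳ-sum c (ω S φ))) ⟩
        inv (W S φ) * (W S φ * c) ≡⟨ sym (ℚ.*-assoc (inv (W S φ)) (W S φ) c) ⟩
        inv (W S φ) * W S φ * c   ≡⟨ cong (_* c) (inv-* W≢0) ⟩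
        1ℚ * c                    ≡⟨ ℚ.*-identityˡ c ⟩
        c                         ∎
        where open ≡-Reasoning

      K-independent : ∀ {S y f φ} {X : Fin h → Set} → DependsOn X f → ¬ X y → W S φ ≢ 0ℚ → K S y f φ ≡ f φ
      K-independent {S} {y} {f} {φ} f-dep ¬Xy W≢0 = K-const {S} {y} {f} {φ} W≢0 λ v →
        f-dep (upd φ y v) φ λ a Xa → upd-≢ φ v λ { refl → ¬Xy Xa }

      K-singleton : ∀ p ℓ f φ → K ⁅ p ⁆ ℓ f φ ≡ sum (λ u → P (φ p) u * f (upd φ ℓ u))
      K-singleton p ℓ f φ = begin
        inv (W ⁅ p ⁆ φ) * sum (λ u → ω ⁅ p ⁆ φ u * f (upd φ ℓ u))
          ≡⟨ cong₂ _*_ (cong inv (W-singleton p φ)) (sum-cong-≗ λ u → cong (_* f (upd φ ℓ u)) (ω-singleton p φ u)) ⟩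
        I (φ p) * sum (λ u → A (φ p) u * f (upd φ ℓ u))
          ≡⟨ *-distribˡ-sum (I (φ p)) (λ u → A (φ p) u * f (upd φ ℓ u)) ⟩
        sum (λ u → I (φ p) * (A (φ p) u * f (upd φ ℓ u)))
          ≡⟨ sum-cong-≗ (λ u → solve 3 (λ x y z → x :* (y :* z) := y :* x :* z) refl (I (φ p)) (A (φ p) u) (f (upd φ ℓ u))) ⟩
        sum (λ u → P (φ p) u * f (upd φ ℓ u)) ∎
        where
        open ≡-Reasoning
        open +-*-Solver

      -- Both sides sum over the labels v of p and u of ℓ, in the two orders.
      ω-K-singleton : ∀ {S p ℓ f} → ℓ ∉ S → p ≢ ℓ → Extensional f → ∀ φ →
        sum (λ v → ω S φ v * K ⁅ p ⁆ ℓ f (upd φ p v)) ≡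
        sum (λ u → sum (λ v → ω (S ∪ ⁅ ℓ ⁆) (upd φ ℓ u) v * f (upd (upd φ ℓ u) p v)))
      ω-K-singleton {S} {p} {ℓ} {f} ℓ∉S p≢ℓ f-ext φ = begin
        sum (λ v → ω S φ v * K ⁅ p ⁆ ℓ f (upd φ p v))
          ≡⟨ sum-cong-≗ (λ v → cong (ω S φ v *_) (K-singleton p ℓ f (upd φ p v))) ⟩
        sum (λ v → ω S φ v * sum (λ u → P (upd φ p v p) u * f (upd (upd φ p v) ℓ u)))
          ≡⟨ sum-cong-≗ (λ v → *-distribˡ-sum (ω S φ v) (λ u → P (upd φ p v p) u * f (upd (upd φ p v) ℓ u))) ⟩
        sum (λ v → sum (λ u → ω S φ v * (P (upd φ p v p) u * f (upd (upd φ p v) ℓ u))))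
          ≡⟨ sum-cong-≗ (λ v → sum-cong-≗ (term v)) ⟩
        sum (λ v → sum (λ u → ω (S ∪ ⁅ ℓ ⁆) (upd φ ℓ u) v * f (upd (upd φ ℓ u) p v)))
          ≡⟨ ∑-comm (λ v u → ω (S ∪ ⁅ ℓ ⁆) (upd φ ℓ u) v * f (upd (upd φ ℓ u) p v)) ⟩
        sum (λ u → sum (λ v → ω (S ∪ ⁅ ℓ ⁆) (upd φ ℓ u) v * f (upd (upd φ ℓ u) p v))) ∎
        where
        open ≡-Reasoning
        term : ∀ v u → ω S φ v * (P (upd φ p v p) u * f (upd (upd φ p v) ℓ u)) ≡
                       ω (S ∪ ⁅ ℓ ⁆) (upd φ ℓ u) v * f (upd (upd φ ℓ u) p v)
        term v u = begin
          ω S φ v * (P (upd φ p v p) u * f (upd (upd φ p v) ℓ u))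
            ≡⟨ sym (ℚ.*-assoc (ω S φ v) (P (upd φ p v p) u) (f (upd (upd φ p v) ℓ u))) ⟩
          ω S φ v * P (upd φ p v p) u * f (upd (upd φ p v) ℓ u)
            ≡⟨ cong₂ _*_ (cong₂ _*_ (ω-cong {S} (λ a a∈S → sym (upd-∉ φ u ℓ∉S a a∈S)) v)
                                    (cong₂ P (upd-≡ φ p v) (sym (upd-≡ φ ℓ u))))
                         (f-ext _ _ (upd-comm φ v u p≢ℓ)) ⟩
          ω S (upd φ ℓ u) v * P v (upd φ ℓ u ℓ) * f (upd (upd φ ℓ u) p v)
            ≡⟨ cong (_* f (upd (upd φ ℓ u) p v)) (sym (ω-insert ℓ∉S (upd φ ℓ u) v)) ⟩
          ω (S ∪ ⁅ ℓ ⁆) (upd φ ℓ u) v * f (upd (upd φ ℓ u) p v) ∎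

      -- The inner kernel overwrites the label of p and reads only S, so it factors out of the sum
      -- and `W S φ` cancels. If this weight is 0, every term on the right is 0 too, so the junk
      -- value of `inv` does no harm.
      ω-K-absorb : ∀ {S p f} → p ∉ S → Extensional f → ∀ φ →
        sum (λ v → ω S φ v * K S p f (upd φ p v)) ≡ sum (λ v → ω S φ v * f (upd φ p v))
      ω-K-absorb {S} {p} {f} p∉S f-ext φ = begin
        sum (λ v → ω S φ v * K S p f (upd φ p v)) ≡⟨ sum-cong-≗ (λ v → cong (ω S φ v *_) (fixed v)) ⟩
        sum (λ v → ω S φ v * K S p f φ)           ≡⟨ sym (*-distribʳ-sum (K S p f φ) (ω S φ)) ⟩
        W S φ * (inv (W S φ) * s)                 ≡⟨ sym (ℚ.*-assoc (W S φ) (inv (W S φ)) s) ⟩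
        W S φ * inv (W S φ) * s                   ≡⟨ cancel (W S φ ℚ.≟ 0ℚ) ⟩
        s                                         ∎
        where
        open ≡-Reasoning
        s = sum (λ v → ω S φ v * f (upd φ p v))
        fixed : ∀ v → K S p f (upd φ p v) ≡ K S p f φ
        fixed v = cong₂ _*_ (cong inv (W-cong {S} (upd-∉ φ v p∉S)))
          (sum-cong-≗ λ w → cong₂ _*_ (ω-cong {S} (upd-∉ φ v p∉S) w) (f-ext _ _ (upd-upd φ p v w)))
        cancel : Dec (W S φ ≡ 0ℚ) → W S φ * inv (W S φ) * s ≡ s
        cancel (no W≢0)  = trans (cong (_* s) (*-inv W≢0)) (ℚ.*-identityˡ s)
        cancel (yes W≡0) = trans (cong (W S φ * inv (W S φ) *_) s≡0) (trans (ℚ.*-zeroʳ (W S φ * inv (W S φ))) (sym s≡0))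
          where
          s≡0 : s ≡ 0ℚ
          s≡0 = sum-0 λ v → trans (cong (_* f (upd φ p v)) (W≡0⇒ω≡0 {S} {φ} W≡0 v)) (ℚ.*-zeroˡ (f (upd φ p v)))

      -- Once the sums are exchanged, drawing p given S and then stepping to ℓ weighs p, for each
      -- label of ℓ, by `ω (S ∪ ⁅ ℓ ⁆)`. The innermost kernel redraws p with exactly these weights,
      -- hence is absorbed. This is what keeps p resamplable after a leaf ℓ has been attached to it.
      K-absorb : ∀ {S p ℓ f} → p ∉ S → ℓ ∉ S → p ≢ ℓ → Extensional f → ∀ φ →
        K S p (K ⁅ p ⁆ ℓ (K (S ∪ ⁅ ℓ ⁆) p f)) φ ≡ K S p (K ⁅ p ⁆ ℓ f) φ
      K-absorb {S} {p} {ℓ} {f} p∉S ℓ∉S p≢ℓ f-ext φ = cong (inv (W S φ) *_) (begin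
        sum (λ v → ω S φ v * K ⁅ p ⁆ ℓ (K S⁺ p f) (upd φ p v))
          ≡⟨ ω-K-singleton ℓ∉S p≢ℓ (K-ext {S⁺} f-ext) φ ⟩
        sum (λ u → sum (λ v → ω S⁺ (upd φ ℓ u) v * K S⁺ p f (upd (upd φ ℓ u) p v)))
          ≡⟨ sum-cong-≗ (λ u → ω-K-absorb p∉S⁺ f-ext (upd φ ℓ u)) ⟩
        sum (λ u → sum (λ v → ω S⁺ (upd φ ℓ u) v * f (upd (upd φ ℓ u) p v)))
          ≡⟨ sym (ω-K-singleton ℓ∉S p≢ℓ f-ext φ) ⟩
        sum (λ v → ω S φ v * K ⁅ p ⁆ ℓ f (upd φ p v)) ∎)
        where
        open ≡-Reasoning
        S⁺ = S ∪ ⁅ ℓ ⁆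
        p∉S⁺ : p ∉ S⁺
        p∉S⁺ p∈ with x∈p∪q⁻ S ⁅ ℓ ⁆ p∈
        ... | inj₁ p∈S = p∉S p∈S
        ... | inj₂ p∈ℓ = p≢ℓ (x∈⁅y⁆⇒x≡y ℓ p∈ℓ)

      -- Neither draw reads the label that the other one writes.
      K-comm : ∀ {S c p ℓ f} → c ≢ p → c ≢ ℓ → ℓ ∉ S → Extensional f → ∀ φ →
        K S c (K ⁅ p ⁆ ℓ f) φ ≡ K ⁅ p ⁆ ℓ (K S c f) φ
      K-comm {S} {c} {p} {ℓ} {f} c≢p c≢ℓ ℓ∉S f-ext φ = begin
        i * sum (λ v → ω S φ v * K ⁅ p ⁆ ℓ f (upd φ c v))
          ≡⟨ cong (i *_) (sum-cong-≗ λ v → cong (ω S φ v *_) (K-singleton p ℓ f (upd φ c v))) ⟩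
        i * sum (λ v → ω S φ v * sum (λ u → P (upd φ c v p) u * f (upd (upd φ c v) ℓ u)))
          ≡⟨ cong (i *_) (sum-cong-≗ λ v → trans
               (*-distribˡ-sum (ω S φ v) (λ u → P (upd φ c v p) u * f (upd (upd φ c v) ℓ u)))
               (sum-cong-≗ (term v))) ⟩
        i * sum (λ v → sum (λ u → P (φ p) u * (ω S φ v * f (upd (upd φ ℓ u) c v))))
          ≡⟨ cong (i *_) (∑-comm (λ v u → P (φ p) u * (ω S φ v * f (upd (upd φ ℓ u) c v)))) ⟩
        i * sum (λ u → sum (λ v → P (φ p) u * (ω S φ v * f (upd (upd φ ℓ u) c v))))
          ≡⟨ cong (i *_) (sum-cong-≗ λ u → sym (*-distribˡ-sum (P (φ p) u) (λ v → ω S φ v * f (upd (upd φ ℓ u) c v)))) ⟩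
        i * sum (λ u → P (φ p) u * s u)
          ≡⟨ *-distribˡ-sum i (λ u → P (φ p) u * s u) ⟩
        sum (λ u → i * (P (φ p) u * s u))
          ≡⟨ sum-cong-≗ (λ u → solve 3 (λ x y z → x :* (y :* z) := y :* (x :* z)) refl i (P (φ p) u) (s u)) ⟩
        sum (λ u → P (φ p) u * (i * s u))
          ≡⟨ sum-cong-≗ (λ u → cong (P (φ p) u *_) (cong₂ _*_
               (cong inv (W-cong {S} λ a a∈S → sym (upd-∉ φ u ℓ∉S a a∈S)))
               (sum-cong-≗ λ v → cong (_* f (upd (upd φ ℓ u) c v)) (ω-cong {S} (λ a a∈S → sym (upd-∉ φ u ℓ∉S a a∈S)) v)))) ⟩
        sum (λ u → P (φ p) u * K S c f (upd φ ℓ u))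
          ≡⟨ sym (K-singleton p ℓ (K S c f) φ) ⟩
        K ⁅ p ⁆ ℓ (K S c f) φ ∎
        where
        open ≡-Reasoning
        open +-*-Solver
        i = inv (W S φ)
        s : Fin n → ℚ
        s u = sum (λ v → ω S φ v * f (upd (upd φ ℓ u) c v))
        term : ∀ v u → ω S φ v * (P (upd φ c v p) u * f (upd (upd φ c v) ℓ u)) ≡
                       P (φ p) u * (ω S φ v * f (upd (upd φ ℓ u) c v))
        term v u = trans
          (cong (ω S φ v *_) (cong₂ _*_ (cong (λ z → P z u) (upd-≢ φ v (c≢p ∘ sym))) (f-ext _ _ (upd-comm φ v u c≢ℓ))))
          (solve 3 (λ x y z → x :* (y :* z) := y :* (x :* z)) refl (ω S φ v) (P (φ p) u) (f (upd (upd φ ℓ u) c v)))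

      -- The sum of `D v * P v u` over v is `D u`: one step from the stationary law is stationary
      -- again.
      K-stationary : ∀ {p ℓ f} → p ≢ ℓ → DependsOn (_≡ ℓ) f → ∀ φ → K ⊥ p (K ⁅ p ⁆ ℓ f) φ ≡ K ⊥ ℓ f φ
      K-stationary {p} {ℓ} {f} p≢ℓ f-dep φ = cong (inv (W ⊥ φ) *_) (begin
        sum (λ v → ω ⊥ φ v * K ⁅ p ⁆ ℓ f (upd φ p v))
          ≡⟨ ω-K-singleton (∉⊥ {x = ℓ}) p≢ℓ (DependsOn⇒Extensional f-dep) φ ⟩
        sum (λ u → sum (λ v → ω (⊥ ∪ ⁅ ℓ ⁆) (upd φ ℓ u) v * f (upd (upd φ ℓ u) p v)))
          ≡⟨ sum-cong-≗ (λ u → sum-cong-≗ λ v → cong₂ (λ S x → ω S (upd φ ℓ u) v * x) (∪-identityˡ ⁅ ℓ ⁆)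
               (f-dep _ _ λ { a refl → upd-≢ (upd φ ℓ u) v (p≢ℓ ∘ sym) })) ⟩
        sum (λ u → sum (λ v → ω ⁅ ℓ ⁆ (upd φ ℓ u) v * f (upd φ ℓ u)))
          ≡⟨ sum-cong-≗ (λ u → sym (*-distribʳ-sum (f (upd φ ℓ u)) (ω ⁅ ℓ ⁆ (upd φ ℓ u)))) ⟩
        sum (λ u → W ⁅ ℓ ⁆ (upd φ ℓ u) * f (upd φ ℓ u))
          ≡⟨ sum-cong-≗ (λ u → cong (_* f (upd φ ℓ u)) (trans (W-singleton ℓ (upd φ ℓ u))
               (trans (cong D (upd-≡ φ ℓ u)) (sym (ω-⊥ φ u))))) ⟩
        sum (λ u → ω ⊥ φ u * f (upd φ ℓ u)) ∎)
        where open ≡-Reasoning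

  -- Laws of random maps

  module _ {h : ℕ} (_~_ : Fin h → Fin h → Set) (_~?_ : ∀ a b → Dec (a ~ b))
           (~-sym : ∀ {a b} → a ~ b → b ~ a) (~-irrefl : ∀ {a} → ¬ (a ~ a)) where

    fromRelation : Graph h
    fromRelation .N a = tabulate λ b → does (a ~? b)
    fromRelation .N-sym {a} {b} ab = ∈-tabulate⁺ (b ~?_) (~-sym (∈-tabulate⁻ (a ~?_) ab))
    fromRelation .irrefl {a} aa = ~-irrefl (∈-tabulate⁻ (a ~?_) aa)

  -- Stars as subtrees

  module _ {h : ℕ} (T : SubGraph h) {c : Fin h} (c∈T : c ∈ V T) {S : Subset h} (S⊆N : S ⊆ Nbh T c) where

    private
      StarEdge : Fin h → Fin h → Set
      StarEdge a b = (a ≡ c × b ∈ S) ⊎ (b ≡ c × a ∈ S)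

      starEdge? : ∀ a b → Dec (StarEdge a b)
      starEdge? a b = ((a ≟ᶠ c) ×-dec (b ∈? S)) ⊎-dec ((b ≟ᶠ c) ×-dec (a ∈? S))

      starEdge-sym : ∀ {a b} → StarEdge a b → StarEdge b a
      starEdge-sym (inj₁ p) = inj₂ p
      starEdge-sym (inj₂ p) = inj₁ p

      c∉S : c ∉ S
      c∉S c∈S = irrefl (graph T) (S⊆N c∈S)

      starEdge-irrefl : ∀ {a} → ¬ StarEdge a a
      starEdge-irrefl (inj₁ (refl , c∈S)) = c∉S c∈S
      starEdge-irrefl (inj₂ (refl , c∈S)) = c∉S c∈S

      ∈-Nbh⁺ : ∀ {a b} → StarEdge a b → b ∈ tabulate (λ b → does (starEdge? a b))
      ∈-Nbh⁺ {a} = ∈-tabulate⁺ (starEdge? a)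

      ∈-Nbh⁻ : ∀ {a b} → b ∈ tabulate (λ b → does (starEdge? a b)) → StarEdge a b
      ∈-Nbh⁻ {a} = ∈-tabulate⁻ (starEdge? a)

    -- S may be a proper part of the neighbourhood of c: leaves are peeled off one at a time, and
    -- `S = ⊥` yields the tree with the single vertex c.
    star : SubGraph h
    star .V       = ⁅ c ⁆ ∪ S
    star .graph   = fromRelation StarEdge starEdge? starEdge-sym starEdge-irrefl
    star .support {a} b∈ with ∈-Nbh⁻ {a} b∈
    ... | inj₁ (_ , b∈S)  = x∈p∪q⁺ (inj₂ b∈S)
    ... | inj₂ (refl , _) = x∈p∪q⁺ (inj₁ (x∈⁅x⁆ c))

    ∈-star⁻ : ∀ {a} → a ∈ V star → a ≡ c ⊎ a ∈ S
    ∈-star⁻ a∈ with x∈p∪q⁻ ⁅ c ⁆ S a∈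
    ... | inj₁ a∈c = inj₁ (x∈⁅y⁆⇒x≡y c a∈c)
    ... | inj₂ a∈S = inj₂ a∈S

    ∈-star⁺ : ∀ {a} → a ≡ c ⊎ a ∈ S → a ∈ V star
    ∈-star⁺ (inj₁ refl) = x∈p∪q⁺ (inj₁ (x∈⁅x⁆ c))
    ∈-star⁺ (inj₂ a∈S)  = x∈p∪q⁺ (inj₂ a∈S)

    Nbh-center : Nbh star c ≡ S
    Nbh-center = ⊆-antisym fwd (λ b∈S → ∈-Nbh⁺ (inj₁ (refl , b∈S)))
      where
      fwd : Nbh star c ⊆ S
      fwd b∈ with ∈-Nbh⁻ {c} b∈
      ... | inj₁ (_ , b∈S) = b∈S
      ... | inj₂ (_ , c∈S) = contradiction c∈S c∉S

    Nbh-leaf : ∀ {a} → a ∈ S → Nbh star a ≡ ⁅ c ⁆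
    Nbh-leaf {a} a∈S = ⊆-antisym fwd (λ b∈c → ∈-Nbh⁺ (inj₂ (x∈⁅y⁆⇒x≡y c b∈c , a∈S)))
      where
      fwd : Nbh star a ⊆ ⁅ c ⁆
      fwd {b} b∈ with ∈-Nbh⁻ {a} b∈
      ... | inj₁ (refl , _) = contradiction a∈S c∉S
      ... | inj₂ (refl , _) = x∈⁅x⁆ b

    star-subtree : star IsSubtreeOf T
    star-subtree = ((c , ∈-star⁺ (inj₁ refl)) , walk) , V⊆ , N⊆
      where
      to-center : ∀ {a} → a ≡ c ⊎ a ∈ S → Star (λ a b → b ∈ Nbh star a) a c
      to-center (inj₁ refl) = ε
      to-center (inj₂ a∈S)  = ∈-Nbh⁺ (inj₂ (refl , a∈S)) ◅ ε
      from-center : ∀ {a} → a ≡ c ⊎ a ∈ S → Star (λ a b → b ∈ Nbh star a) c a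
      from-center (inj₁ refl) = ε
      from-center (inj₂ a∈S)  = ∈-Nbh⁺ (inj₁ (refl , a∈S)) ◅ ε
      walk : ∀ u v → u ∈ V star → v ∈ V star → Star (λ a b → b ∈ Nbh star a) u v
      walk u v u∈ v∈ = to-center (∈-star⁻ u∈) ◅◅ from-center (∈-star⁻ v∈)
      V⊆ : V star ⊆ V T
      V⊆ a∈ with ∈-star⁻ a∈
      ... | inj₁ refl = c∈T
      ... | inj₂ a∈S  = support T (S⊆N a∈S)
      N⊆ : ∀ a → Nbh star a ⊆ Nbh T a
      N⊆ a b∈ with ∈-Nbh⁻ {a} b∈
      ... | inj₁ (refl , b∈S) = S⊆N b∈S
      ... | inj₂ (refl , a∈S) = N-sym (graph T) (S⊆N a∈S)

  remove-one : ∀ {h k} (S : Subset h) → ∣ S ∣ ≡ suc k → ∃[ a ] ∃[ S⁻ ] (a ∉ S⁻ × S⁻ ∪ ⁅ a ⁆ ≡ S × ∣ S⁻ ∣ ≡ k)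
  remove-one (inside ∷ S) ∣S∣≡ = zero , outside ∷ S , (λ ()) , cong (inside ∷_) (∪-identityʳ S) , cong ℕ.pred ∣S∣≡
  remove-one (outside ∷ S) ∣S∣≡ with remove-one S ∣S∣≡
  ... | a , S⁻ , a∉ , S≡ , ∣S⁻∣≡ = suc a , outside ∷ S⁻ , (λ { (there a∈) → a∉ a∈ }) , cong (outside ∷_) S≡ , ∣S⁻∣≡

  ∣S∣≡0⇒S≡⊥ : ∀ {h} (S : Subset h) → ∣ S ∣ ≡ 0 → S ≡ ⊥
  ∣S∣≡0⇒S≡⊥ []            _    = refl
  ∣S∣≡0⇒S≡⊥ (outside ∷ S) ∣S∣≡ = cong (outside ∷_) (∣S∣≡0⇒S≡⊥ S ∣S∣≡)

  -- Collisions between labels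

  module _ {h n : ℕ} where

    InjectiveOn : Subset h → (Fin h → Fin n) → Set
    InjectiveOn U φ = ∀ a b → a ∈ U → b ∈ U → φ a ≡ φ b → a ≡ b

    injectiveOn? : ∀ U φ → Dec (InjectiveOn U φ)
    injectiveOn? U φ = all? λ a → all? λ b → (a ∈? U) →-dec ((b ∈? U) →-dec ((φ a ≟ᶠ φ b) →-dec (a ≟ᶠ b)))

    collides : Subset h → (Fin h → Fin n) → ℚ
    collides U φ = if does (injectiveOn? U φ) then 0ℚ else 1ℚ

    collides-nonNeg : ∀ U φ → 0ℚ ≤ collides U φ
    collides-nonNeg U φ with does (injectiveOn? U φ)
    ... | true  = ℚ.≤-refl
    ... | false = 0≤1

    collides-injective : ∀ {U φ} → InjectiveOn U φ → collides U φ ≡ 0ℚ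
    collides-injective {U} {φ} inj = cong (if_then 0ℚ else 1ℚ) (dec-true (injectiveOn? U φ) inj)

    collides-¬injective : ∀ {U φ} → ¬ InjectiveOn U φ → collides U φ ≡ 1ℚ
    collides-¬injective {U} {φ} ¬inj = cong (if_then 0ℚ else 1ℚ) (dec-false (injectiveOn? U φ) ¬inj)

    collides≤1 : ∀ U φ → collides U φ ≤ 1ℚ
    collides≤1 U φ with does (injectiveOn? U φ)
    ... | true  = 0≤1
    ... | false = ℚ.≤-refl

    -- A union bound. The sum runs over all of `Fin h`, so labels outside U are counted as well; the
    -- price is a factor h in place of the size of U.
    collides-upd : ∀ {U x} → x ∉ U → ∀ φ v →
                   collides (U ∪ ⁅ x ⁆) (upd φ x v) ≤ collides U φ + sum (λ a → δ v (φ a))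
    collides-upd {U} {x} x∉U φ v = by-cases (injectiveOn? U φ) (any? (λ a → v ≟ᶠ φ a))
      where
      0≤δ : ∀ a → 0ℚ ≤ δ v (φ a)
      0≤δ a = δ-nonNeg v (φ a)
      by-cases : Dec (InjectiveOn U φ) → Dec (∃[ a ] v ≡ φ a) →
                 collides (U ∪ ⁅ x ⁆) (upd φ x v) ≤ collides U φ + sum (λ a → δ v (φ a))
      by-cases (no ¬inj) _ = ℚ.≤-trans (collides≤1 (U ∪ ⁅ x ⁆) (upd φ x v))
        (ℚ.≤-trans (ℚ.≤-reflexive (sym (collides-¬injective ¬inj))) (p≤p+q (sum-nonNeg 0≤δ)))
      by-cases (yes inj) (yes (a , v≡φa)) = ℚ.≤-trans (collides≤1 (U ∪ ⁅ x ⁆) (upd φ x v))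
        (ℚ.≤-trans (ℚ.≤-reflexive (sym (trans (cong (δ v) (sym v≡φa)) (δ-refl v))))
          (ℚ.≤-trans (term≤sum 0≤δ a) (p≤q+p (collides-nonNeg U φ))))
      by-cases (yes inj) (no v∉φ) = ℚ.≤-trans (ℚ.≤-reflexive (collides-injective inj⁺))
        (+-nonNeg (collides-nonNeg U φ) (sum-nonNeg 0≤δ))
        where
        inj⁺ : InjectiveOn (U ∪ ⁅ x ⁆) (upd φ x v)
        inj⁺ a b a∈ b∈ eq with x∈p∪q⁻ U ⁅ x ⁆ a∈ | x∈p∪q⁻ U ⁅ x ⁆ b∈
        ... | inj₁ a∈U | inj₁ b∈U = inj a b a∈U b∈U
          (trans (sym (upd-≢ φ v (∉⇒≢ a∈U x∉U))) (trans eq (upd-≢ φ v (∉⇒≢ b∈U x∉U))))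
        ... | inj₂ a∈x | inj₂ b∈x = trans (x∈⁅y⁆⇒x≡y x a∈x) (sym (x∈⁅y⁆⇒x≡y x b∈x))
        ... | inj₁ a∈U | inj₂ b∈x with x∈⁅y⁆⇒x≡y x b∈x
        ...   | refl = contradiction
          (a , trans (sym (upd-≡ φ x v)) (trans (sym eq) (upd-≢ φ v (∉⇒≢ a∈U x∉U)))) v∉φ
        inj⁺ a b a∈ b∈ eq | inj₂ a∈x | inj₁ b∈U with x∈⁅y⁆⇒x≡y x a∈x
        ...   | refl = contradiction
          (b , trans (sym (upd-≡ φ x v)) (trans eq (upd-≢ φ v (∉⇒≢ b∈U x∉U)))) v∉φ

  module Laws {n : ℕ} (G : Graph n) {h : ℕ} where

    open Kernel G

    -- The expectation of a random map Fin h → Fin n that almost surely has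
    -- the property X.
    record Law (X : (Fin h → Fin n) → Set) : Set where
      field
        E      : ((Fin h → Fin n) → ℚ) → ℚ
        E-+    : ∀ f g → E (λ φ → f φ + g φ) ≡ E f + E g
        E-*    : ∀ c f → E (λ φ → c * f φ) ≡ c * E f
        E-1    : E (λ _ → 1ℚ) ≡ 1ℚ
        E-mono : ∀ {f g} → (∀ φ → X φ → f φ ≤ g φ) → E f ≤ E g

      E-cong : ∀ {f g} → (∀ φ → X φ → f φ ≡ g φ) → E f ≡ E g
      E-cong f≡g = ℚ.≤-antisym (E-mono λ φ Xφ → ℚ.≤-reflexive (f≡g φ Xφ))
                               (E-mono λ φ Xφ → ℚ.≤-reflexive (sym (f≡g φ Xφ)))

      E-const : ∀ c → E (λ _ → c) ≡ c
      E-const c = begin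
        E (λ _ → c)        ≡⟨ E-cong (λ _ _ → sym (ℚ.*-identityʳ c)) ⟩
        E (λ _ → c * 1ℚ)   ≡⟨ E-* c (λ _ → 1ℚ) ⟩
        c * E (λ _ → 1ℚ)   ≡⟨ cong (c *_) E-1 ⟩
        c * 1ℚ             ≡⟨ ℚ.*-identityʳ c ⟩
        c                  ∎
        where open ≡-Reasoning

    open Law public

    weaken : ∀ {X Y} → (∀ φ → X φ → Y φ) → Law X → Law Y
    weaken X⇒Y L = record
      { E = E L ; E-+ = E-+ L ; E-* = E-* L ; E-1 = E-1 L
      ; E-mono = λ f≤g → E-mono L λ φ Xφ → f≤g φ (X⇒Y φ Xφ) }

    dirac : ∀ φ → Law (_≡ φ)
    dirac φ = record
      { E = λ f → f φ ; E-+ = λ f g → refl ; E-* = λ c f → refl ; E-1 = refl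
      ; E-mono = λ f≤g → f≤g φ refl }

    -- Every random map arises from a point mass by this one operation: `S = ⊥` starts the walk at
    -- the root, a singleton S is a step to a leaf, and the neighbourhood of c gives a star flip.
    -- Positivity of W on the support keeps the total mass equal to 1.
    resample : ∀ {X Y} → Law X → ∀ S y → (∀ φ → X φ → W S φ ≢ 0ℚ) →
               (∀ φ v → X φ → ω S φ v ≢ 0ℚ → Y (upd φ y v)) → Law Y
    resample L S y W≢0 X⇒Y = record
      { E      = λ f → E L (K S y f)
      ; E-+    = λ f g → trans (E-cong L λ φ _ → K-+ S y f g φ) (E-+ L (K S y f) (K S y g))
      ; E-*    = λ c f → trans (E-cong L λ φ _ → K-* S y c f φ) (E-* L c (K S y f))
      ; E-1    = trans (E-cong L λ φ Xφ → K-const {S = S} {y} {λ _ → 1ℚ} {φ} (W≢0 φ Xφ) λ v → refl) (E-1 L)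
      ; E-mono = λ {f} {g} f≤g → E-mono L λ φ Xφ → K-mono {S = S} {y} {f} {g} {φ} λ v ω≢0 → f≤g _ (X⇒Y φ v Xφ ω≢0)
      }

    -- The condition that defines a Gibbs measure, at one vertex. It is asked only for functions of
    -- the labels on Q: a vertex outside Q may be adjacent to c, and redrawing c without regard to
    -- it would change the joint law.
    Gibbs : ∀ {X} → Law X → SubGraph h → Fin h → Set
    Gibbs L Q c = ∀ f → DependsOn (_∈ V Q) f → E L f ≡ E L (K (Nbh Q c) c f)

    -- Peeling off leaves of a tree T, these identities determine the law on `V T` as that of the
    -- stationary random walk. All subtrees are included since stars with fewer leaves, down to
    -- single vertices, are used as well.
    Markov : ∀ {X} → Law X → SubGraph h → Set
    Markov L T = ∀ Q → Q IsSubtreeOf T → ∀ {c} → c ∈ V Q → Gibbs L Q c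

    -- The labels of a star are resampled one leaf at a time and then at the
    -- centre; summing out the centre first turns its weights into W S.
    star-bound : ∀ {X T c} (L : Law X) → Markov L T → c ∈ V T →
      ∀ k {S} → S ⊆ Nbh T c → ∣ S ∣ ≡ k → ∀ {f B} → DependsOn (λ a → a ≡ c ⊎ a ∈ S) f →
      (∀ φ → sum (λ v → ω S φ v * f (upd φ c v)) ≤ B) → E L f ≤ ι n ^ k * B * inv M
    star-bound {T = T} {c} L markov c∈T zero {S} S⊆N ∣S∣≡ {f} {B} f-dep bound = begin
      E L f
        ≡⟨ markov Q (star-subtree T c∈T S⊆N) (∈-star⁺ T c∈T S⊆N (inj₁ refl)) f
             (λ φ ψ φ≡ψ → f-dep φ ψ λ a a∈ → φ≡ψ a (∈-star⁺ T c∈T S⊆N a∈)) ⟩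
      E L (K (Nbh Q c) c f)
        ≡⟨ cong (λ S → E L (K S c f)) (Nbh-center T c∈T S⊆N) ⟩
      E L (K S c f)
        ≤⟨ E-mono L (λ φ _ → ≤-const φ) ⟩
      E L (λ _ → 1ℚ * B * inv M)
        ≡⟨ E-const L (1ℚ * B * inv M) ⟩
      1ℚ * B * inv M ∎
      where
      open ℚ.≤-Reasoning
      Q = star T c∈T S⊆N
      ≤-const : ∀ φ → K S c f φ ≤ 1ℚ * B * inv M
      ≤-const φ = begin
        inv (W S φ) * sum (λ v → ω S φ v * f (upd φ c v)) ≤⟨ *-monoʳ (inv-nonNeg (W-nonNeg S φ)) (bound φ) ⟩
        inv (W S φ) * B ≡⟨ cong (λ w → inv w * B) (trans (cong (λ S → W S φ) (∣S∣≡0⇒S≡⊥ S ∣S∣≡)) (W-⊥ φ)) ⟩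
        inv M * B       ≡⟨ ℚ.*-comm (inv M) B ⟩
        B * inv M       ≡⟨ cong (_* inv M) (sym (ℚ.*-identityˡ B)) ⟩
        1ℚ * B * inv M  ∎
    star-bound {T = T} {c} L markov c∈T (suc k) {S} S⊆N ∣S∣≡ {f} {B} f-dep bound with remove-one S ∣S∣≡
    ... | a , S⁻ , a∉S⁻ , refl , ∣S⁻∣≡ = begin
      E L f
        ≡⟨ markov Q (star-subtree T c∈T S⊆N) (∈-star⁺ T c∈T S⊆N (inj₂ a∈S)) f
             (λ φ ψ φ≡ψ → f-dep φ ψ λ a a∈ → φ≡ψ a (∈-star⁺ T c∈T S⊆N a∈)) ⟩
      E L (K (Nbh Q a) a f)
        ≡⟨ cong (λ S → E L (K S a f)) (Nbh-leaf T c∈T S⊆N a∈S) ⟩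
      E L (K ⁅ c ⁆ a f)
        ≤⟨ star-bound {T = T} L markov c∈T k (λ b∈ → S⊆N (x∈p∪q⁺ (inj₁ b∈))) ∣S⁻∣≡ K-dep K-bound ⟩
      ι n ^ k * (ι n * B) * inv M
        ≡⟨ solve 4 (λ x y z w → x :* (y :* z) :* w := y :* x :* z :* w) refl (ι n ^ k) (ι n) B (inv M) ⟩
      ι n * ι n ^ k * B * inv M ∎
      where
      open ℚ.≤-Reasoning
      open +-*-Solver
      Q = star T c∈T S⊆N
      a∈S : a ∈ S⁻ ∪ ⁅ a ⁆
      a∈S = x∈p∪q⁺ (inj₂ (x∈⁅x⁆ a))
      c≢a : c ≢ a
      c≢a refl = irrefl (graph T) (S⊆N a∈S)
      K-dep : DependsOn (λ b → b ≡ c ⊎ b ∈ S⁻) (K ⁅ c ⁆ a f)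
      K-dep = K-depends {S = ⁅ c ⁆} f-dep (λ b b∈c → inj₁ (x∈⁅y⁆⇒x≡y c b∈c)) reduce
        where
        reduce : ∀ b → b ≡ c ⊎ b ∈ S⁻ ∪ ⁅ a ⁆ → b ≢ a → b ≡ c ⊎ b ∈ S⁻
        reduce b (inj₁ b≡c) _ = inj₁ b≡c
        reduce b (inj₂ b∈S) b≢a with x∈p∪q⁻ S⁻ ⁅ a ⁆ b∈S
        ... | inj₁ b∈ = inj₂ b∈
        ... | inj₂ b∈ = contradiction (x∈⁅y⁆⇒x≡y a b∈) b≢a
      K-bound : ∀ φ → sum (λ v → ω S⁻ φ v * K ⁅ c ⁆ a f (upd φ c v)) ≤ ι n * B
      K-bound φ = begin
        sum (λ v → ω S⁻ φ v * K ⁅ c ⁆ a f (upd φ c v))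
          ≡⟨ ω-K-singleton a∉S⁻ c≢a (DependsOn⇒Extensional f-dep) φ ⟩
        sum (λ u → sum (λ v → ω (S⁻ ∪ ⁅ a ⁆) (upd φ a u) v * f (upd (upd φ a u) c v)))
          ≤⟨ sum-mono (λ u → bound (upd φ a u)) ⟩
        sum {n} (λ _ → B) ≡⟨ sum-const {n} B ⟩
        ι n * B ∎

    module Collisions {r : ℕ} (scale : Scale r) where

      open Scale scale

      low : Fin n → ℚ
      low v = if does (β ℚ.<? I v) then 1ℚ else 0ℚ

      low-cases : ∀ v → (low v ≡ 1ℚ × β < I v) ⊎ (low v ≡ 0ℚ × I v ≤ β)
      low-cases v = by-cases (β ℚ.<? I v)
        where
        by-cases : (d : Dec (β < I v)) → ((if does d then 1ℚ else 0ℚ) ≡ 1ℚ × β < I v) ⊎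
                                         ((if does d then 1ℚ else 0ℚ) ≡ 0ℚ × I v ≤ β)
        by-cases (yes β<I) = inj₁ (refl , β<I)
        by-cases (no β≮I)  = inj₂ (refl , ℚ.≮⇒≥ β≮I)

      low-nonNeg : ∀ v → 0ℚ ≤ low v
      low-nonNeg v with low-cases v
      ... | inj₁ (low≡1 , _) = ℚ.≤-trans 0≤1 (ℚ.≤-reflexive (sym low≡1))
      ... | inj₂ (low≡0 , _) = ℚ.≤-reflexive (sym low≡0)

      D*low≤γ : ∀ v → D v * low v ≤ γ
      D*low≤γ v with low-cases v
      ... | inj₂ (low≡0 , _) = ℚ.≤-trans (ℚ.≤-reflexive (trans (cong (D v *_) low≡0) (ℚ.*-zeroʳ (D v)))) 0≤γ
      ... | inj₁ (low≡1 , β<I) = begin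
        D v * low v    ≡⟨ cong (D v *_) low≡1 ⟩
        D v * 1ℚ       ≤⟨ *-monoʳ (D-nonNeg v) 1≤γβ ⟩
        D v * (γ * β)  ≡⟨ solve 3 (λ x y z → x :* (y :* z) := y :* (x :* z)) refl (D v) γ β ⟩
        γ * (D v * β)  ≤⟨ *-monoʳ 0≤γ (ℚ.≤-trans (*-monoʳ (D-nonNeg v) (ℚ.<⇒≤ β<I)) (p*inv-p≤1 (D v))) ⟩
        γ * 1ℚ         ≡⟨ ℚ.*-identityʳ γ ⟩
        γ              ∎
        where
        open ℚ.≤-Reasoning
        open +-*-Solver

      -- Each of the k + 1 factors `P v (φ a)` is at most `I v`. One of them cancels `D v`, and for
      -- a label that is not low the other k are at most β.
      ω≤ : ∀ {k S} → ∣ S ∣ ≡ suc k → ∀ (φ : Fin h → Fin n) v → ω S φ v ≤ ω S φ v * low v + β ^ k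
      ω≤ {k} {S} ∣S∣≡ φ v with low-cases v
      ... | inj₁ (low≡1 , _) = ℚ.≤-trans
        (ℚ.≤-reflexive (sym (trans (cong (ω S φ v *_) low≡1) (ℚ.*-identityʳ (ω S φ v)))))
        (p≤p+q (^-nonNeg 0≤β k))
      ... | inj₂ (_ , I≤β) = begin
        D v * ∏ S (λ a → P v (φ a))
          ≤⟨ *-monoʳ (D-nonNeg v) (∏-≤-^ S (λ a → P-nonNeg v (φ a)) (λ a → P≤I v (φ a))) ⟩
        D v * I v ^ ∣ S ∣       ≡⟨ cong (λ j → D v * I v ^ j) ∣S∣≡ ⟩
        D v * (I v * I v ^ k)   ≡⟨ sym (ℚ.*-assoc (D v) (I v) (I v ^ k)) ⟩
        D v * I v * I v ^ k     ≤⟨ *-mono (*-nonNeg (D-nonNeg v) (I-nonNeg v)) (^-nonNeg 0≤β k) (p*inv-p≤1 (D v)) (^-mono k) ⟩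
        1ℚ * β ^ k              ≡⟨ ℚ.*-identityˡ (β ^ k) ⟩
        β ^ k                   ≤⟨ p≤q+p (*-nonNeg (ω-nonNeg S φ v) (low-nonNeg v)) ⟩
        ω S φ v * low v + β ^ k ∎
        where
        open ℚ.≤-Reasoning
        ^-mono : ∀ j → I v ^ j ≤ β ^ j
        ^-mono zero    = ℚ.≤-refl
        ^-mono (suc j) = *-mono (I-nonNeg v) (^-nonNeg 0≤β j) I≤β (^-mono j)

      -- The conditional mean, given the old map φ, of the number of indices whose old label equals
      -- the fresh one.
      hits : Subset h → (Fin h → Fin n) → ℚ
      hits S φ = inv (W S φ) * sum (λ a → ω S φ (φ a))

      -- A low old label contributes at most the weight of all low labels, hence at most the
      -- probability that the fresh label is low. Thus nothing need be known about how the old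
      -- labels are correlated with those on S.
      hits≤ : ∀ {k S} → ∣ S ∣ ≡ suc k → ∀ x φ →
              hits S φ ≤ ι h * K S x (λ ψ → low (ψ x)) φ + ι h * β ^ k * inv (W S φ)
      hits≤ {k} {S} ∣S∣≡ x φ = begin
        i * sum (λ a → ω S φ (φ a))
          ≤⟨ *-monoʳ 0≤i (sum-mono (λ a → ℚ.≤-trans (ω≤ {S = S} ∣S∣≡ φ (φ a))
               (ℚ.+-monoˡ-≤ (β ^ k) (term≤sum (λ v → *-nonNeg (ω-nonNeg S φ v) (low-nonNeg v)) (φ a))))) ⟩
        i * sum {h} (λ _ → s + β ^ k)  ≡⟨ cong (i *_) (sum-const {h} (s + β ^ k)) ⟩
        i * (ι h * (s + β ^ k))
          ≡⟨ solve 4 (λ x y z w → x :* (y :* (z :+ w)) := y :* (x :* z) :+ y :* w :* x) refl i (ι h) s (β ^ k) ⟩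
        ι h * (i * s) + ι h * β ^ k * i
          ≡⟨ cong (λ t → ι h * (i * t) + ι h * β ^ k * i) (sum-cong-≗ λ v → cong (λ u → ω S φ v * low u) (sym (upd-≡ φ x v))) ⟩
        ι h * K S x (λ ψ → low (ψ x)) φ + ι h * β ^ k * i ∎
        where
        open ℚ.≤-Reasoning
        open +-*-Solver
        i = inv (W S φ)
        s = sum (λ v → ω S φ v * low v)
        0≤i = inv-nonNeg (W-nonNeg S φ)

      module _ {X Y : (Fin h → Fin n) → Set} (L : Law X) {S : Subset h} {x : Fin h}
        (W≢0 : ∀ φ → X φ → W S φ ≢ 0ℚ) (X⇒Y : ∀ φ v → X φ → ω S φ v ≢ 0ℚ → Y (upd φ x v)) where

        private
          L⁺ : Law Y
          L⁺ = resample L S x W≢0 X⇒Y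

        hits-bound : ∀ {T} → Markov L⁺ T → x ∈ V T → Nbh T x ≡ S →
                     ∀ {k} → ∣ S ∣ ≡ suc k → suc k ℕ.≤ r → E L (hits S) ≤ ι h * η + ι h * η
        hits-bound {T} markov x∈T Nx≡S {k} ∣S∣≡ k<r = begin
          E L (hits S)
            ≤⟨ E-mono L (λ φ _ → hits≤ {S = S} ∣S∣≡ x φ) ⟩
          E L (λ φ → ι h * K S x (λ ψ → low (ψ x)) φ + ι h * β ^ k * inv (W S φ))
            ≡⟨ E-+ L (λ φ → ι h * K S x (λ ψ → low (ψ x)) φ) (λ φ → ι h * β ^ k * inv (W S φ)) ⟩
          E L (λ φ → ι h * K S x (λ ψ → low (ψ x)) φ) + E L (λ φ → ι h * β ^ k * inv (W S φ))
            ≡⟨ cong₂ _+_ (E-* L (ι h) (K S x λ ψ → low (ψ x))) (E-* L (ι h * β ^ k) (λ φ → inv (W S φ))) ⟩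
          ι h * E L⁺ (λ ψ → low (ψ x)) + ι h * β ^ k * E L (λ φ → inv (W S φ))
            ≤⟨ ℚ.+-mono-≤ (*-monoʳ (ι-nonNeg h) low≤) inv≤ ⟩
          ι h * η + ι h * η ∎
          where
          open ℚ.≤-Reasoning
          open +-*-Solver
          x∉S : x ∉ S
          x∉S x∈S = irrefl (graph T) (subst (x ∈_) (sym Nx≡S) x∈S)
          low≤ : E L⁺ (λ ψ → low (ψ x)) ≤ η
          low≤ = begin
            E L⁺ (λ ψ → low (ψ x))
              -- A star without leaves: the label of x is stationary, and at most n low labels
              -- contribute at most γ each.
              ≤⟨ star-bound {T = T} L⁺ markov x∈T 0 {⊥} (λ a∈⊥ → contradiction a∈⊥ ∉⊥) (∣⊥∣≡0 h)
                   (λ φ ψ φ≡ψ → cong low (φ≡ψ x (inj₁ refl))) (λ φ → begin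
                     sum (λ v → ω ⊥ φ v * low (upd φ x v x))
                       ≡⟨ sum-cong-≗ (λ v → cong₂ (λ w u → w * low u) (ω-⊥ φ v) (upd-≡ φ x v)) ⟩
                     sum (λ v → D v * low v) ≤⟨ sum-mono D*low≤γ ⟩
                     sum {n} (λ _ → γ)       ≡⟨ sum-const {n} γ ⟩
                     ι n * γ                 ∎) ⟩
            1ℚ * (ι n * γ) * inv M ≡⟨ cong (_* inv M) (ℚ.*-identityˡ (ι n * γ)) ⟩
            ι n * γ * inv M        ≤⟨ low-bound ⟩
            η                      ∎
          inv≤ : ι h * β ^ k * E L (λ φ → inv (W S φ)) ≤ ι h * η
          inv≤ = begin
            ι h * β ^ k * E L (λ φ → inv (W S φ))
              -- The inverse weight does not read x, so its mean may be taken after x is drawn. Then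
              -- x and S form a star in T, and weighted summation over the centre turns 1/W into at
              -- most 1.
              ≡⟨ cong (ι h * β ^ k *_) (E-cong L λ φ Xφ → sym (K-const {S = S} {x} {λ ψ → inv (W S ψ)} {φ} (W≢0 φ Xφ)
                   λ v → cong inv (W-cong {S = S} (upd-∉ φ v x∉S)))) ⟩
            ι h * β ^ k * E L⁺ (λ φ → inv (W S φ))
              ≤⟨ *-monoʳ (*-nonNeg (ι-nonNeg h) (^-nonNeg 0≤β k)) (star-bound {T = T} L⁺ markov x∈T (suc k) {S}
                   (λ {a} a∈ → subst (a ∈_) (sym Nx≡S) a∈) ∣S∣≡
                   (λ φ ψ φ≡ψ → cong inv (W-cong {S = S} λ a a∈ → φ≡ψ a (inj₂ a∈))) (λ φ → begin
                     sum (λ v → ω S φ v * inv (W S (upd φ x v)))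
                       ≡⟨ sum-cong-≗ (λ v → cong (λ w → ω S φ v * inv w) (W-cong {S = S} (upd-∉ φ v x∉S))) ⟩
                     sum (λ v → ω S φ v * inv (W S φ)) ≡⟨ sym (*-distribʳ-sum (inv (W S φ)) (ω S φ)) ⟩
                     W S φ * inv (W S φ)               ≤⟨ p*inv-p≤1 (W S φ) ⟩
                     1ℚ                                ∎)) ⟩
            ι h * β ^ k * (ι n ^ suc k * 1ℚ * inv M)
              ≡⟨ solve 4 (λ x y z w → x :* y :* (z :* con 1ℚ :* w) := x :* (y :* (z :* w))) refl (ι h) (β ^ k) (ι n ^ suc k) (inv M) ⟩
            ι h * (β ^ k * (ι n ^ suc k * inv M))
              ≤⟨ *-monoʳ (ι-nonNeg h) (star-bounds k k<r) ⟩
            ι h * η ∎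

        collision-step : ∀ {T U} → x ∉ U → Markov L⁺ T → x ∈ V T → Nbh T x ≡ S →
          ∀ {k} → ∣ S ∣ ≡ suc k → suc k ℕ.≤ r →
          E L⁺ (collides (U ∪ ⁅ x ⁆)) ≤ E L (collides U) + (ι h * η + ι h * η)
        collision-step {T} {U} x∉U markov x∈T Nx≡S ∣S∣≡ k<r = begin
          E L (K S x (collides (U ∪ ⁅ x ⁆)))
            ≤⟨ E-mono L (λ φ Xφ → begin
              K S x (collides (U ∪ ⁅ x ⁆)) φ
                ≤⟨ K-mono {S = S} {x} {collides (U ∪ ⁅ x ⁆)} {g φ} {φ} (λ v _ →
                     subst (λ u → collides (U ∪ ⁅ x ⁆) (upd φ x v) ≤ collides U φ + sum (λ a → δ u (φ a)))
                       (sym (upd-≡ φ x v)) (collides-upd x∉U φ v)) ⟩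
              K S x (g φ) φ
                ≡⟨ K-+ S x (λ _ → collides U φ) (λ ψ → sum (λ a → δ (ψ x) (φ a))) φ ⟩
              K S x (λ _ → collides U φ) φ + K S x (λ ψ → sum (λ a → δ (ψ x) (φ a))) φ
                ≡⟨ cong₂ _+_ (K-const {S = S} {x} {λ _ → collides U φ} {φ} (W≢0 φ Xφ) λ _ → refl)
                             (cong (inv (W S φ) *_) (occupied φ)) ⟩
              collides U φ + hits S φ ∎) ⟩
          E L (λ φ → collides U φ + hits S φ) ≡⟨ E-+ L (collides U) (hits S) ⟩
          E L (collides U) + E L (hits S)
            ≤⟨ ℚ.+-monoʳ-≤ (E L (collides U)) (hits-bound {T} markov x∈T Nx≡S ∣S∣≡ k<r) ⟩
          E L (collides U) + (ι h * η + ι h * η) ∎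
          where
          open ℚ.≤-Reasoning
          -- The kernel averages functions of the updated map, so the fresh label is read as `ψ x`
          -- while the old labels stay frozen at φ.
          g : (Fin h → Fin n) → (Fin h → Fin n) → ℚ
          g φ ψ = collides U φ + sum (λ a → δ (ψ x) (φ a))
          occupied : ∀ φ → sum (λ v → ω S φ v * sum (λ a → δ (upd φ x v x) (φ a))) ≡ sum (λ a → ω S φ (φ a))
          occupied φ = trans
            (sum-cong-≗ λ v → trans (*-distribˡ-sum (ω S φ v) (λ a → δ (upd φ x v x) (φ a)))
               (sum-cong-≗ λ a → cong (λ u → ω S φ v * δ u (φ a)) (upd-≡ φ x v)))
            (trans (∑-comm (λ v a → ω S φ v * δ v (φ a))) (sum-cong-≗ λ a → sum-δ (ω S φ) (φ a)))

  -- Star flips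

  ∈-Nbh⇒∈V : ∀ {h} (T : SubGraph h) {a b} → b ∈ Nbh T a → a ∈ V T
  ∈-Nbh⇒∈V T b∈ = support T (N-sym (graph T) b∈)

  ⊑-refl : ∀ {h} {T : SubGraph h} → T ⊑ T
  ⊑-refl = id , λ a → id

  ⊑-trans : ∀ {h} {S T U : SubGraph h} → S ⊑ T → T ⊑ U → S ⊑ U
  ⊑-trans (V⊆ , N⊆) (V⊆′ , N⊆′) = V⊆′ ∘ V⊆ , λ a → N⊆′ a ∘ N⊆ a

  -- Replacing a vertex by means of a transposition

  module _ {h : ℕ} (c x : Fin h) where

    private
      τ : Fin h → Fin h
      τ = transpose c x

    transpose-i : τ c ≡ x
    transpose-i rewrite dec-true (c ≟ᶠ c) refl = refl

    transpose-j : τ x ≡ c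
    transpose-j with x ≟ᶠ c
    ... | yes x≡c = x≡c
    ... | no _ rewrite dec-true (x ≟ᶠ x) refl = refl

    transpose-other : ∀ {a} → a ≢ c → a ≢ x → τ a ≡ a
    transpose-other {a} a≢c a≢x rewrite dec-false (a ≟ᶠ c) a≢c | dec-false (a ≟ᶠ x) a≢x = refl

    transpose-involutive : ∀ a → τ (τ a) ≡ a
    transpose-involutive a = by-cases (a ≟ᶠ c) (a ≟ᶠ x)
      where
      by-cases : Dec (a ≡ c) → Dec (a ≡ x) → τ (τ a) ≡ a
      by-cases (yes refl) _        = trans (cong τ transpose-i) transpose-j
      by-cases (no _) (yes refl)   = trans (cong τ transpose-j) transpose-i
      by-cases (no a≢c) (no a≢x)   = trans (cong τ (transpose-other a≢c a≢x)) (transpose-other a≢c a≢x)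

    module _ {T : SubGraph h} (c∈T : c ∈ V T) (x∉T : x ∉ V T) where

      -- There is no case `a ≡ c`: the transposition sends c to x, which lies outside T.
      data ReplacedVertex (a : Fin h) : Set where
        new : a ≡ x → τ a ≡ c → ReplacedVertex a
        old : a ≢ x → τ a ≡ a → a ∈ V T → ReplacedVertex a

      replacedVertex : ∀ {a} → τ a ∈ V T → ReplacedVertex a
      replacedVertex {a} τa∈ = by-cases (a ≟ᶠ x) (a ≟ᶠ c)
        where
        by-cases : Dec (a ≡ x) → Dec (a ≡ c) → ReplacedVertex a
        by-cases (yes refl) _      = new refl transpose-j
        by-cases (no _) (yes refl) = contradiction (subst (_∈ V T) transpose-i τa∈) x∉T
        by-cases (no a≢x) (no a≢c) = old a≢x (transpose-other a≢c a≢x) (subst (_∈ V T) (transpose-other a≢c a≢x) τa∈)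

    replace-⊑ : ∀ {T Q} → Q ⊑ replace T c x → replace Q c x ⊑ T
    replace-⊑ {T} (V⊆ , N⊆) =
        (λ {a} a∈ → subst (_∈ V T) (transpose-involutive a) (pull⁻ τ (V⊆ (pull⁻ τ a∈))))
      , (λ a {b} b∈ → subst₂ (λ a b → b ∈ Nbh T a) (transpose-involutive a) (transpose-involutive b)
          (pull⁻ τ (N⊆ (τ a) (pull⁻ τ b∈))))

    replace-connected : ∀ {Q} → Connected Q → Connected (replace Q c x)
    replace-connected {Q} ((a , a∈) , walk) =
        (τ a , pull⁺ τ (subst (_∈ V Q) (sym (transpose-involutive a)) a∈))
      , λ u v u∈ v∈ → subst₂ (Star (λ a b → b ∈ Nbh (replace Q c x) a)) (transpose-involutive u) (transpose-involutive v)
          (gmap τ (λ {a} {b} b∈ → pull⁺ τ (subst₂ (λ a b → b ∈ Nbh Q a) (sym (transpose-involutive a)) (sym (transpose-involutive b)) b∈))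
            (walk (τ u) (τ v) (pull⁻ τ u∈) (pull⁻ τ v∈)))

  -- Random homomorphisms and their change under a star flip

  module Realisations {n : ℕ} (G : Graph n) {h : ℕ} where

    open Kernel G
    open Laws G {h}

    -- On a single vertex adjacency imposes nothing; the condition on `D` is what allows the walk to
    -- leave its label.
    Hom : SubGraph h → (Fin h → Fin n) → Set
    Hom H φ = (∀ {a} → a ∈ V H → D (φ a) ≢ 0ℚ) × (∀ {a b} → b ∈ Nbh H a → φ b ∈ N G (φ a))

    Hom-⊑ : ∀ {H H′} → H′ ⊑ H → ∀ φ → Hom H φ → Hom H′ φ
    Hom-⊑ (V⊆ , N⊆) φ (D≢0 , adj) = D≢0 ∘ V⊆ , λ {a} → adj ∘ N⊆ a

    -- The present label of c is itself a common neighbour of the labels on S.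
    Hom⇒W≢0 : ∀ {H c} → c ∈ V H → ∀ {S} → S ⊆ Nbh H c → ∀ φ → Hom H φ → W S φ ≢ 0ℚ
    Hom⇒W≢0 {c = c} c∈H {S} S⊆N φ (D≢0 , adj) = W-≢0 {S = S} {φ} {φ c} (D≢0 c∈H) λ a a∈S → adj (S⊆N a∈S)

    module _ {H H⁺ : SubGraph h} {x : Fin h} {S : Subset h} (adjoins : Adjoins H x S H⁺) (S⊆V : S ⊆ V H) where

      open Adjoins adjoins

      Hom-adjoin : ∀ φ v → Hom H φ → ω S φ v ≢ 0ℚ → Hom H⁺ (upd φ x v)
      Hom-adjoin φ v (D≢0 , adj) ω≢0 = D≢0⁺ , λ {a} {b} b∈ → adj⁺ (Equivalence.to (adjacent a b) b∈)
        where
        upd-old : ∀ {a} → a ∈ V H → upd φ x v a ≡ φ a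
        upd-old a∈H = upd-≢ φ v (∉⇒≢ a∈H fresh)
        D≢0⁺ : ∀ {a} → a ∈ V H⁺ → D (upd φ x v a) ≢ 0ℚ
        D≢0⁺ {a} a∈ with x∈p∪q⁻ (V H) ⁅ x ⁆ (subst (a ∈_) vertices a∈)
        ... | inj₁ a∈H = subst (λ u → D u ≢ 0ℚ) (sym (upd-old a∈H)) (D≢0 a∈H)
        ... | inj₂ a∈x with x∈⁅y⁆⇒x≡y x a∈x
        ...   | refl = subst (λ u → D u ≢ 0ℚ) (sym (upd-≡ φ x v)) (ω≢0⇒D≢0 {S = S} {φ} ω≢0)
        adj⁺ : ∀ {a b} → b ∈ Nbh H a ⊎ (a ≡ x × b ∈ S) ⊎ (b ≡ x × a ∈ S) → upd φ x v b ∈ N G (upd φ x v a)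
        adj⁺ {a} {b} (inj₁ b∈) = subst₂ (λ u w → w ∈ N G u) (sym (upd-old (∈-Nbh⇒∈V H b∈))) (sym (upd-old (support H b∈))) (adj b∈)
        adj⁺ {a} {b} (inj₂ (inj₁ (refl , b∈S))) = subst₂ (λ u w → w ∈ N G u) (sym (upd-≡ φ x v)) (sym (upd-old (S⊆V b∈S)))
          (ω≢0⇒adjacent {S = S} {φ} ω≢0 b∈S)
        adj⁺ {a} {b} (inj₂ (inj₂ (refl , a∈S))) = subst₂ (λ u w → w ∈ N G u) (sym (upd-old (S⊆V a∈S))) (sym (upd-≡ φ x v))
          (N-sym G (ω≢0⇒adjacent {S = S} {φ} ω≢0 a∈S))

    Markov-subtree : ∀ {X Q T} {L : Law X} → Markov L T → Q ⊑ T → Markov L Q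
    Markov-subtree {Q = Q} {T} markov Q⊑T Q′ (conn , Q′⊑Q) = markov Q′ (conn , ⊑-trans {_} {Q′} {Q} {T} Q′⊑Q Q⊑T)

    K-depends-V : ∀ (Q : SubGraph h) {c f} → DependsOn (_∈ V Q) f → DependsOn (_∈ V Q) (K (Nbh Q c) c f)
    K-depends-V Q {c} f-dep = K-depends {S = Nbh Q c} f-dep (λ a → support Q) (λ a a∈ _ → a∈)

    module _ {X Y : (Fin h → Fin n) → Set} (L : Law X) {S : Subset h} {x : Fin h}
      (W≢0 : ∀ φ → X φ → W S φ ≢ 0ℚ) (X⇒Y : ∀ φ v → X φ → ω S φ v ≢ 0ℚ → Y (upd φ x v)) where

      private
        L⁺ : Law Y
        L⁺ = resample L S x W≢0 X⇒Y

      E-independent : ∀ {Z f} → DependsOn Z f → ¬ Z x → E L⁺ f ≡ E L f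
      E-independent {f = f} f-dep ¬Zx = E-cong L λ φ Xφ → K-independent {S = S} {x} {f} {φ} f-dep ¬Zx (W≢0 φ Xφ)

      Gibbs-old : ∀ {Q c} → x ∉ V Q → Gibbs L Q c → Gibbs L⁺ Q c
      Gibbs-old {Q} {c} x∉Q gibbs f f-dep = begin
        E L⁺ f                     ≡⟨ E-independent f-dep x∉Q ⟩
        E L f                      ≡⟨ gibbs f f-dep ⟩
        E L (K (Nbh Q c) c f)      ≡⟨ sym (E-independent (K-depends-V Q f-dep) x∉Q) ⟩
        E L⁺ (K (Nbh Q c) c f)     ∎
        where open ≡-Reasoning

      Markov-old : ∀ {T} → x ∉ V T → Markov L T → Markov L⁺ T
      Markov-old x∉T markov Q (conn , Q⊑T) c∈ = Gibbs-old {Q} (x∉T ∘ proj₁ Q⊑T) (markov Q (conn , Q⊑T) c∈)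

      module _ {T : SubGraph h} (connected : Connected T) {c : Fin h} (c∈T : c ∈ V T) (x∉T : x ∉ V T)
        (S≡ : Nbh T c ≡ S) (markov : Markov L T) where

        private
          τ : Fin h → Fin h
          τ = transpose c x

          ττ : ∀ a → τ (τ a) ≡ a
          ττ = transpose-involutive c x

        -- By the Gibbs identity of T at c, the label of c may be taken as drawn afresh given S,
        -- which is precisely how x was drawn. A function on the replaced tree reads x but not c, so
        -- it cannot tell the two draws apart.
        E-replace : ∀ {f} → DependsOn (_∈ V (replace T c x)) f → E L⁺ f ≡ E L (λ φ → f (φ ∘ τ))
        E-replace {f} f-dep = begin
          E L (K S x f)                        ≡⟨ E-cong L (λ φ _ → cong (inv (W S φ) *_) (sum-cong-≗ λ v →
                                                    cong (ω S φ v *_) (f-dep _ _ λ a a∈ → agree φ v a (replacedVertex c x {T} c∈T x∉T (pull⁻ τ a∈))))) ⟩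
          E L (K S c (λ φ → f (φ ∘ τ)))         ≡⟨ cong (λ S → E L (K S c (λ φ → f (φ ∘ τ)))) (sym S≡) ⟩
          E L (K (Nbh T c) c (λ φ → f (φ ∘ τ))) ≡⟨ sym (markov T (connected , ⊑-refl {T = T}) c∈T (λ φ → f (φ ∘ τ))
                                                    λ φ ψ φ≡ψ → f-dep _ _ λ a a∈ → φ≡ψ (τ a) (pull⁻ τ a∈)) ⟩
          E L (λ φ → f (φ ∘ τ))                 ∎
          where
          open ≡-Reasoning
          agree : ∀ φ v a → ReplacedVertex c x {T} c∈T x∉T a → upd φ x v a ≡ upd φ c v (τ a)
          agree φ v a (new refl τa≡c) = trans (upd-≡ φ x v) (sym (trans (cong (upd φ c v) τa≡c) (upd-≡ φ c v)))
          agree φ v a (old a≢x τa≡a a∈T) = trans (upd-≢ φ v a≢x)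
            (sym (trans (cong (upd φ c v) τa≡a) (upd-≢ φ v λ { refl → a≢x (trans (sym τa≡a) (transpose-i c x)) })))

        -- A relabelling merely permutes the factors of the weights.
        K-transpose : ∀ {f} → Extensional f → ∀ R y φ →
                      K R y f (φ ∘ τ) ≡ K (pull τ R) (τ y) (λ ψ → f (ψ ∘ τ)) φ
        K-transpose {f} f-ext R y φ = cong₂ _*_ (cong inv (sum-cong-≗ ω-transpose))
          (sum-cong-≗ λ v → cong₂ _*_ (ω-transpose v) (f-ext _ _ (upd-transpose v)))
          where
          factor : Fin n → Fin h → ℚ
          factor v a = if lookup (pull τ R) a then P v (φ a) else 1ℚ
          ω-transpose : ∀ v → ω R (φ ∘ τ) v ≡ ω (pull τ R) φ v
          ω-transpose v = cong (D v *_) (sym (trans (product-permute (factor v) (transposition c x))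
            (product-cong λ a → cong (if_then P v (φ (τ a)) else 1ℚ)
              (trans (lookup∘tabulate (lookup R ∘ τ) (τ a)) (cong (lookup R) (ττ a))))))
          upd-transpose : ∀ v a → upd (φ ∘ τ) y v a ≡ upd φ (τ y) v (τ a)
          upd-transpose v a with a ≟ᶠ y
          ... | yes refl = sym (upd-≡ φ (τ a) v)
          ... | no a≢y   = sym (upd-≢ φ v λ τa≡τy → a≢y (trans (sym (ττ a)) (trans (cong τ τa≡τy) (ττ y))))

        -- The law on the replaced tree is that on T with c renamed to x, so the identity for Q is
        -- the one for the subtree of T obtained by exchanging c and x in Q.
        Markov-replace : Markov L⁺ (replace T c x)
        Markov-replace Q (Q-connected , Q⊑) {d} d∈Q f f-dep = begin
          E L⁺ f
            ≡⟨ E-replace (λ φ ψ φ≡ψ → f-dep φ ψ λ a a∈ → φ≡ψ a (proj₁ Q⊑ a∈)) ⟩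
          E L f∘τ
            ≡⟨ markov Q̃ (replace-connected c x {Q} Q-connected , replace-⊑ c x {T} {Q} Q⊑)
                 (pull⁺ τ (subst (_∈ V Q) (sym (ττ d)) d∈Q)) f∘τ
                 (λ φ ψ φ≡ψ → f-dep _ _ λ a a∈ → φ≡ψ (τ a) (pull⁺ τ (subst (_∈ V Q) (sym (ττ a)) a∈))) ⟩
          E L (K (Nbh Q̃ (τ d)) (τ d) f∘τ)
            ≡⟨ cong (λ e → E L (K (pull τ (Nbh Q e)) (τ d) f∘τ)) (ττ d) ⟩
          E L (K (pull τ (Nbh Q d)) (τ d) f∘τ)
            ≡⟨ E-cong L (λ φ _ → sym (K-transpose (DependsOn⇒Extensional f-dep) (Nbh Q d) d φ)) ⟩
          E L (λ φ → K (Nbh Q d) d f (φ ∘ τ))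
            ≡⟨ sym (E-replace (λ φ ψ φ≡ψ → K-depends-V Q f-dep φ ψ λ a a∈ → φ≡ψ a (proj₁ Q⊑ a∈))) ⟩
          E L⁺ (K (Nbh Q d) d f) ∎
          where
          open ≡-Reasoning
          Q̃ = replace Q c x
          f∘τ : (Fin h → Fin n) → ℚ
          f∘τ φ = f (φ ∘ τ)

    -- The invariant carried along a presentation. Connectedness of T is recorded because `Markov`
    -- speaks of connected subgraphs, and the flip applies it to T itself.
    record Realisation (H : SubGraph h) (𝒯 : Family h) (bound : ℚ) : Set where
      field
        law       : Law (Hom H)
        markov    : ∀ {T} → 𝒯 T → Markov law T
        live-⊑    : ∀ {T} → 𝒯 T → T ⊑ H
        live-conn : ∀ {T} → 𝒯 T → Connected T
        collision : E law (collides (V H)) ≤ bound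

    open Realisation public

    replace-⊑-adjoin : ∀ {H H⁺ T : SubGraph h} {x S c} → Adjoins H x S H⁺ → T ⊑ H → c ∈ V T → Nbh T c ≡ S → replace T c x ⊑ H⁺
    replace-⊑-adjoin {H} {H⁺} {T} {x} {S} {c} adjoins (V⊆ , N⊆) c∈T S≡ =
        (λ {a} a∈ → V⊆⁺ (view (pull⁻ τ a∈)))
      , (λ a {b} b∈ → let τb∈ = pull⁻ τ b∈ in
          N⊆⁺ τb∈ (view (∈-Nbh⇒∈V T τb∈)) (view (support T τb∈)))
      where
      open Adjoins adjoins
      τ = transpose c x
      x∉T : x ∉ V T
      x∉T = fresh ∘ V⊆
      View = ReplacedVertex c x {T} c∈T x∉T
      view : ∀ {a} → τ a ∈ V T → View a
      view = replacedVertex c x {T} c∈T x∉T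
      V⊆⁺ : ∀ {a} → View a → a ∈ V H⁺
      V⊆⁺ (new refl _)    = subst (x ∈_) (sym vertices) (x∈p∪q⁺ (inj₂ (x∈⁅x⁆ x)))
      V⊆⁺ {a} (old _ _ a∈T) = subst (a ∈_) (sym vertices) (x∈p∪q⁺ (inj₁ (V⊆ a∈T)))
      N⊆⁺ : ∀ {a b} → τ b ∈ Nbh T (τ a) → View a → View b → b ∈ Nbh H⁺ a
      N⊆⁺ {a} {b} τb∈ (new a≡x τa≡c) (new b≡x τb≡c) =
        contradiction (subst₂ (λ a b → b ∈ Nbh T a) τa≡c τb≡c τb∈) (irrefl (graph T))
      N⊆⁺ {a} {b} τb∈ (new a≡x τa≡c) (old _ τb≡b _) = Equivalence.from (adjacent a b)
        (inj₂ (inj₁ (a≡x , subst (b ∈_) S≡ (subst₂ (λ a b → b ∈ Nbh T a) τa≡c τb≡b τb∈))))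
      N⊆⁺ {a} {b} τb∈ (old _ τa≡a _) (new b≡x τb≡c) = Equivalence.from (adjacent a b)
        (inj₂ (inj₂ (b≡x , subst (a ∈_) S≡ (N-sym (graph T) (subst₂ (λ a b → b ∈ Nbh T a) τa≡a τb≡c τb∈)))))
      N⊆⁺ {a} {b} τb∈ (old _ τa≡a _) (old _ τb≡b _) = Equivalence.from (adjacent a b)
        (inj₁ (N⊆ a (subst₂ (λ a b → b ∈ Nbh T a) τa≡a τb≡b τb∈)))

    module Flip {r : ℕ} (scale : Scale r) where

      open Scale scale
      open Collisions scale

      flip-realisation : ∀ {H 𝒯 bound} → Realisation H 𝒯 bound →
        ∀ {T} → 𝒯 T → ∀ {c} → c ∈ V T → 1 ℕ.≤ deg T c → deg T c ℕ.≤ r →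
        ∀ {x H⁺} → Adjoins H x (Nbh T c) H⁺ →
        Realisation H⁺ (flipFamily 𝒯 T c x) (bound + (ι h * η + ι h * η))
      flip-realisation {H} {𝒯} {bound} R {T} T-live {c} c∈T 1≤deg deg≤r {x} {H⁺} adjoins = record
        { law       = L⁺
        ; markov    = markov⁺
        ; live-⊑    = λ { {Q} (inj₁ Q-live) → ⊑-trans {S = Q} {H} {H⁺} (live-⊑ R Q-live) H⊑H⁺
                        ; {Q} (inj₂ (T′ , (T′-live , c∈T′ , eq) , (_ , Q⊑))) →
                            ⊑-trans {S = Q} {replace T′ c x} {H⁺} Q⊑ (replace-⊑-adjoin {H} {H⁺} {T′} adjoins (live-⊑ R T′-live) c∈T′ eq) }
        ; live-conn = λ { (inj₁ Q-live) → live-conn R Q-live ; (inj₂ (_ , _ , (conn , _))) → conn }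
        ; collision = collision⁺ (deg T c) refl 1≤deg deg≤r
        }
        where
        open Adjoins adjoins
        L = law R
        T⊑H = live-⊑ R T-live
        W≢0 : ∀ φ → Hom H φ → W (Nbh T c) φ ≢ 0ℚ
        W≢0 = Hom⇒W≢0 {H} (proj₁ T⊑H c∈T) {Nbh T c} (proj₂ T⊑H c)
        S⊆V : Nbh T c ⊆ V H
        S⊆V a∈ = proj₁ T⊑H (support T a∈)
        hom⁺ : ∀ φ v → Hom H φ → ω (Nbh T c) φ v ≢ 0ℚ → Hom H⁺ (upd φ x v)
        hom⁺ = Hom-adjoin {H} {H⁺} {x} {Nbh T c} adjoins S⊆V
        L⁺ : Law (Hom H⁺)
        L⁺ = resample L (Nbh T c) x W≢0 hom⁺
        H⊑H⁺ : H ⊑ H⁺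
        H⊑H⁺ = (λ {a} a∈ → subst (a ∈_) (sym vertices) (x∈p∪q⁺ (inj₁ a∈)))
             , (λ a {b} b∈ → Equivalence.from (adjacent a b) (inj₁ b∈))
        x∉live : ∀ {Q} → 𝒯 Q → x ∉ V Q
        x∉live Q-live x∈ = fresh (proj₁ (live-⊑ R Q-live) x∈)
        Markov-flipped : ∀ {T′} → Flippable 𝒯 T c T′ → Markov L⁺ (replace T′ c x)
        Markov-flipped {T′} (T′-live , c∈T′ , eq) = Markov-replace {Hom H} {Hom H⁺} L {Nbh T c} {x} W≢0 hom⁺
          {T′} (live-conn R T′-live) c∈T′ (x∉live T′-live) eq (markov R T′-live)
        markov⁺ : ∀ {Q} → flipFamily 𝒯 T c x Q → Markov L⁺ Q
        markov⁺ {Q} (inj₁ Q-live) = Markov-old {Hom H} {Hom H⁺} L {Nbh T c} {x} W≢0 hom⁺ {Q} (x∉live Q-live) (markov R Q-live)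
        markov⁺ {Q} (inj₂ (T′ , flippable , (_ , Q⊑))) =
          Markov-subtree {Q = Q} {T = replace T′ c x} {L = L⁺} (Markov-flipped {T′} flippable) Q⊑
        τ = transpose c x
        -- The collision bound needs a tree with the Markov property in which x has the neighbour
        -- set of the flip; T itself does not contain x.
        T-new = replace T c x
        x∈T-new : x ∈ V T-new
        x∈T-new = pull⁺ τ (subst (_∈ V T) (sym (transpose-j c x)) c∈T)
        x∉T = x∉live T-live
        Nbh-x : Nbh T-new x ≡ Nbh T c
        Nbh-x = ⊆-antisym
          (λ {a} a∈ → let τa∈ = subst (λ y → τ a ∈ Nbh T y) (transpose-j c x) (pull⁻ τ a∈) in
            fwd τa∈ (replacedVertex c x {T} c∈T x∉T (support T τa∈)))
          (λ {a} a∈ → pull⁺ τ (subst₂ (λ y z → z ∈ Nbh T y) (sym (transpose-j c x))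
            (sym (transpose-other c x (λ { refl → irrefl (graph T) a∈ }) λ { refl → x∉T (support T a∈) })) a∈))
          where
          fwd : ∀ {a} → τ a ∈ Nbh T c → ReplacedVertex c x {T} c∈T x∉T a → a ∈ Nbh T c
          fwd τa∈ (new _ τa≡c)   = contradiction (subst (_∈ Nbh T c) τa≡c τa∈) (irrefl (graph T))
          fwd τa∈ (old _ τa≡a _) = subst (_∈ Nbh T c) τa≡a τa∈
        collision⁺ : ∀ k → deg T c ≡ k → 1 ℕ.≤ k → k ℕ.≤ r → E L⁺ (collides (V H⁺)) ≤ bound + (ι h * η + ι h * η)
        collision⁺ (suc k) deg≡ _ k<r = begin
          E L⁺ (collides (V H⁺))           ≡⟨ cong (λ U → E L⁺ (collides U)) vertices ⟩
          E L⁺ (collides (V H ∪ ⁅ x ⁆))    ≤⟨ collision-step {Hom H} {Hom H⁺} L {Nbh T c} {x} W≢0 hom⁺ {T-new} {V H} fresh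
                                                (Markov-flipped {T} (T-live , c∈T , refl)) x∈T-new Nbh-x deg≡ k<r ⟩
          E L (collides (V H)) + (ι h * η + ι h * η) ≤⟨ ℚ.+-monoˡ-≤ (ι h * η + ι h * η) (collision R) ⟩
          bound + (ι h * η + ι h * η)      ∎
          where open ℚ.≤-Reasoning

  -- Seed trees

  module _ {h : ℕ} (T : SubGraph h) (U : Subset h) where

    private
      Edge : Fin h → Fin h → Set
      Edge a b = b ∈ Nbh T a × a ∈ U × b ∈ U

      edge? : ∀ a b → Dec (Edge a b)
      edge? a b = (b ∈? Nbh T a) ×-dec ((a ∈? U) ×-dec (b ∈? U))

    restrict : SubGraph h
    restrict .V       = U
    restrict .graph   = fromRelation Edge edge? (λ (b∈ , a∈U , b∈U) → N-sym (graph T) b∈ , b∈U , a∈U)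
      λ (a∈ , _) → irrefl (graph T) a∈
    restrict .support {a} b∈ = proj₂ (proj₂ (∈-tabulate⁻ (edge? a) b∈))

    restrict⁺ : ∀ {a b} → b ∈ Nbh T a → a ∈ U → b ∈ U → b ∈ Nbh restrict a
    restrict⁺ {a} b∈ a∈U b∈U = ∈-tabulate⁺ (edge? a) (b∈ , a∈U , b∈U)

    restrict⁻ : ∀ {a b} → b ∈ Nbh restrict a → b ∈ Nbh T a × a ∈ U × b ∈ U
    restrict⁻ {a} = ∈-tabulate⁻ (edge? a)

  -- Attaching a leaf to a tree

  module Leaf {n : ℕ} (G : Graph n) {h : ℕ} where

    open Kernel G
    open Laws G {h}
    open Realisations G {h}

    module _ {H H⁺ : SubGraph h} {ℓ p : Fin h} (adjoins : Adjoins H ℓ ⁅ p ⁆ H⁺) (p∈H : p ∈ V H)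
      {X Y : (Fin h → Fin n) → Set} (L : Law X) (W≢0 : ∀ φ → X φ → W ⁅ p ⁆ φ ≢ 0ℚ)
      (X⇒Y : ∀ φ v → X φ → ω ⁅ p ⁆ φ v ≢ 0ℚ → Y (upd φ ℓ v)) (markov : Markov L H) where

      open Adjoins adjoins

      private
        L⁺ : Law Y
        L⁺ = resample L ⁅ p ⁆ ℓ W≢0 X⇒Y

        p≢ℓ : p ≢ ℓ
        p≢ℓ = ∉⇒≢ p∈H fresh

        Nbh-old : ∀ {Q} → Q ⊑ H⁺ → ∀ {a b} → a ≢ ℓ → b ≢ ℓ → b ∈ Nbh Q a → b ∈ Nbh H a
        Nbh-old (_ , N⊆) {a} {b} a≢ℓ b≢ℓ b∈ with Equivalence.to (adjacent a b) (N⊆ a b∈)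
        ... | inj₁ b∈H              = b∈H
        ... | inj₂ (inj₁ (a≡ℓ , _)) = contradiction a≡ℓ a≢ℓ
        ... | inj₂ (inj₂ (b≡ℓ , _)) = contradiction b≡ℓ b≢ℓ

        Nbh-ℓ : ∀ {Q} → Q ⊑ H⁺ → ∀ {b} → b ∈ Nbh Q ℓ → b ≡ p
        Nbh-ℓ (_ , N⊆) {b} b∈ with Equivalence.to (adjacent ℓ b) (N⊆ ℓ b∈)
        ... | inj₁ b∈H              = contradiction (∈-Nbh⇒∈V H b∈H) fresh
        ... | inj₂ (inj₁ (_ , b∈p)) = x∈⁅y⁆⇒x≡y p b∈p
        ... | inj₂ (inj₂ (_ , ℓ∈p)) = contradiction (sym (x∈⁅y⁆⇒x≡y p ℓ∈p)) p≢ℓ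

        V-old : ∀ {Q} → Q ⊑ H⁺ → ∀ {a} → a ≢ ℓ → a ∈ V Q → a ∈ V H
        V-old (V⊆ , _) {a} a≢ℓ a∈ with x∈p∪q⁻ (V H) ⁅ ℓ ⁆ (subst (a ∈_) vertices (V⊆ a∈))
        ... | inj₁ a∈H = a∈H
        ... | inj₂ a∈ℓ = contradiction (x∈⁅y⁆⇒x≡y ℓ a∈ℓ) a≢ℓ

      module _ (Q : SubGraph h) (connected : Connected Q) (Q⊑ : Q ⊑ H⁺) (ℓ∈Q : ℓ ∈ V Q) where

        module _ (p∉Q : p ∉ V Q) where

          private
            Nbh-ℓ≡⊥ : Nbh Q ℓ ≡ ⊥
            Nbh-ℓ≡⊥ = Empty-unique λ (b , b∈) → p∉Q (subst (_∈ V Q) (Nbh-ℓ {Q} Q⊑ b∈) (support Q b∈))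

            only-ℓ : ∀ {a} → a ∈ V Q → a ≡ ℓ
            only-ℓ {a} a∈ with proj₂ connected ℓ a ℓ∈Q a∈
            ... | ε = refl
            ... | b∈ ◅ _ = contradiction (subst (_ ∈_) Nbh-ℓ≡⊥ b∈) ∉⊥

          -- Here Q is ℓ alone, so its label must be stationary. That of p is, by the Markov
          -- property for the one-vertex subtree at p, and the step from p to ℓ preserves
          -- stationarity.
          Gibbs-isolated : Gibbs L⁺ Q ℓ
          Gibbs-isolated f f-dep = begin
            E L (K ⁅ p ⁆ ℓ f)
              ≡⟨ markov Q₀ (star-subtree H p∈H ⊥⊆N) (∈-star⁺ H p∈H ⊥⊆N (inj₁ refl)) (K ⁅ p ⁆ ℓ f)
                   (λ φ ψ φ≡ψ → K-depends {S = ⁅ p ⁆} {Y = _≡ p} f-dep-ℓ (λ a → x∈⁅y⁆⇒x≡y p)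
                     (λ { a refl ℓ≢ℓ → contradiction refl ℓ≢ℓ }) φ ψ
                     λ a a≡p → φ≡ψ a (∈-star⁺ H p∈H ⊥⊆N (inj₁ a≡p))) ⟩
            E L (K (Nbh Q₀ p) p (K ⁅ p ⁆ ℓ f))
              ≡⟨ cong (λ S → E L (K S p (K ⁅ p ⁆ ℓ f))) (Nbh-center H p∈H ⊥⊆N) ⟩
            E L (K ⊥ p (K ⁅ p ⁆ ℓ f))
              ≡⟨ E-cong L (λ φ _ → K-stationary p≢ℓ f-dep-ℓ φ) ⟩
            E L (K ⊥ ℓ f)
              ≡⟨ sym (E-independent {X} {Y} L {⁅ p ⁆} {ℓ} W≢0 X⇒Y {λ a → a ∈ ⊥} (K-depends {S = ⊥} f-dep-ℓ (λ a → id)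
                   λ { a refl ℓ≢ℓ → contradiction refl ℓ≢ℓ }) ∉⊥) ⟩
            E L⁺ (K ⊥ ℓ f)
              ≡⟨ cong (λ S → E L⁺ (K S ℓ f)) (sym Nbh-ℓ≡⊥) ⟩
            E L⁺ (K (Nbh Q ℓ) ℓ f) ∎
            where
            open ≡-Reasoning
            ⊥⊆N : ⊥ ⊆ Nbh H p
            ⊥⊆N a∈ = contradiction a∈ ∉⊥
            Q₀ = star H p∈H ⊥⊆N
            f-dep-ℓ : DependsOn (_≡ ℓ) f
            f-dep-ℓ φ ψ φ≡ψ = f-dep φ ψ λ a a∈ → φ≡ψ a (only-ℓ a∈)

          isolated-Gibbs : ∀ {c} → c ∈ V Q → Gibbs L⁺ Q c
          isolated-Gibbs c∈ = subst (Gibbs L⁺ Q) (sym (only-ℓ c∈)) Gibbs-isolated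

        module _ (p∈Q : p ∈ V Q) where

          private
            U : Subset h
            U = V Q ∩ ∁ ⁅ ℓ ⁆

            Q⁻ : SubGraph h
            Q⁻ = restrict Q U

            U⁺ : ∀ {a} → a ∈ V Q → a ≢ ℓ → a ∈ U
            U⁺ a∈ a≢ℓ = x∈p∩q⁺ (a∈ , x∉p⇒x∈∁p (x≢y⇒x∉⁅y⁆ a≢ℓ))

            U⁻ : ∀ {a} → a ∈ U → a ∈ V Q × a ≢ ℓ
            U⁻ a∈ with x∈p∩q⁻ (V Q) (∁ ⁅ ℓ ⁆) a∈
            ... | a∈Q , a∈∁ = a∈Q , x∉⁅y⁆⇒x≢y (x∈∁p⇒x∉p a∈∁)

            ℓ∉U : ℓ ∉ U
            ℓ∉U ℓ∈ = proj₂ (U⁻ ℓ∈) refl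

            p∈ℓ : p ∈ Nbh Q ℓ
            p∈ℓ with proj₂ connected ℓ p ℓ∈Q p∈Q
            ... | ε = contradiction refl p≢ℓ
            ... | b∈ ◅ _ = subst (_∈ Nbh Q ℓ) (Nbh-ℓ {Q} Q⊑ b∈) b∈

            Nbh-ℓ≡ : Nbh Q ℓ ≡ ⁅ p ⁆
            Nbh-ℓ≡ = ⊆-antisym
              (λ {b} b∈ → subst (_∈ ⁅ p ⁆) (sym (Nbh-ℓ {Q} Q⊑ b∈)) (x∈⁅x⁆ p))
              (λ {b} b∈ → subst (_∈ Nbh Q ℓ) (sym (x∈⁅y⁆⇒x≡y p b∈)) p∈ℓ)

            -- A walk enters and leaves the leaf ℓ through p, so it can be cut short.
            avoid : ∀ {u v} → v ≢ ℓ → Star (λ a b → b ∈ Nbh Q a) u v →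
                    (u ≢ ℓ → Star (λ a b → b ∈ Nbh Q⁻ a) u v) × (u ≡ ℓ → Star (λ a b → b ∈ Nbh Q⁻ a) p v)
            avoid v≢ℓ ε = (λ _ → ε) , (λ u≡ℓ → contradiction u≡ℓ v≢ℓ)
            avoid {u} v≢ℓ (_◅_ {j = w} w∈ walk) = from-other , from-ℓ
              where
              from-ℓ : u ≡ ℓ → _
              from-ℓ refl with Nbh-ℓ {Q} Q⊑ w∈
              ... | refl = proj₁ (avoid v≢ℓ walk) p≢ℓ
              from-other : u ≢ ℓ → _
              from-other u≢ℓ with w ≟ᶠ ℓ
              ... | no w≢ℓ = restrict⁺ Q U w∈ (U⁺ (∈-Nbh⇒∈V Q w∈) u≢ℓ) (U⁺ (support Q w∈) w≢ℓ) ◅ proj₁ (avoid v≢ℓ walk) w≢ℓ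
              ... | yes refl with Nbh-ℓ {Q} Q⊑ (N-sym (graph Q) w∈)
              ...   | refl = proj₂ (avoid v≢ℓ walk) refl

            Q⁻-subtree : Q⁻ IsSubtreeOf H
            Q⁻-subtree = ((p , U⁺ p∈Q p≢ℓ) , λ u v u∈ v∈ →
                proj₁ (avoid (proj₂ (U⁻ v∈)) (proj₂ connected u v (proj₁ (U⁻ u∈)) (proj₁ (U⁻ v∈)))) (proj₂ (U⁻ u∈)))
              , (λ a∈ → V-old {Q} Q⊑ (proj₂ (U⁻ a∈)) (proj₁ (U⁻ a∈)))
              , (λ a b∈ → let (b∈Q , a∈U , b∈U) = restrict⁻ Q U b∈ in
                  Nbh-old {Q} Q⊑ (proj₂ (U⁻ a∈U)) (proj₂ (U⁻ b∈U)) b∈Q)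

            K-dep : ∀ {f} → DependsOn (_∈ V Q) f → DependsOn (_∈ U) (K ⁅ p ⁆ ℓ f)
            K-dep f-dep = K-depends {S = ⁅ p ⁆} f-dep
              (λ a a∈p → subst (_∈ U) (sym (x∈⁅y⁆⇒x≡y p a∈p)) (U⁺ p∈Q p≢ℓ)) (λ a → U⁺)

            Nbh-Q⁻ : ∀ {a b} → a ∈ V Q → a ≢ ℓ → b ≢ ℓ → b ∈ Nbh Q a → b ∈ Nbh Q⁻ a
            Nbh-Q⁻ a∈ a≢ℓ b≢ℓ b∈ = restrict⁺ Q U b∈ (U⁺ a∈ a≢ℓ) (U⁺ (support Q b∈) b≢ℓ)

          Gibbs-ℓ : Gibbs L⁺ Q ℓ
          Gibbs-ℓ f f-dep = begin
            E L (K ⁅ p ⁆ ℓ f)               ≡⟨ sym (E-independent {X} {Y} L {⁅ p ⁆} {ℓ} W≢0 X⇒Y {_∈ U} (K-dep f-dep) ℓ∉U) ⟩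
            E L⁺ (K ⁅ p ⁆ ℓ f)              ≡⟨ cong (λ S → E L⁺ (K S ℓ f)) (sym Nbh-ℓ≡) ⟩
            E L⁺ (K (Nbh Q ℓ) ℓ f)          ∎
            where open ≡-Reasoning

          -- After averaging over ℓ, f becomes a function on Q without its leaf, where p may be
          -- redrawn given its other neighbours; `K-absorb` then upgrades this to a redraw given ℓ
          -- as well.
          Gibbs-p : Gibbs L⁺ Q p
          Gibbs-p f f-dep = begin
            E L (K ⁅ p ⁆ ℓ f)
              ≡⟨ gibbs (K ⁅ p ⁆ ℓ f) (K-dep f-dep) ⟩
            E L (K S p (K ⁅ p ⁆ ℓ f))
              ≡⟨ E-cong L (λ φ _ → sym (K-absorb {S = S} {p} {ℓ} (irrefl (graph Q⁻)) (ℓ∉U ∘ support Q⁻) p≢ℓ (DependsOn⇒Extensional f-dep) φ)) ⟩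
            E L (K S p (K ⁅ p ⁆ ℓ (K (S ∪ ⁅ ℓ ⁆) p f)))
              ≡⟨ cong (λ S⁺ → E L (K S p (K ⁅ p ⁆ ℓ (K S⁺ p f)))) (sym Nbh-p≡) ⟩
            E L (K S p (K ⁅ p ⁆ ℓ (K (Nbh Q p) p f)))
              ≡⟨ sym (gibbs (K ⁅ p ⁆ ℓ (K (Nbh Q p) p f)) (K-dep (K-depends-V Q f-dep))) ⟩
            E L (K ⁅ p ⁆ ℓ (K (Nbh Q p) p f)) ∎
            where
            open ≡-Reasoning
            gibbs = markov Q⁻ Q⁻-subtree {p} (U⁺ p∈Q p≢ℓ)
            S = Nbh Q⁻ p
            Nbh-p≡ : Nbh Q p ≡ S ∪ ⁅ ℓ ⁆
            Nbh-p≡ = ⊆-antisym fwd bwd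
              where
              fwd : Nbh Q p ⊆ S ∪ ⁅ ℓ ⁆
              fwd {b} b∈ with b ≟ᶠ ℓ
              ... | yes refl = x∈p∪q⁺ (inj₂ (x∈⁅x⁆ ℓ))
              ... | no b≢ℓ   = x∈p∪q⁺ (inj₁ (Nbh-Q⁻ p∈Q p≢ℓ b≢ℓ b∈))
              bwd : S ∪ ⁅ ℓ ⁆ ⊆ Nbh Q p
              bwd {b} b∈ with x∈p∪q⁻ S ⁅ ℓ ⁆ b∈
              ... | inj₁ b∈S = proj₁ (restrict⁻ Q U b∈S)
              ... | inj₂ b∈ℓ = subst (_∈ Nbh Q p) (sym (x∈⁅y⁆⇒x≡y ℓ b∈ℓ)) (N-sym (graph Q) p∈ℓ)

          -- The leaf is adjacent only to p, so c has the same neighbours with and without it, and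
          -- the two draws commute.
          Gibbs-other : ∀ {c} → c ∈ V Q → c ≢ ℓ → c ≢ p → Gibbs L⁺ Q c
          Gibbs-other {c} c∈ c≢ℓ c≢p f f-dep = begin
            E L (K ⁅ p ⁆ ℓ f)
              ≡⟨ markov Q⁻ Q⁻-subtree (U⁺ c∈ c≢ℓ) (K ⁅ p ⁆ ℓ f) (K-dep f-dep) ⟩
            E L (K (Nbh Q⁻ c) c (K ⁅ p ⁆ ℓ f))
              ≡⟨ E-cong L (λ φ _ → K-comm {S = Nbh Q⁻ c} c≢p c≢ℓ (ℓ∉U ∘ support Q⁻) (DependsOn⇒Extensional f-dep) φ) ⟩
            E L (K ⁅ p ⁆ ℓ (K (Nbh Q⁻ c) c f))
              ≡⟨ cong (λ S → E L (K ⁅ p ⁆ ℓ (K S c f))) (⊆-antisym (λ b∈ → proj₁ (restrict⁻ Q U b∈)) fwd) ⟩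
            E L (K ⁅ p ⁆ ℓ (K (Nbh Q c) c f)) ∎
            where
            open ≡-Reasoning
            fwd : Nbh Q c ⊆ Nbh Q⁻ c
            fwd b∈ = Nbh-Q⁻ c∈ c≢ℓ (λ { refl → c≢p (Nbh-ℓ {Q} Q⊑ (N-sym (graph Q) b∈)) }) b∈

          joined-Gibbs : ∀ {c} → c ∈ V Q → Gibbs L⁺ Q c
          joined-Gibbs {c} c∈ with c ≟ᶠ ℓ | c ≟ᶠ p
          ... | yes refl | _        = Gibbs-ℓ
          ... | no _     | yes refl = Gibbs-p
          ... | no c≢ℓ   | no c≢p   = Gibbs-other c∈ c≢ℓ c≢p

      -- A subtree that avoids ℓ lies in H. One that contains ℓ but not p is ℓ alone, by
      -- connectedness. In the remaining case deleting ℓ leaves a subtree of H.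
      Markov-leaf : Markov L⁺ H⁺
      Markov-leaf Q (connected , Q⊑) c∈ with ℓ ∈? V Q | p ∈? V Q
      ... | no ℓ∉Q  | _       = Gibbs-old {X} {Y} L {⁅ p ⁆} {ℓ} W≢0 X⇒Y {Q} ℓ∉Q (markov Q (connected
              , (λ {a} a∈ → V-old {Q} Q⊑ (∉⇒≢ a∈ ℓ∉Q) a∈)
              , (λ a b∈ → Nbh-old {Q} Q⊑ (∉⇒≢ (∈-Nbh⇒∈V Q b∈) ℓ∉Q) (∉⇒≢ (support Q b∈) ℓ∉Q) b∈)) c∈)
      ... | yes ℓ∈Q | yes p∈Q = joined-Gibbs Q connected Q⊑ ℓ∈Q p∈Q c∈
      ... | yes ℓ∈Q | no p∉Q  = isolated-Gibbs Q connected Q⊑ ℓ∈Q p∉Q c∈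

  -- Simple paths and cycles

  Unique⇒lookup-injective : ∀ {A : Set} {xs : List A} → Unique xs → Injective _≡_ _≡_ (List.lookup xs)
  Unique⇒lookup-injective (x∉ ∷ u) {zero}  {zero}  eq = refl
  Unique⇒lookup-injective (x∉ ∷ u) {zero}  {suc j} eq = contradiction eq (All.lookup x∉ (∈-lookup j))
  Unique⇒lookup-injective (x∉ ∷ u) {suc i} {zero}  eq = contradiction (sym eq) (All.lookup x∉ (∈-lookup i))
  Unique⇒lookup-injective (x∉ ∷ u) {suc i} {suc j} eq = cong suc (Unique⇒lookup-injective u eq)

  Unique-snoc : ∀ {A : Set} {xs : List A} {y} → Unique xs → All (_≢ y) xs → Unique (xs ++ y ∷ [])
  Unique-snoc []       []          = [] ∷ []
  Unique-snoc (x∉ ∷ u) (x≢y ∷ ≢y) = All-++⁺ x∉ (x≢y ∷ []) ∷ Unique-snoc u ≢y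

  module _ {h : ℕ} (T : SubGraph h) where

    data Chain : Fin h → List (Fin h) → Fin h → Set where
      stop : ∀ {u} → Chain u [] u
      step : ∀ {u w xs v} → w ∈ Nbh T u → Chain w xs v → Chain u (w ∷ xs) v

    Chain-snoc : ∀ {u xs v w} → Chain u xs v → w ∈ Nbh T v → Chain u (xs ++ w ∷ []) w
    Chain-snoc stop           vw = step vw stop
    Chain-snoc (step uw rest) vw = step uw (Chain-snoc rest vw)

    Chain-edge : ∀ {u xs v} → Chain u xs v → ∀ i → List.lookup (u ∷ xs) (suc i) ∈ Nbh T (List.lookup (u ∷ xs) (inject₁ i))
    Chain-edge (step uw rest) zero    = uw
    Chain-edge (step uw rest) (suc i) = Chain-edge rest i

    Chain-last : ∀ {u xs v} → Chain u xs v → List.lookup (u ∷ xs) (fromℕ (length xs)) ≡ v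
    Chain-last stop           = refl
    Chain-last (step uw rest) = Chain-last rest

    record SimplePath (U : Subset h) (u v : Fin h) : Set where
      field
        {vertices} : List (Fin h)
        chain      : Chain u vertices v
        unique     : Unique (u ∷ vertices)
        inside-U   : All (_∈ U) (u ∷ vertices)

    open SimplePath

    close-path : ∀ {U u v ℓ} → SimplePath U u v → u ≢ v → ℓ ∉ U → u ∈ Nbh T ℓ → ℓ ∈ Nbh T v → HasCycle T
    close-path record { chain = stop } u≢v _ _ _ = contradiction refl u≢v
    close-path {U} {u} {v} {ℓ} record { vertices = w ∷ xs ; chain = chain@(step _ _) ; unique = unique ; inside-U = all∈ } _ ℓ∉U ℓu vℓ =
      -- The cycle consists of ℓ, u, w and the vertices of xs, that is `length xs + 3` vertices,
      -- which matches the offset in `HasCycle`.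
      length xs , List.lookup (ℓ ∷ u ∷ w ∷ xs) ,
      Unique⇒lookup-injective (All.map (λ { x∈U refl → ℓ∉U x∈U }) all∈ ∷ unique) ,
      Chain-edge (step ℓu chain) ,
      subst (λ y → ℓ ∈ Nbh T y) (sym (Chain-last (step ℓu chain))) vℓ

    crossing-edge : ∀ {U : Subset h} {u v} → Star (λ a b → b ∈ Nbh T a) u v → u ∈ U → v ∉ U →
                    ∃[ p ] ∃[ ℓ ] (p ∈ U × ℓ ∉ U × ℓ ∈ Nbh T p)
    crossing-edge ε u∈U u∉U = contradiction u∈U u∉U
    crossing-edge {U} {u} (_◅_ {j = w} uw walk) u∈U v∉U with w ∈? U
    ... | yes w∈U = crossing-edge walk w∈U v∉U
    ... | no w∉U  = u , w , u∈U , w∉U , uw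

    module _ {U : Subset h} (paths : ∀ {u v} → u ∈ U → v ∈ U → SimplePath U u v)
      {p ℓ : Fin h} (p∈U : p ∈ U) (ℓ∉U : ℓ ∉ U) (pℓ : ℓ ∈ Nbh T p) where

      private
        U⁺ = U ∪ ⁅ ℓ ⁆

        U⊆U⁺ : ∀ {a} → a ∈ U → a ∈ U⁺
        U⊆U⁺ a∈ = x∈p∪q⁺ (inj₁ a∈)

        ℓ∈U⁺ : ℓ ∈ U⁺
        ℓ∈U⁺ = x∈p∪q⁺ (inj₂ (x∈⁅x⁆ ℓ))

      -- A second neighbour of ℓ in U would close a cycle with the path inside U from p. Hence each
      -- vertex reached from U is attached as a leaf.
      unique-parent : ¬ HasCycle T → ∀ {q} → q ∈ U → ℓ ∈ Nbh T q → q ≡ p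
      unique-parent acyclic {q} q∈U qℓ with p ≟ᶠ q
      ... | yes p≡q = sym p≡q
      ... | no p≢q  = contradiction (close-path (paths p∈U q∈U) p≢q ℓ∉U (N-sym (graph T) pℓ) qℓ) acyclic

      extend-paths : ∀ {u v} → u ∈ U⁺ → v ∈ U⁺ → SimplePath U⁺ u v
      extend-paths {u} {v} u∈ v∈ with x∈p∪q⁻ U ⁅ ℓ ⁆ u∈ | x∈p∪q⁻ U ⁅ ℓ ⁆ v∈
      ... | inj₁ u∈U | inj₁ v∈U = let π = paths u∈U v∈U in
        record { chain = chain π ; unique = unique π ; inside-U = All.map U⊆U⁺ (inside-U π) }
      ... | inj₁ u∈U | inj₂ v∈ℓ with x∈⁅y⁆⇒x≡y ℓ v∈ℓ
      ...   | refl = let π = paths u∈U p∈U in record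
        { chain    = Chain-snoc (chain π) pℓ
        ; unique   = Unique-snoc (unique π) (All.map (λ { x∈U refl → ℓ∉U x∈U }) (inside-U π))
        ; inside-U = All-++⁺ (All.map U⊆U⁺ (inside-U π)) (ℓ∈U⁺ ∷ []) }
      extend-paths {u} {v} u∈ v∈ | inj₂ u∈ℓ | inj₁ v∈U with x∈⁅y⁆⇒x≡y ℓ u∈ℓ
      ...   | refl = let π = paths p∈U v∈U in record
        { chain    = step (N-sym (graph T) pℓ) (chain π)
        ; unique   = All.map (λ { x∈U refl → ℓ∉U x∈U }) (inside-U π) ∷ unique π
        ; inside-U = ℓ∈U⁺ ∷ All.map U⊆U⁺ (inside-U π) }
      extend-paths {u} {v} u∈ v∈ | inj₂ u∈ℓ | inj₂ v∈ℓ with x∈⁅y⁆⇒x≡y ℓ u∈ℓ | x∈⁅y⁆⇒x≡y ℓ v∈ℓ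
      ...   | refl | refl = record { chain = stop ; unique = [] ∷ [] ; inside-U = ℓ∈U⁺ ∷ [] }

      module _ (acyclic : ¬ HasCycle T) where

        restrict-adjoins : Adjoins (restrict T U) ℓ ⁅ p ⁆ (restrict T U⁺)
        restrict-adjoins = record { fresh = ℓ∉U ; vertices = refl ; adjacent = λ a b → mk⇔ to (from a b) }
          where
          to : ∀ {a b} → b ∈ Nbh (restrict T U⁺) a → b ∈ Nbh (restrict T U) a ⊎ (a ≡ ℓ × b ∈ ⁅ p ⁆) ⊎ (b ≡ ℓ × a ∈ ⁅ p ⁆)
          to {a} {b} b∈ with restrict⁻ T U⁺ {a} b∈
          ... | ab , a∈ , b∈′ with x∈p∪q⁻ U ⁅ ℓ ⁆ a∈ | x∈p∪q⁻ U ⁅ ℓ ⁆ b∈′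
          ...   | inj₁ a∈U | inj₁ b∈U = inj₁ (restrict⁺ T U ab a∈U b∈U)
          ...   | inj₁ a∈U | inj₂ b∈ℓ with x∈⁅y⁆⇒x≡y ℓ b∈ℓ
          ...     | refl = inj₂ (inj₂ (refl , subst (_∈ ⁅ p ⁆) (sym (unique-parent acyclic a∈U ab)) (x∈⁅x⁆ p)))
          to {a} {b} b∈ | ab , a∈ , b∈′ | inj₂ a∈ℓ | inj₁ b∈U with x∈⁅y⁆⇒x≡y ℓ a∈ℓ
          ...     | refl = inj₂ (inj₁ (refl , subst (_∈ ⁅ p ⁆) (sym (unique-parent acyclic b∈U (N-sym (graph T) ab))) (x∈⁅x⁆ p)))
          to {a} {b} b∈ | ab , a∈ , b∈′ | inj₂ a∈ℓ | inj₂ b∈ℓ with x∈⁅y⁆⇒x≡y ℓ a∈ℓ | x∈⁅y⁆⇒x≡y ℓ b∈ℓ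
          ...     | refl | refl = contradiction ab (irrefl (graph T))
          from : ∀ a b → b ∈ Nbh (restrict T U) a ⊎ (a ≡ ℓ × b ∈ ⁅ p ⁆) ⊎ (b ≡ ℓ × a ∈ ⁅ p ⁆) → b ∈ Nbh (restrict T U⁺) a
          from a b (inj₁ b∈) with restrict⁻ T U {a} b∈
          ... | ab , a∈U , b∈U = restrict⁺ T U⁺ ab (U⊆U⁺ a∈U) (U⊆U⁺ b∈U)
          from a b (inj₂ (inj₁ (refl , b∈p))) with x∈⁅y⁆⇒x≡y p b∈p
          ... | refl = restrict⁺ T U⁺ (N-sym (graph T) pℓ) ℓ∈U⁺ (U⊆U⁺ p∈U)
          from a b (inj₂ (inj₂ (refl , a∈p))) with x∈⁅y⁆⇒x≡y p a∈p
          ... | refl = restrict⁺ T U⁺ pℓ (U⊆U⁺ p∈U) ℓ∈U⁺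

        Nbh-restrict-leaf : Nbh (restrict T U⁺) ℓ ≡ ⁅ p ⁆
        Nbh-restrict-leaf = ⊆-antisym fwd
          (λ {b} b∈p → Equivalence.from (Adjoins.adjacent restrict-adjoins ℓ b) (inj₂ (inj₁ (refl , b∈p))))
          where
          fwd : Nbh (restrict T U⁺) ℓ ⊆ ⁅ p ⁆
          fwd {b} b∈ with Equivalence.to (Adjoins.adjacent restrict-adjoins ℓ b) b∈
          ... | inj₁ b∈U = contradiction (∈-Nbh⇒∈V (restrict T U) b∈U) ℓ∉U
          ... | inj₂ (inj₁ (_ , b∈p)) = b∈p
          ... | inj₂ (inj₂ (_ , ℓ∈p)) = contradiction (subst (_∈ U) (sym (x∈⁅y⁆⇒x≡y p ℓ∈p)) p∈U) ℓ∉U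

  -- The random map of a presentation

  module _ {r h : ℕ} where

    -- The seed tree is charged h, a bound for its number of vertices, so that the total collision
    -- probability is at most κ per step.
    steps : ∀ {H : SubGraph h} {𝒯} → Presentation r H 𝒯 → ℕ
    steps (seed _)           = h
    steps (flip p _ _ _ _ _) = suc (steps p)

  module Realise {n : ℕ} (G : Graph n) {h : ℕ} (φ₀ : Fin h → Fin n) (M≢0 : Kernel.M G ≢ 0ℚ)
    {r : ℕ} (1≤r : 1 ℕ.≤ r) (scale : Kernel.Scale G r) where

    open Kernel G
    open Laws G {h}
    open Realisations G {h} hiding (law; markov; collision)
    open Leaf G {h}
    open Scale scale
    open Collisions scale
    open Flip scale

    -- The price of one new vertex: one summand for the low labels, one for the others, each with a
    -- factor h for the older labels that may be hit.
    κ : ℚ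
    κ = ι h * η + ι h * η

    0≤κ : 0ℚ ≤ κ
    0≤κ = +-nonNeg (*-nonNeg (ι-nonNeg h) 0≤η) (*-nonNeg (ι-nonNeg h) 0≤η)

    module _ {R : SubGraph h} (tree : IsTree R) where

      private
        root : Fin h
        root = proj₁ (proj₁ (proj₁ tree))

        root∈R : root ∈ V R
        root∈R = proj₂ (proj₁ (proj₁ tree))

        acyclic : ¬ HasCycle R
        acyclic = proj₂ tree

      module _ where
        private
          H₀ : SubGraph h
          H₀ = restrict R ⁅ root ⁆

          W≢0 : ∀ φ → φ ≡ φ₀ → W ⊥ φ ≢ 0ℚ
          W≢0 φ _ = subst (_≢ 0ℚ) (sym (W-⊥ φ)) M≢0

          hom₀ : ∀ φ v → φ ≡ φ₀ → ω ⊥ φ v ≢ 0ℚ → Hom H₀ (upd φ root v)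
          hom₀ φ v _ ω≢0 =
              (λ {a} a∈ → subst (λ u → D u ≢ 0ℚ) (sym (trans (cong (upd φ root v) (x∈⁅y⁆⇒x≡y root a∈)) (upd-≡ φ root v)))
                 (ω≢0⇒D≢0 {S = ⊥} {φ} ω≢0))
            , (λ {a} {b} b∈ → let (ab , a∈ , b∈′) = restrict⁻ R ⁅ root ⁆ {a} b∈ in contradiction
                 (subst₂ (λ a b → b ∈ Nbh R a) (x∈⁅y⁆⇒x≡y root a∈) (x∈⁅y⁆⇒x≡y root b∈′) ab) (irrefl (graph R)))

        root-law : Law (Hom H₀)
        root-law = resample (dirac φ₀) ⊥ root W≢0 hom₀

        root-Markov : Markov root-law H₀
        root-Markov Q (_ , (V⊆ , N⊆)) {c} c∈ f f-dep = begin
          E root-law f                    ≡⟨ sym (E-independent {_≡ φ₀} {Hom H₀} (dirac φ₀) {⊥} {root} W≢0 hom₀ {_∈ ⊥}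
                                               (K-depends {S = ⊥} {Y = _∈ ⊥} f-dep (λ a → id)
                                                 λ a a∈ a≢root → contradiction (x∈⁅y⁆⇒x≡y root (V⊆ a∈)) a≢root) ∉⊥) ⟩
          E root-law (K ⊥ root f)         ≡⟨ cong₂ (λ S y → E root-law (K S y f)) (sym Nbh≡⊥) (sym c≡root) ⟩
          E root-law (K (Nbh Q c) c f)    ∎
          where
          open ≡-Reasoning
          c≡root : c ≡ root
          c≡root = x∈⁅y⁆⇒x≡y root (V⊆ c∈)
          Nbh≡⊥ : Nbh Q c ≡ ⊥
          Nbh≡⊥ = Empty-unique λ (b , b∈) → irrefl (graph Q)
            (subst (_∈ Nbh Q c) (trans (x∈⁅y⁆⇒x≡y root (V⊆ (support Q b∈))) (sym c≡root)) b∈)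

        root-collision : E root-law (collides ⁅ root ⁆) ≤ ι ∣ ⁅ root ⁆ ∣ * κ
        root-collision = begin
          E root-law (collides ⁅ root ⁆) ≡⟨ E-cong root-law (λ φ _ → collides-injective {U = ⁅ root ⁆} {φ} λ a b a∈ b∈ _ →
                                              trans (x∈⁅y⁆⇒x≡y root a∈) (sym (x∈⁅y⁆⇒x≡y root b∈))) ⟩
          E root-law (λ _ → 0ℚ)          ≡⟨ E-const root-law 0ℚ ⟩
          0ℚ                             ≤⟨ *-nonNeg (ι-nonNeg ∣ ⁅ root ⁆ ∣) 0≤κ ⟩
          ι ∣ ⁅ root ⁆ ∣ * κ             ∎
          where open ℚ.≤-Reasoning

      -- Simple paths inside U belong to the invariant because acyclicity of R excludes only
      -- explicit cycles: out of them comes the cycle that a second edge from a new vertex into U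
      -- would create.
      record Stage (U : Subset h) : Set where
        field
          root∈     : root ∈ U
          U⊆V       : U ⊆ V R
          paths     : ∀ {u v} → u ∈ U → v ∈ U → SimplePath R U u v
          law       : Law (Hom (restrict R U))
          markov    : Markov law (restrict R U)
          collision : E law (collides U) ≤ ι ∣ U ∣ * κ

      root-stage : Stage ⁅ root ⁆
      root-stage = record
        { root∈     = x∈⁅x⁆ root
        ; U⊆V       = λ {a} a∈ → subst (_∈ V R) (sym (x∈⁅y⁆⇒x≡y root a∈)) root∈R
        ; paths     = λ {u} {v} u∈ v∈ → subst₂ (SimplePath R ⁅ root ⁆) (sym (x∈⁅y⁆⇒x≡y root u∈)) (sym (x∈⁅y⁆⇒x≡y root v∈))
                        record { chain = stop ; unique = [] ∷ [] ; inside-U = x∈⁅x⁆ root ∷ [] }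
        ; law       = root-law
        ; markov    = root-Markov
        ; collision = root-collision
        }

      ∪⁅⁆-size : ∀ {U : Subset h} {ℓ} → ℓ ∉ U → suc ∣ U ∣ ℕ.≤ ∣ U ∪ ⁅ ℓ ⁆ ∣
      ∪⁅⁆-size {U} {ℓ} ℓ∉U = p⊂q⇒∣p∣<∣q∣ (p⊆p∪q {p = U} ⁅ ℓ ⁆ , ℓ , x∈p∪q⁺ (inj₂ (x∈⁅x⁆ ℓ)) , ℓ∉U)

      grow : ∀ {U} → Stage U → ∀ {p ℓ} → p ∈ U → ℓ ∉ U → ℓ ∈ Nbh R p → Stage (U ∪ ⁅ ℓ ⁆)
      grow {U} stage {p} {ℓ} p∈U ℓ∉U pℓ = record
        { root∈     = x∈p∪q⁺ (inj₁ root∈)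
        ; U⊆V       = U⁺⊆V
        ; paths     = extend-paths R paths p∈U ℓ∉U pℓ
        ; law       = L⁺
        ; markov    = markov⁺
        ; collision = begin
            -- A step to a leaf is a draw with neighbour set `⁅ p ⁆`, so the collision estimate of a
            -- flip of size 1 applies.
            E L⁺ (collides U⁺)           ≤⟨ collision-step {Hom (restrict R U)} {Hom (restrict R U⁺)} law {⁅ p ⁆} {ℓ} W≢0 hom⁺ {restrict R U⁺} {U} ℓ∉U markov⁺
                                              (x∈p∪q⁺ (inj₂ (x∈⁅x⁆ ℓ))) (Nbh-restrict-leaf R paths p∈U ℓ∉U pℓ acyclic) (∣⁅x⁆∣≡1 p) 1≤r ⟩
            E law (collides U) + κ       ≤⟨ ℚ.+-monoˡ-≤ κ collision ⟩
            ι ∣ U ∣ * κ + κ              ≡⟨ solve 2 (λ x y → x :* y :+ y := (con 1ℚ :+ x) :* y) refl (ι ∣ U ∣) κ ⟩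
            ι (suc ∣ U ∣) * κ            ≤⟨ *-monoˡ 0≤κ (ι-mono (∪⁅⁆-size ℓ∉U)) ⟩
            ι ∣ U⁺ ∣ * κ                 ∎
        }
        where
        open ℚ.≤-Reasoning
        open +-*-Solver
        open Stage stage
        U⁺ = U ∪ ⁅ ℓ ⁆
        U⁺⊆V : U⁺ ⊆ V R
        U⁺⊆V a∈ with x∈p∪q⁻ U ⁅ ℓ ⁆ a∈
        ... | inj₁ a∈U = U⊆V a∈U
        ... | inj₂ a∈ℓ = subst (_∈ V R) (sym (x∈⁅y⁆⇒x≡y ℓ a∈ℓ)) (support R pℓ)
        adjoins = restrict-adjoins R paths p∈U ℓ∉U pℓ acyclic
        W≢0 : ∀ φ → Hom (restrict R U) φ → W ⁅ p ⁆ φ ≢ 0ℚ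
        W≢0 φ (D≢0 , _) = subst (_≢ 0ℚ) (sym (W-singleton p φ)) (D≢0 p∈U)
        hom⁺ : ∀ φ v → Hom (restrict R U) φ → ω ⁅ p ⁆ φ v ≢ 0ℚ → Hom (restrict R U⁺) (upd φ ℓ v)
        hom⁺ = Hom-adjoin {restrict R U} {restrict R U⁺} {ℓ} {⁅ p ⁆} adjoins
          (λ a∈p → subst (_∈ U) (sym (x∈⁅y⁆⇒x≡y p a∈p)) p∈U)
        L⁺ : Law (Hom (restrict R U⁺))
        L⁺ = resample law ⁅ p ⁆ ℓ W≢0 hom⁺
        markov⁺ : Markov L⁺ (restrict R U⁺)
        markov⁺ = Markov-leaf {restrict R U} {restrict R U⁺} adjoins p∈U {Hom (restrict R U)} {Hom (restrict R U⁺)} law W≢0 hom⁺ markov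

      finish : ∀ {U} → Stage U → V R ⊆ U → Realisation R (_IsSubtreeOf R) (ι h * κ)
      finish {U} stage V⊆U = record
        { law       = weaken (Hom-⊑ {restrict R U} {R} R⊑) law
        ; markov    = λ {Q} (_ , Q⊑R) → Markov-subtree {Q = Q} {restrict R U} {law} markov (⊑-trans {S = Q} {R} {restrict R U} Q⊑R R⊑)
        ; live-⊑    = proj₂
        ; live-conn = proj₁
        ; collision = begin
            E law (collides (V R)) ≡⟨ cong (λ U → E law (collides U)) (⊆-antisym V⊆U U⊆V) ⟩
            E law (collides U)     ≤⟨ collision ⟩
            ι ∣ U ∣ * κ            ≤⟨ *-monoˡ 0≤κ (ι-mono (∣p∣≤n U)) ⟩
            ι h * κ                ∎
        }
        where
        open ℚ.≤-Reasoning
        open Stage stage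
        R⊑ : R ⊑ restrict R U
        R⊑ = V⊆U , λ a b∈ → restrict⁺ R U b∈ (V⊆U (∈-Nbh⇒∈V R b∈)) (V⊆U (support R b∈))

      -- The counter k bounds the number of labels still outside U; at zero U is everything and no
      -- vertex of R can be missing.
      complete : ∀ k {U} → h ℕ.≤ ∣ U ∣ ℕ.+ k → Stage U → Realisation R (_IsSubtreeOf R) (ι h * κ)
      complete k {U} h≤ stage with any? (λ a → (a ∈? V R) ×-dec ¬? (a ∈? U))
      ... | no ¬missing = finish stage λ {a} a∈ → by-cases a∈ (a ∈? U)
        where
        by-cases : ∀ {a} → a ∈ V R → Dec (a ∈ U) → a ∈ U
        by-cases a∈ (yes a∈U) = a∈U
        by-cases a∈ (no a∉U)  = contradiction (_ , a∈ , a∉U) ¬missing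
      complete zero {U} h≤ stage | yes (a , _ , a∉U) = contradiction (subst (a ∈_) (sym U≡⊤) ∈⊤) a∉U
        where
        U≡⊤ : U ≡ ⊤
        U≡⊤ = ∣p∣≡n⇒p≡⊤ (ℕ.≤-antisym (∣p∣≤n U) (subst (h ℕ.≤_) (ℕ.+-identityʳ ∣ U ∣) h≤))
      complete (suc k) {U} h≤ stage | yes (a , a∈ , a∉U)
        with crossing-edge R (proj₂ (proj₁ tree) root a root∈R a∈) (Stage.root∈ stage) a∉U
      ... | p , ℓ , p∈U , ℓ∉U , pℓ = complete k
        (ℕ.≤-trans h≤ (ℕ.≤-trans (ℕ.≤-reflexive (ℕ.+-suc ∣ U ∣ k)) (ℕ.+-monoˡ-≤ k (∪⁅⁆-size ℓ∉U))))
        (grow stage p∈U ℓ∉U pℓ)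

      seed-realisation : Realisation R (_IsSubtreeOf R) (ι h * κ)
      seed-realisation = complete h (ℕ.m≤n+m h ∣ ⁅ root ⁆ ∣) root-stage

    realise : ∀ {H 𝒯} (p : Presentation r H 𝒯) → Realisation H 𝒯 (ι (steps p) * κ)
    realise (seed tree) = seed-realisation tree
    realise {H} (flip {𝒯 = 𝒯} p {T} T-live c∈T 1≤deg deg≤r {x} adjoins) =
      subst (Realisation H (flipFamily 𝒯 T _ x)) (solve 2 (λ x y → x :* y :+ y := (con 1ℚ :+ x) :* y) refl (ι (steps p)) κ)
        (flip-realisation (realise p) T-live c∈T 1≤deg deg≤r adjoins)
      where open +-*-Solver

  -- Dense graphs

  sumList : ∀ {A : Set} → (A → ℚ) → List A → ℚ
  sumList f []       = 0ℚ
  sumList f (x ∷ xs) = f x + sumList f xs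

  sumList-++ : ∀ {A : Set} (f : A → ℚ) xs ys → sumList f (xs ++ ys) ≡ sumList f xs + sumList f ys
  sumList-++ f []       ys = sym (ℚ.+-identityˡ (sumList f ys))
  sumList-++ f (x ∷ xs) ys = trans (cong (f x +_) (sumList-++ f xs ys)) (sym (ℚ.+-assoc (f x) (sumList f xs) (sumList f ys)))

  sumList-map : ∀ {A B : Set} (f : B → ℚ) (g : A → B) xs → sumList f (map g xs) ≡ sumList (f ∘ g) xs
  sumList-map f g []       = refl
  sumList-map f g (x ∷ xs) = cong (f (g x) +_) (sumList-map f g xs)

  sumList-product : ∀ {A B : Set} (f : A × B → ℚ) xs ys →
                    sumList f (cartesianProduct xs ys) ≡ sumList (λ a → sumList (λ b → f (a , b)) ys) xs
  sumList-product f []       ys = refl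
  sumList-product f (x ∷ xs) ys = trans (sumList-++ f (map (x ,_) ys) (cartesianProduct xs ys))
    (cong₂ _+_ (sumList-map f (x ,_) ys) (sumList-product f xs ys))

  sumList-tabulate : ∀ {A : Set} {k} (f : A → ℚ) (g : Fin k → A) → sumList f (List.tabulate g) ≡ sum (f ∘ g)
  sumList-tabulate {k = zero}  f g = refl
  sumList-tabulate {k = suc k} f g = cong (f (g zero) +_) (sumList-tabulate f (g ∘ suc))

  length-filter≤sumList : ∀ {A : Set} {P : A → Set} (P? : Decidable P) {f : A → ℚ} → (∀ x → 0ℚ ≤ f x) →
                          (∀ x → P x → 1ℚ ≤ f x) → ∀ xs → ι (length (filter P? xs)) ≤ sumList f xs
  length-filter≤sumList P? 0≤f 1≤f []       = ℚ.≤-refl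
  length-filter≤sumList P? 0≤f 1≤f (x ∷ xs) with P? x
  ... | yes Px = ℚ.+-mono-≤ (1≤f x Px) (length-filter≤sumList P? 0≤f 1≤f xs)
  ... | no _   = ℚ.≤-trans (length-filter≤sumList P? 0≤f 1≤f xs) (p≤q+p (0≤f x))

  length-cartesianProduct : ∀ {A B : Set} (xs : List A) (ys : List B) → length (cartesianProduct xs ys) ≡ length xs ℕ.* length ys
  length-cartesianProduct []       ys = refl
  length-cartesianProduct (x ∷ xs) ys = trans (length-++ (map (x ,_) ys))
    (cong₂ ℕ._+_ (length-map (x ,_) ys) (length-cartesianProduct xs ys))

  e≤M : ∀ {n} (G : Graph n) → ι (e G) ≤ Kernel.M G
  e≤M {n} G = begin
    ι (e G)
      ≤⟨ length-filter≤sumList (λ (a , b) → (a <ᶠ? b) ×-dec (b ∈? N G a)) {λ (a , b) → A a b}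
           (λ (a , b) → A-nonNeg a b) (λ (a , b) (_ , ab) → ℚ.≤-reflexive (sym (A-adjacent ab)))
           (cartesianProduct (allFin n) (allFin n)) ⟩
    sumList (λ (a , b) → A a b) (cartesianProduct (allFin n) (allFin n))
      ≡⟨ sumList-product (λ (a , b) → A a b) (allFin n) (allFin n) ⟩
    sumList (λ a → sumList (A a) (allFin n)) (allFin n)
      ≡⟨ sumList-tabulate (λ a → sumList (A a) (allFin n)) id ⟩
    sum (λ a → sumList (A a) (allFin n))
      ≡⟨ sum-cong-≗ (λ a → sumList-tabulate (A a) id) ⟩
    M ∎
    where
    open ℚ.≤-Reasoning
    open Kernel G

  e≤n² : ∀ {n} (G : Graph n) → e G ℕ.≤ n ℕ.* n
  e≤n² {n} G = ℕ.≤-trans (length-filter (λ (a , b) → (a <ᶠ? b) ×-dec (b ∈? N G a)) (cartesianProduct (allFin n) (allFin n)))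
    (ℕ.≤-reflexive (trans (length-cartesianProduct (allFin n) (allFin n))
      (cong₂ ℕ._*_ (length-tabulate {n = n} id) (length-tabulate {n = n} id))))

  -- Flips of every size up to r must be served. The hypothesis says that the density e/m², with m =
  -- n + 1, has r-th power at least `C ^ r` / m. As the density is at most 1, its lower powers are
  -- at least as large. Denominators are cleared by `(m * m) ^ d`.
  lower-powers : ∀ {r k n e C} → suc k ℕ.≤ r → e ℕ.≤ suc n ℕ.* suc n →
    C ℕ.^ r ℕ.* suc n ℕ.^ (2 ℕ.* r ℕ.∸ 1) ℕ.≤ e ℕ.^ r →
    C ℕ.^ r ℕ.* (suc n ℕ.^ k ℕ.* suc n ℕ.^ suc k) ℕ.≤ e ℕ.^ suc k
  lower-powers {r} {k} {n} {e} {C} k<r e≤ dense = ℕ.*-cancelʳ-≤ _ _ ((m ℕ.* m) ℕ.^ d) {{nonZero}} (begin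
    C ℕ.^ r ℕ.* (m ℕ.^ k ℕ.* m ℕ.^ suc k) ℕ.* (m ℕ.* m) ℕ.^ d
      ≡⟨ ℕ.*-assoc (C ℕ.^ r) (m ℕ.^ k ℕ.* m ℕ.^ suc k) ((m ℕ.* m) ℕ.^ d) ⟩
    C ℕ.^ r ℕ.* (m ℕ.^ k ℕ.* m ℕ.^ suc k ℕ.* (m ℕ.* m) ℕ.^ d)
      ≡⟨ cong (C ℕ.^ r ℕ.*_) powers ⟩
    C ℕ.^ r ℕ.* m ℕ.^ (2 ℕ.* r ℕ.∸ 1)
      ≤⟨ dense ⟩
    e ℕ.^ r                    ≡⟨ cong (e ℕ.^_) (sym r≡) ⟩
    e ℕ.^ (suc k ℕ.+ d)        ≡⟨ ℕ.^-distribˡ-+-* e (suc k) d ⟩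
    e ℕ.^ suc k ℕ.* e ℕ.^ d    ≤⟨ ℕ.*-monoʳ-≤ (e ℕ.^ suc k) (ℕ.^-monoˡ-≤ d e≤) ⟩
    e ℕ.^ suc k ℕ.* (m ℕ.* m) ℕ.^ d ∎)
    where
    open ℕ.≤-Reasoning
    m = suc n
    d = r ℕ.∸ suc k
    r≡ : suc k ℕ.+ d ≡ r
    r≡ = ℕ.m+[n∸m]≡n k<r
    nonZero : ℕ.NonZero ((m ℕ.* m) ℕ.^ d)
    nonZero = ℕ.m^n≢0 (m ℕ.* m) d
    exponent : k ℕ.+ suc k ℕ.+ 2 ℕ.* d ≡ 2 ℕ.* r ℕ.∸ 1
    exponent = trans
      -- The right side is what `2 * s ∸ 1` computes to for `s = suc (k + d)`: the subtraction
      -- removes the outer successor, and the last 0 ends the unfolded product.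
      (solve 2 (λ x y → x :+ (con 1 :+ x) :+ con 2 :* y := x :+ y :+ (con 1 :+ (x :+ y) :+ con 0)) refl k d)
      (cong (λ s → 2 ℕ.* s ℕ.∸ 1) r≡)
      where open ℕSolver.+-*-Solver
    powers : m ℕ.^ k ℕ.* m ℕ.^ suc k ℕ.* (m ℕ.* m) ℕ.^ d ≡ m ℕ.^ (2 ℕ.* r ℕ.∸ 1)
    powers = begin-equality
      m ℕ.^ k ℕ.* m ℕ.^ suc k ℕ.* (m ℕ.* m) ℕ.^ d
        ≡⟨ cong₂ ℕ._*_ (sym (ℕ.^-distribˡ-+-* m k (suc k)))
             (trans (cong (λ x → (m ℕ.* x) ℕ.^ d) (sym (ℕ.*-identityʳ m))) (ℕ.^-*-assoc m 2 d)) ⟩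
      m ℕ.^ (k ℕ.+ suc k) ℕ.* m ℕ.^ (2 ℕ.* d)
        ≡⟨ sym (ℕ.^-distribˡ-+-* m (k ℕ.+ suc k) (2 ℕ.* d)) ⟩
      m ℕ.^ (k ℕ.+ suc k ℕ.+ 2 ℕ.* d)
        ≡⟨ cong (m ℕ.^_) exponent ⟩
      m ℕ.^ (2 ℕ.* r ℕ.∸ 1) ∎

  ι≢0 : ∀ k → ι (suc k) ≢ 0ℚ
  ι≢0 k eq = ℚ.<-irrefl (sym eq) (ι-pos k)

  inv-antimono : ∀ {p q} → 0ℚ ≤ p → p ≢ 0ℚ → p ≤ q → inv q ≤ inv p
  inv-antimono {p} {q} 0≤p p≢0 p≤q = begin
    inv q                ≡⟨ sym (ℚ.*-identityʳ (inv q)) ⟩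
    inv q * 1ℚ           ≡⟨ cong (inv q *_) (sym (*-inv p≢0)) ⟩
    inv q * (p * inv p)  ≤⟨ *-monoʳ (inv-nonNeg (ℚ.≤-trans 0≤p p≤q)) (*-monoˡ (inv-nonNeg 0≤p) p≤q) ⟩
    inv q * (q * inv p)  ≡⟨ solve 3 (λ x y z → x :* (y :* z) := y :* x :* z) refl (inv q) q (inv p) ⟩
    q * inv q * inv p    ≤⟨ *-monoˡ (inv-nonNeg 0≤p) (p*inv-p≤1 q) ⟩
    1ℚ * inv p           ≡⟨ ℚ.*-identityˡ (inv p) ⟩
    inv p                ∎
    where
    open ℚ.≤-Reasoning
    open +-*-Solver

  1^k≡1 : ∀ k → 1ℚ ^ k ≡ 1ℚ
  1^k≡1 zero    = refl
  1^k≡1 (suc k) = trans (ℚ.*-identityˡ (1ℚ ^ k)) (1^k≡1 k)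

  module Dense {n : ℕ} (G : Graph (suc n)) {m : ℕ} (e≡ : e G ≡ suc m) (l r C : ℕ)
    (C-large : ∀ k → suc k ℕ.≤ r → suc l ℕ.^ suc k ℕ.≤ C)
    (e-large : ∀ k → suc k ℕ.≤ r → C ℕ.* (suc n ℕ.^ k ℕ.* suc n ℕ.^ suc k) ℕ.≤ suc m ℕ.^ suc k) where

    open Kernel G

    private
      X L Y i j x : ℚ
      X = ι (suc n)
      L = ι (suc l)
      Y = ι (suc m)
      x = inv X
      j = inv L
      i = inv Y

      Y≤M : Y ≤ M
      Y≤M = subst (λ k → ι k ≤ M) e≡ (e≤M G)

      0≤j : 0ℚ ≤ j
      0≤j = inv-nonNeg (ι-nonNeg (suc l))

      0≤i : 0ℚ ≤ i
      0≤i = inv-nonNeg (ι-nonNeg (suc m))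

      0≤x : 0ℚ ≤ x
      0≤x = inv-nonNeg (ι-nonNeg (suc n))

      0≤invM : 0ℚ ≤ inv M
      0≤invM = inv-nonNeg (ℚ.≤-trans (ι-nonNeg (suc m)) Y≤M)

      open ℚ.≤-Reasoning
      open +-*-Solver

    M≢0 : M ≢ 0ℚ
    M≢0 M≡0 = ℚ.<-irrefl refl (ℚ.<-≤-trans (ι-pos m) (subst (Y ≤_) M≡0 Y≤M))

    -- β is the inverse of the threshold degree Y/(X L), a fraction 1/L of edges per vertex, and γ
    -- is that threshold. Then the low labels have stationary probability at most Y/(L M), which is
    -- at most 1/L = η because Y is at most M.
    scale : Scale r
    scale = record
      { β = X * L * i ; γ = Y * j * x ; η = j
      ; 0≤β = *-nonNeg (*-nonNeg (ι-nonNeg (suc n)) (ι-nonNeg (suc l))) 0≤i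
      ; 0≤γ = *-nonNeg (*-nonNeg (ι-nonNeg (suc m)) 0≤j) 0≤x
      ; 0≤η = 0≤j
      ; 1≤γβ = ℚ.≤-reflexive (begin-equality
          1ℚ * 1ℚ * 1ℚ                 ≡⟨ cong₂ _*_ (cong₂ _*_ (sym (*-inv (ι≢0 m))) (sym (*-inv (ι≢0 l)))) (sym (*-inv (ι≢0 n))) ⟩
          Y * i * (L * j) * (X * x)    ≡⟨ solve 6 (λ Y i L j X x → Y :* i :* (L :* j) :* (X :* x) := Y :* j :* x :* (X :* L :* i)) refl Y i L j X x ⟩
          Y * j * x * (X * L * i)      ∎)
      ; low-bound = begin
          X * (Y * j * x) * inv M      ≡⟨ solve 5 (λ X Y j x w → X :* (Y :* j :* x) :* w := X :* x :* (j :* (Y :* w))) refl X Y j x (inv M) ⟩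
          X * x * (j * (Y * inv M))    ≡⟨ trans (cong (_* (j * (Y * inv M))) (*-inv (ι≢0 n))) (ℚ.*-identityˡ (j * (Y * inv M))) ⟩
          j * (Y * inv M)              ≤⟨ *-monoʳ 0≤j (ℚ.≤-trans (*-monoˡ 0≤invM Y≤M) (p*inv-p≤1 M)) ⟩
          j * 1ℚ                       ≡⟨ ℚ.*-identityʳ j ⟩
          j                            ∎
      ; star-bounds = star-bounds
      }
      where
      star-bounds : ∀ k → suc k ℕ.≤ r → (X * L * i) ^ k * (X ^ suc k * inv M) ≤ j
      -- With 1/M replaced by 1/Y the claim becomes that L^(k+1) X^(2k+1) is at most Y^(k+1), which
      -- is `C-large` combined with `e-large`.
      star-bounds k k<r = begin
        (X * L * i) ^ k * (X ^ suc k * inv M)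
          ≤⟨ *-monoʳ (^-nonNeg (*-nonNeg (*-nonNeg (ι-nonNeg (suc n)) (ι-nonNeg (suc l))) 0≤i) k)
               (*-monoʳ (^-nonNeg (ι-nonNeg (suc n)) (suc k)) (inv-antimono (ι-nonNeg (suc m)) (ι≢0 m) Y≤M)) ⟩
        (X * L * i) ^ k * (X ^ suc k * i)
          ≡⟨ cong (_* (X ^ suc k * i)) (trans (^-distrib-* (X * L) i k) (cong (_* i ^ k) (^-distrib-* X L k))) ⟩
        X ^ k * L ^ k * i ^ k * (X ^ suc k * i)
          ≡⟨ sym (ℚ.*-identityʳ _) ⟩
        X ^ k * L ^ k * i ^ k * (X ^ suc k * i) * 1ℚ
          ≡⟨ cong (X ^ k * L ^ k * i ^ k * (X ^ suc k * i) *_) (sym (inv-* (ι≢0 l))) ⟩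
        X ^ k * L ^ k * i ^ k * (X ^ suc k * i) * (j * L)
          ≡⟨ solve 7 (λ a b c d i j L → a :* b :* c :* (d :* i) :* (j :* L) := j :* (L :* b :* (a :* d) :* (i :* c))) refl
               (X ^ k) (L ^ k) (i ^ k) (X ^ suc k) i j L ⟩
        j * (L ^ suc k * (X ^ k * X ^ suc k) * i ^ suc k)
          ≡⟨ cong (λ w → j * (w * i ^ suc k)) (sym (trans (ι-homo-* (suc l ℕ.^ suc k) (suc n ℕ.^ k ℕ.* suc n ℕ.^ suc k))
               (cong₂ _*_ (ι-homo-^ (suc l) (suc k)) (trans (ι-homo-* (suc n ℕ.^ k) (suc n ℕ.^ suc k))
                 (cong₂ _*_ (ι-homo-^ (suc n) k) (ι-homo-^ (suc n) (suc k))))))) ⟩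
        j * (ι (suc l ℕ.^ suc k ℕ.* (suc n ℕ.^ k ℕ.* suc n ℕ.^ suc k)) * i ^ suc k)
          ≤⟨ *-monoʳ 0≤j (*-monoˡ (^-nonNeg 0≤i (suc k)) (ι-mono
               (ℕ.≤-trans (ℕ.*-monoˡ-≤ (suc n ℕ.^ k ℕ.* suc n ℕ.^ suc k) (C-large k k<r)) (e-large k k<r)))) ⟩
        j * (ι (suc m ℕ.^ suc k) * i ^ suc k)
          ≡⟨ cong (λ w → j * (w * i ^ suc k)) (ι-homo-^ (suc m) (suc k)) ⟩
        j * (Y ^ suc k * i ^ suc k)
          ≡⟨ cong (j *_) (trans (sym (^-distrib-* Y i (suc k))) (trans (cong (_^ suc k) (*-inv (ι≢0 m))) (1^k≡1 (suc k)))) ⟩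
        j * 1ℚ
          ≡⟨ ℚ.*-identityʳ j ⟩
        j ∎

    -- If G were H-free, every homomorphism would collide and the mean of `collides` would be 1. But
    -- that mean is at most l times η = 1/(l + 1), which is less than 1.
    ¬free : ∀ {h} {H : Graph h} {𝒯} → 1 ℕ.≤ r → (p : Presentation r (whole H) 𝒯) →
            l ≡ steps p ℕ.* (h ℕ.+ h) → ¬ Free H G
    ¬free {h} {H} 1≤r p refl free = ℚ.<-irrefl refl (begin-strict
      1ℚ                               ≡⟨ sym (E-1 μ) ⟩
      E μ (λ _ → 1ℚ)                   ≤⟨ E-mono μ (λ φ hom → ℚ.≤-reflexive (sym (collides-¬injective (not-injective φ hom)))) ⟩
      E μ (collides ⊤)                 ≤⟨ Realisation.collision R ⟩
      ι (steps p) * (ι h * j + ι h * j)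
        ≡⟨ solve 3 (λ s h j → s :* (h :* j :+ h :* j) := s :* (h :+ h) :* j) refl (ι (steps p)) (ι h) j ⟩
      ι (steps p) * (ι h + ι h) * j
        ≡⟨ cong (_* j) (sym (trans (ι-homo-* (steps p) (h ℕ.+ h)) (cong (ι (steps p) *_) (ι-homo-+ h h)))) ⟩
      ι l * j                          ≡⟨ sym (ℚ.+-identityˡ (ι l * j)) ⟩
      0ℚ + ι l * j                     <⟨ ℚ.+-monoˡ-< (ι l * j) (0≤∧≢0⇒0< 0≤j (inv-≢0 (ι≢0 l))) ⟩
      j + ι l * j                      ≡⟨ solve 2 (λ w j → j :+ w :* j := (con 1ℚ :+ w) :* j) refl (ι l) j ⟩
      L * j                            ≡⟨ *-inv (ι≢0 l) ⟩
      1ℚ                               ∎)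
      where
      open Laws G {h}
      open Realisations G {h} using (Realisation; module Realisation; Hom)
      R : Realisation (whole H) _ _
      R = Realise.realise G (λ _ → zero) M≢0 1≤r scale p
      μ : Law (Hom (whole H))
      μ = Realisation.law R
      not-injective : ∀ φ → Hom (whole H) φ → ¬ InjectiveOn ⊤ φ
      not-injective φ (_ , adj) inj = free (φ , (λ {a} {b} eq → inj a b ∈⊤ ∈⊤ eq) , λ a b ab → adj ab)

-- From the random map to the Turán number

open import Data.Nat using (ℕ; _≤_; _<_; _*_; _∸_; _^_)
open import Data.Product using (∃-syntax; _×_)

-- The bound appears as its r-th power, an equivalent inequality between natural numbers that avoids
-- the fractional exponent.
theorem1p4 : ∀ (r : ℕ) → 2 ≤ r → ∀ {h : ℕ} (H : Graph h) → IsStarFlipGraph r H →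
    ∃[ C ] 0 < C × (∀ (n : ℕ) → 1 ≤ n → ex n H ^ r ≤ C ^ r * n ^ (2 * r ∸ 1))
theorem1p4 r@(suc _) 2≤r {h} H (_ , p) = C , s≤s z≤n , bound
  where
  open Embedding using (steps; lower-powers; module Dense)
  l = steps p * (h ℕ.+ h)
  -- The requirement is that `C ^ r` dominate `suc l ^ suc k` for each flip size k + 1 up to r.
  C = suc l * suc l
  C-large : ∀ k → suc k ≤ r → suc l ^ suc k ≤ C ^ r
  C-large k k<r = ℕ.≤-trans (ℕ.^-monoʳ-≤ (suc l) k<r) (ℕ.^-monoˡ-≤ r (ℕ.m≤m*n (suc l) (suc l)))
  bound : ∀ n → 1 ≤ n → ex n H ^ r ≤ C ^ r * n ^ (2 * r ∸ 1)
  bound (suc n) _ with ex-attained H {suc n}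
  -- Since r is matched as a successor, `0 ^ r` computes to 0; the same settles an extremal graph
  -- without edges below.
  ... | inj₂ (_ , ex≡0) = subst (λ x → x ^ r ≤ C ^ r * suc n ^ (2 * r ∸ 1)) (sym ex≡0) z≤n
  ... | inj₁ (G , free , e≡ex) = subst (λ x → x ^ r ≤ C ^ r * suc n ^ (2 * r ∸ 1)) e≡ex (by-cases (e G) refl)
    where
    by-cases : ∀ x → e G ≡ x → x ^ r ≤ C ^ r * suc n ^ (2 * r ∸ 1)
    by-cases zero    _  = z≤n
    -- Failure of the bound for an extremal G is exactly the density needed to embed H in it. An
    -- edge count of the form `suc m` makes the weight M nonzero.
    by-cases (suc m) e≡ = ℕ.≮⇒≥ λ dense → Dense.¬free G e≡ l r (C ^ r) C-large
      (λ k k<r → lower-powers {r} {k} {n} {suc m} {C} k<r (subst (_≤ suc n * suc n) e≡ (Embedding.e≤n² G)) (ℕ.<⇒≤ dense))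
      (ℕ.<⇒≤ 2≤r) p refl free
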